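{- There exist absolute constants $C > 0$ and $c > 0$ such that the following holds. Let $\epsilon > 0$, let $d$ be a positive integer, and let $\mathbb{F}$ be a finite field with $q$ elements where $q > C \cdot d/\epsilon^7$. Suppose $f\colon \mathbb{F}^2 \to \mathbb{F}$ passes $\mathrm{LDT}_d$ with probability at least $\epsilon$, that is, \[ \Pr_{a,\ \ell \ni a}[f(a) = P_\ell(a)] \geq \epsilon. \] Then there is a polynomial $Q(x,y)$ of total degree at most $d$ such that $\Pr_{a \in \mathbb{F}^2}[f(a) = Q(a)] \geq c\,\epsilon^4$.
   Context: Lines in $\mathbb{F}^2$ are sets $\{b+tu: t\in\mathbb{F}\}$ with $u\neq 0$. For a line $\ell$, $P_\ell$ denotes a best-fit degree-$d$ polynomial for $f$ on $\ell$: a function on $\ell$ given (in a parametrization of $\ell$) by a univariate polynomial of degree at most $d$ that agrees with $f$ on the maximum number of points of $\ell$ (ties broken arbitrarily). The test $\mathrm{LDT}_d$ picks a uniformly random point $a\in\mathbb{F}^2$ and a uniformly random line $\ell\ni a$, and accepts iff $P_\ell(a)=f(a)$. -}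

module Defs where

open import Level using (0ℓ)
open import Data.Nat as ℕ using (ℕ; zero; suc)
open import Data.Fin using (Fin)
open import Data.Fin.Base using () renaming (toℕ to finToℕ)
open import Data.List using (List; []; _∷_; map; filter; length; concatMap; allFin; upTo)
open import Data.Product using (_×_; _,_; ∃; Σ; proj₁; proj₂)
open import Relation.Binary.PropositionalEquality using (_≡_; _≢_)
open import Relation.Binary.Definitions using (DecidableEquality)
open import Relation.Nullary using (¬_; Dec; yes; no)
open import Relation.Nullary.Decidable using (_×-dec_; ¬?)
open import Algebra.Structures using (IsCommutativeRing)
open import Function.Bundles using (_↔_; Inverse)

record FiniteField : Set₁ where
  infixl 7 _*_
  infixl 6 _+_
  field
    Carrier : Set
    _+_ _*_ : Carrier → Carrier → Carrier
    -_      : Carrier → Carrier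
    0# 1#   : Carrier
    isCommutativeRing : IsCommutativeRing _≡_ _+_ _*_ -_ 0# 1#
    0≢1     : 0# ≢ 1#
    inverse : ∀ x → x ≢ 0# → ∃ λ y → x * y ≡ 1#
    q       : ℕ
    enum    : Fin q ↔ Carrier
    -- decidable equality (derivable from enum; included for convenience)
    _≟_     : DecidableEquality Carrier

module _ (𝔽 : FiniteField) where
  open FiniteField 𝔽

  elems : List Carrier
  elems = map (Inverse.to enum) (allFin q)

  Point : Set
  Point = Carrier × Carrier

  points : List Point
  points = concatMap (λ x → map (λ y → (x , y)) elems) elems

  count : {A : Set} {P : A → Set} → (∀ a → Dec (P a)) → List A → ℕ
  count P? xs = length (filter P? xs)

  _⊕_ : Point → Point → Point
  (a₁ , a₂) ⊕ (b₁ , b₂) = (a₁ + b₁ , a₂ + b₂)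

  _·_ : Carrier → Point → Point
  t · (u₁ , u₂) = (t * u₁ , t * u₂)

  origin : Point
  origin = (0# , 0#)

  linePt : Point → Point → Carrier → Point
  linePt b u t = b ⊕ (t · u)

  _^_ : Carrier → ℕ → Carrier
  x ^ zero  = 1#
  x ^ suc n = x * (x ^ n)

  evalUni : (d : ℕ) → (Fin (suc d) → Carrier) → Carrier → Carrier
  evalUni d c t = go (allFin (suc d))
    where
    go : List (Fin (suc d)) → Carrier
    go []       = 0#
    go (i ∷ is) = c i * (t ^ finToℕ i) + go is

  evalBi : (d : ℕ) → (ℕ → ℕ → Carrier) → Point → Carrier
  evalBi d c (x , y) = goI (upTo (suc d))
    where
    goJ : ℕ → List ℕ → Carrier
    goJ i []       = 0#
    goJ i (j ∷ js) = c i j * (x ^ i) * (y ^ j) + goJ i js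
    goI : List ℕ → Carrier
    goI []       = 0#
    goI (i ∷ is) = goJ i (upTo (suc (d ℕ.∸ i))) + goI is

  SameLine : Point → Point → Point → Point → Set
  SameLine b u b' u' = (∃ λ s → b' ≡ linePt b u s) × (∃ λ r → r ≢ 0# × u' ≡ r · u)

  -- A best-fit assignment for f: P b u is the function P_ℓ on the line
  -- ℓ = {b + t u}. It depends only on the line ℓ (not on its representation),
  -- is given in the parametrisation t ↦ b + t u by a univariate polynomial of
  -- degree ≤ d, and agrees with f on the maximum number of points of ℓ among
  -- all such polynomials.
  record BestFit (d : ℕ) (f : Point → Carrier) (P : Point → Point → Point → Carrier) : Set where
    field
      wellDefined : ∀ b u b' u' → u ≢ origin → SameLine b u b' u' →
                    ∀ t → P b u (linePt b u t) ≡ P b' u' (linePt b u t)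
      isPoly      : ∀ b u → u ≢ origin →
                    ∃ λ (g : Fin (suc d) → Carrier) → ∀ t → P b u (linePt b u t) ≡ evalUni d g t
      maximal     : ∀ b u → u ≢ origin → ∀ (h : Fin (suc d) → Carrier) →
                    count (λ t → f (linePt b u t) ≟ evalUni d h t) elems
                      ℕ.≤ count (λ t → f (linePt b u t) ≟ P b u (linePt b u t)) elems

  _≟P_ : DecidableEquality Point
  (a₁ , a₂) ≟P (b₁ , b₂) with a₁ ≟ b₁ | a₂ ≟ b₂
  ... | yes Relation.Binary.PropositionalEquality.refl | yes Relation.Binary.PropositionalEquality.refl = yes Relation.Binary.PropositionalEquality.refl
  ... | no ne | _ = no λ { Relation.Binary.PropositionalEquality.refl → ne Relation.Binary.PropositionalEquality.refl }
  ... | yes _ | no ne = no λ { Relation.Binary.PropositionalEquality.refl → ne Relation.Binary.PropositionalEquality.refl }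

  -- Number of pairs (a, u), a ∈ F², u ∈ F² ∖ {0}, with P_{ℓ(a,u)}(a) = f(a).
  -- Choosing a uniformly and u uniformly among nonzero vectors yields a
  -- uniformly random line through a (each line through a arises from exactly
  -- q − 1 directions), so
  --   Pr_{a, ℓ ∋ a}[f(a) = P_ℓ(a)] = ldtAccepting / (q² (q² − 1)).
  ldtAccepting : (f : Point → Carrier) → (Point → Point → Point → Carrier) → ℕ
  ldtAccepting f P =
    count (λ au → ¬? (proj₂ au ≟P origin) ×-dec (P (proj₁ au) (proj₂ au) (proj₁ au) ≟ f (proj₁ au)))
          (concatMap (λ a → map (λ u → (a , u)) points) points)

  agreeCount : (d : ℕ) → (f : Point → Carrier) → (ℕ → ℕ → Carrier) → ℕ
  agreeCount d f c = count (λ a → f a ≟ evalBi d c a) points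

open import Data.Rational as Q using (ℚ; 1ℚ)
open import Data.Integer using (+_)

powℚ : ℚ → ℕ → ℚ
powℚ x zero    = 1ℚ
powℚ x (suc n) = x Q.* powℚ x n

ℕtoℚ : ℕ → ℚ
ℕtoℚ n = (+ n) Q./ 1

{-# OPTIONS --safe #-}
-- Call a pair (point a, non-vertical line ℓ ∋ a) good if f(a) = P_ℓ(a). Deleting points and lines
-- of low degree from the good incidence graph leaves a set S of points and a set of lines such
-- that every remaining vertex has more than T ≈ εq/8 good neighbours. Counting monomials, there
-- is a non-zero A(x,y,z) of (1,1,d)-weighted degree at most T with A(a, f(a)) = 0 for all a; hence
-- A(x, y, P_ℓ) vanishes identically on each remaining line ℓ.
--
-- One may moreover assume ∂A/∂z ≠ 0 at (a, f(a)) for some a ∈ S. Otherwise, the derivative of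
-- A(x, y, P_ℓ) along two lines through each point shows that ∂A/∂x and ∂A/∂y vanish on the graph of
-- f over S as well, so a non-zero partial derivative of A can replace A; if there is none, A is a
-- p-th power and its p-th root can replace A.
--
-- At such a point a, Newton iteration determines the coefficients of P_ℓ for all remaining lines
-- through a: the k-th one is a form of degree k in the direction of ℓ. The sum of these forms for
-- k ≤ d is a polynomial Q which equals P_ℓ on each such ℓ, so Q agrees with f at T points of each
-- of T lines through a. No discriminant is needed, and this works already for q ≥ C d/ε³, with
-- agreement of order ε².
module Submission where

open import Defs hiding (_^_)
open import Level using (0ℓ)
open import Algebra.Bundles using (CommutativeMonoid; CommutativeRing)
import Algebra.Properties.CommutativeSemigroup as CommutativeSemigroupProperties
import Algebra.Properties.Ring as RingProperties
import Algebra.Solver.Ring as RingSolver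
import Algebra.Solver.Ring.AlmostCommutativeRing as ACR
open import Data.Fin as Fin using (Fin)
import Data.Fin.Properties as Finₚ
open import Data.Integer as ℤ using (ℤ; -[1+_]; _⊖_; _◃_)
import Data.Integer.Properties as ℤₚ
open import Data.List using (List; []; _∷_; _++_; map; length; filter; concatMap; cartesianProduct; applyUpTo; upTo; tabulate; allFin)
open import Data.List.Properties using (length-map; length-++; length-filter; length-tabulate; length-upTo)
open import Data.List.Membership.Propositional using (_∈_; _∉_; find; lose)
open import Data.List.Membership.Propositional.Properties using (∈-∃++; ∈-map⁺; ∈-map⁻; ∈-++⁺ˡ; ∈-++⁺ʳ; ∈-++⁻; ∈-filter⁺; ∈-filter⁻; ∈-cartesianProduct⁺; ∈-cartesianProduct⁻; ∈-upTo⁻; ∈-allFin)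
open import Data.List.Relation.Binary.Permutation.Propositional as Perm using (_↭_; ↭-sym; prep; swap)
open import Data.List.Relation.Binary.Permutation.Propositional.Properties using (shift; ↭-length; ∈-resp-↭)
open import Data.List.Relation.Unary.All as All using (All; []; _∷_)
import Data.List.Relation.Unary.All.Properties as Allₚ
open import Data.List.Relation.Unary.AllPairs using ([]; _∷_)
open import Data.List.Relation.Unary.Any as Any using (Any; here; there)
open import Data.List.Relation.Unary.Unique.Propositional using (Unique)
import Data.List.Relation.Unary.Unique.Propositional.Properties as Uniqueₚ
open import Data.Maybe using (Maybe; just; nothing)
open import Data.Nat as ℕ using (ℕ; NonZero; zero; suc; z≤n; s≤s; _∸_) renaming (_*_ to _*ₙ_)
open import Data.Nat.DivMod using (_/_; _%_; m≡m%n+[m/n]*n; m%n<n; m/n*n≤m)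
open import Data.Nat.Induction using (<-rec)
open import Data.Nat.ListAction using (sum)
import Data.Nat.Properties as ℕₚ
open import Data.Nat.Solver using (module +-*-Solver)
open import Data.Product using (∃; _×_; _,_; proj₁; proj₂)
open import Data.Product.Properties using (≡-dec)
import Data.Sign as Sign
open import Data.Sum using (_⊎_; inj₁; inj₂; [_,_]′)
open import Data.Sum.Properties using (inj₁-injective; inj₂-injective)
open import Function using (_∘_; Injective)
open import Function.Bundles using (Inverse)
open import Relation.Binary.Definitions using (DecidableEquality)
open import Relation.Binary.PropositionalEquality
open import Relation.Nullary using (¬_; Dec; yes; no; contradiction)
open import Relation.Nullary.Decidable using (¬?; _×-dec_; decidable-stable)
open import Relation.Unary using (Decidable)

open CommutativeSemigroupProperties ℕₚ.+-commutativeSemigroup using (x∙yz≈y∙xz; interchange)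

-- All remaining lines through `a` give P_ℓ the same value f(a) at `a`. Where ∂A/∂z ≠ 0, the surface
-- A = 0 has a single power series branch with that value, so these lines cannot follow different
-- branches; this takes the place of factoring A. The pruning has to be two-sided: a line needs more
-- than T points for a restriction of degree at most T to vanish, a point needs two lines for the
-- gradient argument, and the final count needs T lines with T further points each. The descent ends
-- because every replacement of A lowers its total degree and keeps its weighted degree at most T,
-- while a non-zero constant cannot vanish on the inhabited set S. The p-th roots of coefficients
-- exist because Frobenius permutes a finite field. Restrictions to lines are compared coefficient
-- by coefficient, as formal series, so that they can be differentiated. Acceptance forces ε ≤ 2.
-- Hence the factor 16 in C = 16 K absorbs ε⁴ and leaves q > K d/ε³, and the agreement ε²q²/256 is
-- at least ε⁴q²/1024.

-- Field arithmetic, powers and finite sums.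

module Field (𝔽 : FiniteField) where
  open FiniteField 𝔽 public renaming (Carrier to F)

  commutativeRing : CommutativeRing 0ℓ 0ℓ
  commutativeRing = record { isCommutativeRing = isCommutativeRing }

  open CommutativeRing commutativeRing public
    using (_-_; +-assoc; +-comm; +-identityˡ; +-identityʳ; -‿inverseʳ;
           *-assoc; *-comm; *-identityˡ; *-identityʳ; zeroˡ; zeroʳ; distribˡ; distribʳ)
  open RingProperties (CommutativeRing.ring commutativeRing) public
    using (-0#≈0#; -‿involutive; -‿distribˡ-*; -‿distribʳ-*; -‿+-comm)

  -- The separate clause for 1 makes `nat 1` reduce to `1#` instead of `1# + 0#`, so that the solver
  -- constant `:1` matches goals definitionally.
  nat : ℕ → F
  nat zero    = 0#
  nat (suc zero) = 1#
  nat (suc (suc n)) = 1# + nat (suc n)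

  nat-suc : ∀ n → nat (suc n) ≡ 1# + nat n
  nat-suc zero    = sym (+-identityʳ 1#)
  nat-suc (suc n) = refl

  nat-+ : ∀ m n → nat (m ℕ.+ n) ≡ nat m + nat n
  nat-+ zero    n = sym (+-identityˡ _)
  nat-+ (suc m) n = begin
    nat (suc (m ℕ.+ n))     ≡⟨ nat-suc (m ℕ.+ n) ⟩
    1# + nat (m ℕ.+ n)      ≡⟨ cong (1# +_) (nat-+ m n) ⟩
    1# + (nat m + nat n)    ≡⟨ +-assoc _ _ _ ⟨
    (1# + nat m) + nat n    ≡⟨ cong (_+ nat n) (nat-suc m) ⟨
    nat (suc m) + nat n     ∎
    where open ≡-Reasoning

  nat-* : ∀ m n → nat (m ℕ.* n) ≡ nat m * nat n
  nat-* zero    n = sym (zeroˡ _)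
  nat-* (suc m) n = begin
    nat (n ℕ.+ m ℕ.* n)            ≡⟨ nat-+ n (m ℕ.* n) ⟩
    nat n + nat (m ℕ.* n)          ≡⟨ cong₂ _+_ (sym (*-identityˡ _)) (nat-* m n) ⟩
    1# * nat n + nat m * nat n     ≡⟨ distribʳ _ _ _ ⟨
    (1# + nat m) * nat n           ≡⟨ cong (_* nat n) (nat-suc m) ⟨
    nat (suc m) * nat n            ∎
    where open ≡-Reasoning

  int : ℤ → F
  int (ℤ.+ n)    = nat n
  int -[1+ n ] = - nat (suc n)

  cancel-head : ∀ a x y → x + - y ≡ (a + x) + - (a + y)
  cancel-head a x y = sym (begin
    (a + x) + - (a + y)     ≡⟨ cong (a + x +_) (-‿+-comm a y) ⟨
    (a + x) + (- a + - y)   ≡⟨ cong (_+ (- a + - y)) (+-comm a x) ⟩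
    (x + a) + (- a + - y)   ≡⟨ +-assoc x a _ ⟩
    x + (a + (- a + - y))   ≡⟨ cong (x +_) (+-assoc a (- a) (- y)) ⟨
    x + ((a + - a) + - y)   ≡⟨ cong (λ s → x + (s + - y)) (-‿inverseʳ a) ⟩
    x + (0# + - y)          ≡⟨ cong (x +_) (+-identityˡ _) ⟩
    x + - y                 ∎)
    where open ≡-Reasoning

  int-⊖ : ∀ m n → int (m ⊖ n) ≡ nat m + - nat n
  int-⊖ zero    zero    = sym (trans (+-identityˡ _) -0#≈0#)
  int-⊖ zero    (suc n) = sym (+-identityˡ _)
  int-⊖ (suc m) zero    = sym (trans (cong (nat (suc m) +_) -0#≈0#) (+-identityʳ _))
  int-⊖ (suc m) (suc n) = trans (cong int (ℤₚ.[1+m]⊖[1+n]≡m⊖n m n))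
    (trans (int-⊖ m n) (trans (cancel-head 1# (nat m) (nat n))
      (cong₂ (λ x y → x + - y) (sym (nat-suc m)) (sym (nat-suc n)))))

  int-+ : ∀ i j → int (i ℤ.+ j) ≡ int i + int j
  int-+ (ℤ.+ m)    (ℤ.+ n)    = nat-+ m n
  int-+ (ℤ.+ m)    -[1+ n ] = int-⊖ m (suc n)
  int-+ -[1+ m ] (ℤ.+ n)    = trans (int-⊖ n (suc m)) (+-comm _ _)
  int-+ -[1+ m ] -[1+ n ] = trans (cong -_ (trans (cong (nat ∘ suc) (sym (ℕₚ.+-suc m n)))
    (nat-+ (suc m) (suc n)))) (sym (-‿+-comm _ _))

  int-neg : ∀ i → int (ℤ.- i) ≡ - int i
  int-neg (ℤ.+ zero)  = sym -0#≈0#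
  int-neg (ℤ.+ suc n) = refl
  int-neg -[1+ n ]  = sym (-‿involutive _)

  int-minus : ∀ n → int (Sign.- ◃ n) ≡ - nat n
  int-minus zero    = sym -0#≈0#
  int-minus (suc n) = refl

  int-plus : ∀ n → int (Sign.+ ◃ n) ≡ nat n
  int-plus n = cong int (ℤₚ.+◃n≡+n n)

  int-* : ∀ i j → int (i ℤ.* j) ≡ int i * int j
  int-* (ℤ.+ m)    (ℤ.+ n)    = trans (int-plus (m ℕ.* n)) (nat-* m n)
  int-* (ℤ.+ m)    -[1+ n ] = trans (int-minus (m ℕ.* suc n))
    (trans (cong -_ (nat-* m (suc n))) (-‿distribʳ-* _ _))
  int-* -[1+ m ] (ℤ.+ n)    = trans (int-minus (suc m ℕ.* n))
    (trans (cong -_ (nat-* (suc m) n)) (-‿distribˡ-* _ _))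
  int-* -[1+ m ] -[1+ n ] = trans (int-plus (suc m ℕ.* suc n)) (trans (nat-* (suc m) (suc n))
    (trans (sym (-‿involutive _)) (trans (cong -_ (-‿distribˡ-* _ _)) (-‿distribʳ-* _ _))))

  private
    target = ACR.fromCommutativeRing commutativeRing

    morphism : ℤ.+-*-rawRing ACR.-Raw-AlmostCommutative⟶ target
    morphism = record
      { ⟦_⟧ = int ; +-homo = int-+ ; *-homo = int-* ; -‿homo = int-neg
      ; 0-homo = refl ; 1-homo = refl }

    -- In positive characteristic distinct integers may have equal images. Answering `nothing` is
    -- sound: the solver merely keeps such coefficients apart.
    same : ∀ i j → Maybe (int i ≡ int j)
    same i j with i ℤₚ.≟ j
    ... | yes eq = just (cong int eq)
    ... | no _   = nothing

  open RingSolver ℤ.+-*-rawRing target morphism same public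
    using (Polynomial; solve; _:+_; _:-_; _:*_; :-_; _:=_; con)

  :0 :1 : ∀ {n} → Polynomial n
  :0 = con (ℤ.+ 0)
  :1 = con (ℤ.+ 1)

  *≢0 : ∀ {x y} → x ≢ 0# → x * y ≡ 0# → y ≡ 0#
  *≢0 {x} {y} x≢0 xy≡0 with x⁻¹ , inv ← inverse x x≢0 = begin
    y               ≡⟨ *-identityˡ y ⟨
    1# * y          ≡⟨ cong (_* y) inv ⟨
    (x * x⁻¹) * y   ≡⟨ solve 3 (λ x i y → x :* i :* y := i :* (x :* y)) refl x x⁻¹ y ⟩
    x⁻¹ * (x * y)   ≡⟨ cong (x⁻¹ *_) xy≡0 ⟩
    x⁻¹ * 0#        ≡⟨ zeroʳ x⁻¹ ⟩
    0#              ∎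
    where open ≡-Reasoning

  x-y≡0⇒x≡y : ∀ {x y} → x - y ≡ 0# → x ≡ y
  x-y≡0⇒x≡y {x} {y} eq = trans (solve 2 (λ x y → x := (x :- y) :+ y) refl x y)
    (trans (cong (_+ y) eq) (+-identityˡ y))

  infixr 8 _^_
  _^_ : F → ℕ → F
  _^_ = Defs._^_ 𝔽

  ^-+ : ∀ x m n → x ^ (m ℕ.+ n) ≡ x ^ m * x ^ n
  ^-+ x zero    n = sym (*-identityˡ _)
  ^-+ x (suc m) n = trans (cong (x *_) (^-+ x m n)) (sym (*-assoc _ _ _))

  ^-distrib-* : ∀ x y n → (x * y) ^ n ≡ x ^ n * y ^ n
  ^-distrib-* x y zero    = sym (*-identityˡ _)
  ^-distrib-* x y (suc n) = trans (cong (x * y *_) (^-distrib-* x y n))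
    (solve 4 (λ x y a b → x :* y :* (a :* b) := x :* a :* (y :* b)) refl x y (x ^ n) (y ^ n))

  ^-* : ∀ x m n → x ^ (m ℕ.* n) ≡ (x ^ n) ^ m
  ^-* x zero    n = refl
  ^-* x (suc m) n = trans (^-+ x n (m ℕ.* n)) (cong (x ^ n *_) (^-* x m n))

  Σ : ℕ → (ℕ → F) → F
  Σ zero    g = 0#
  Σ (suc n) g = Σ n g + g n

  Σ-cong< : ∀ n {g h} → (∀ i → i ℕ.< n → g i ≡ h i) → Σ n g ≡ Σ n h
  Σ-cong< zero    eq = refl
  Σ-cong< (suc n) eq = cong₂ _+_ (Σ-cong< n λ i i<n → eq i (ℕₚ.m<n⇒m<1+n i<n)) (eq n ℕₚ.≤-refl)

  Σ-cong : ∀ n {g h} → (∀ i → g i ≡ h i) → Σ n g ≡ Σ n h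
  Σ-cong n eq = Σ-cong< n λ i _ → eq i

  Σ-zero : ∀ n {g} → (∀ i → i ℕ.< n → g i ≡ 0#) → Σ n g ≡ 0#
  Σ-zero zero    eq = refl
  Σ-zero (suc n) eq = trans (cong₂ _+_ (Σ-zero n λ i i<n → eq i (ℕₚ.m<n⇒m<1+n i<n)) (eq n ℕₚ.≤-refl))
    (+-identityˡ _)

  Σ-+ : ∀ n g h → Σ n (λ i → g i + h i) ≡ Σ n g + Σ n h
  Σ-+ zero    g h = sym (+-identityˡ _)
  Σ-+ (suc n) g h = trans (cong (_+ (g n + h n)) (Σ-+ n g h))
    (solve 4 (λ a b x y → a :+ b :+ (x :+ y) := a :+ x :+ (b :+ y)) refl (Σ n g) (Σ n h) (g n) (h n))

  Σ-*ˡ : ∀ n c g → Σ n (λ i → c * g i) ≡ c * Σ n g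
  Σ-*ˡ zero    c g = sym (zeroʳ c)
  Σ-*ˡ (suc n) c g = trans (cong (_+ c * g n) (Σ-*ˡ n c g)) (sym (distribˡ _ _ _))

  Σ-head : ∀ n g → Σ (suc n) g ≡ g 0 + Σ n (g ∘ suc)
  Σ-head zero    g = +-comm 0# (g 0)
  Σ-head (suc n) g = trans (cong (_+ g (suc n)) (Σ-head n g)) (+-assoc _ _ _)

  Σ-extend : ∀ {n n′} g → n ℕ.≤ n′ → (∀ i → n ℕ.≤ i → g i ≡ 0#) → Σ n′ g ≡ Σ n g
  Σ-extend {n} {zero}   g z≤n  vanish = refl
  Σ-extend {n} {suc n′} g n≤ vanish with ℕₚ.m≤n⇒m<n∨m≡n n≤
  ... | inj₂ refl = refl
  ... | inj₁ (s≤s n≤n′) = trans (cong₂ _+_ (Σ-extend g n≤n′ vanish) (vanish n′ n≤n′)) (+-identityʳ _)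

  -- The index shift of formal differentiation: the constant term dies, and the term that would
  -- cross the upper end is zero.
  Σ-shift : ∀ n g h → g 0 ≡ 0# → (∀ i → g (suc i) ≡ h i) → g n ≡ 0# → Σ n g ≡ Σ n h
  Σ-shift n g h g0 gs gn = begin
    Σ n g                ≡⟨ +-identityʳ _ ⟨
    Σ n g + 0#           ≡⟨ cong (Σ n g +_) gn ⟨
    Σ (suc n) g          ≡⟨ Σ-head n g ⟩
    g 0 + Σ n (g ∘ suc)  ≡⟨ cong₂ _+_ g0 (Σ-cong n gs) ⟩
    0# + Σ n h           ≡⟨ +-identityˡ _ ⟩
    Σ n h                ∎
    where open ≡-Reasoning

-- Formal power series and first-order perturbation.

module Series (𝔽 : FiniteField) where
  open Field 𝔽

  Series : Set
  Series = ℕ → F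

  -- The Cauchy product, unfolded through U = U 0 + t · (U ∘ suc).
  mul : Series → Series → Series
  mul U V zero    = U 0 * V 0
  mul U V (suc n) = U 0 * V (suc n) + mul (U ∘ suc) V n

  one : Series
  one zero    = 1#
  one (suc _) = 0#

  pow : Series → ℕ → Series
  pow U zero    = one
  pow U (suc n) = mul U (pow U n)

  mul-cong : ∀ n {U U′ V V′} → (∀ j → j ℕ.≤ n → U j ≡ U′ j) → (∀ j → j ℕ.≤ n → V j ≡ V′ j) →
             mul U V n ≡ mul U′ V′ n
  mul-cong zero    eqU eqV = cong₂ _*_ (eqU 0 z≤n) (eqV 0 z≤n)
  mul-cong (suc n) eqU eqV = cong₂ _+_ (cong₂ _*_ (eqU 0 z≤n) (eqV (suc n) ℕₚ.≤-refl))
    (mul-cong n (λ j j≤n → eqU (suc j) (s≤s j≤n)) (λ j j≤n → eqV j (ℕₚ.m≤n⇒m≤1+n j≤n)))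

  pow-zeroth : ∀ U n → pow U n 0 ≡ U 0 ^ n
  pow-zeroth U zero    = refl
  pow-zeroth U (suc n) = cong (U 0 *_) (pow-zeroth U n)

  -- U ≡ U′ + δ tⁿ⁺¹ modulo tⁿ⁺².
  record Near (n : ℕ) (U U′ : Series) (δ : F) : Set where
    constructor near
    field
      below : ∀ j → j ℕ.≤ n → U j ≡ U′ j
      at    : U (suc n) ≡ U′ (suc n) + δ

  near-resp : ∀ {n U U′ δ δ′} → δ ≡ δ′ → Near n U U′ δ → Near n U U′ δ′
  near-resp refl N = N

  private
    -- In the n-th coefficient of a product, the perturbed coefficient of the left factor meets only
    -- the constant term of the right one.
    mul-perturbˡ : ∀ n {W W′ V V′ δ} → (∀ j → j ℕ.< n → W j ≡ W′ j) → W n ≡ W′ n + δ →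
                   (∀ j → j ℕ.≤ n → V j ≡ V′ j) → mul W V n ≡ mul W′ V′ n + δ * V 0
    mul-perturbˡ zero {W} {W′} {V} {V′} {δ} eqW at eqV = begin
      W 0 * V 0                 ≡⟨ cong (_* V 0) at ⟩
      (W′ 0 + δ) * V 0          ≡⟨ distribʳ _ _ _ ⟩
      W′ 0 * V 0 + δ * V 0      ≡⟨ cong (λ v → W′ 0 * v + δ * V 0) (eqV 0 z≤n) ⟩
      W′ 0 * V′ 0 + δ * V 0     ∎
      where open ≡-Reasoning
    mul-perturbˡ (suc n) eqW at eqV = trans
      (cong₂ _+_ (cong₂ _*_ (eqW 0 (s≤s z≤n)) (eqV (suc n) ℕₚ.≤-refl))
        (mul-perturbˡ n (λ j j<n → eqW (suc j) (s≤s j<n)) at λ j j≤n → eqV j (ℕₚ.m≤n⇒m≤1+n j≤n)))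
      (sym (+-assoc _ _ _))

  -- The Leibniz rule. The product of the two perturbations starts at order 2n + 2 and does not
  -- reach tⁿ⁺¹.
  near-mul : ∀ {n U U′ V V′ δ η} → Near n U U′ δ → Near n V V′ η →
             Near n (mul U V) (mul U′ V′) (δ * V 0 + U 0 * η)
  near-mul {n} {U} {U′} {V} {V′} {δ} {η} (near bU atU) (near bV atV) = near
    (λ j j≤n → mul-cong j (λ i i≤j → bU i (ℕₚ.≤-trans i≤j j≤n)) (λ i i≤j → bV i (ℕₚ.≤-trans i≤j j≤n)))
    (begin
      U 0 * V (suc n) + mul (U ∘ suc) V n
        ≡⟨ cong₂ _+_ (cong (U 0 *_) atV)
             (mul-perturbˡ n (λ j j<n → bU (suc j) j<n) atU bV) ⟩
      U 0 * (V′ (suc n) + η) + (mul (U′ ∘ suc) V′ n + δ * V 0)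
        ≡⟨ solve 6 (λ u v e m d w → u :* (v :+ e) :+ (m :+ d :* w) := u :* v :+ m :+ (d :* w :+ u :* e))
             refl (U 0) (V′ (suc n)) η (mul (U′ ∘ suc) V′ n) δ (V 0) ⟩
      U 0 * V′ (suc n) + mul (U′ ∘ suc) V′ n + (δ * V 0 + U 0 * η)
        ≡⟨ cong (λ u → u * V′ (suc n) + mul (U′ ∘ suc) V′ n + (δ * V 0 + U 0 * η)) (bU 0 z≤n) ⟩
      U′ 0 * V′ (suc n) + mul (U′ ∘ suc) V′ n + (δ * V 0 + U 0 * η) ∎)
    where open ≡-Reasoning

  dpow : ℕ → F → F
  dpow zero    x = 0#
  dpow (suc n) x = nat (suc n) * x ^ n

  x*dpow : ∀ n x → x * dpow n x ≡ nat n * x ^ n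
  x*dpow zero    x = trans (zeroʳ x) (sym (zeroˡ _))
  x*dpow (suc n) x = solve 3 (λ x n p → x :* (n :* p) := n :* (x :* p)) refl x (nat (suc n)) (x ^ n)

  near-pow : ∀ {n U U′ δ} → Near n U U′ δ → ∀ e → Near n (pow U e) (pow U′ e) (dpow e (U 0) * δ)
  near-pow {δ = δ} N zero = near (λ _ _ → refl) (sym (trans (+-identityˡ _) (zeroˡ δ)))
  near-pow {n} {U} {U′} {δ} N (suc e) = near-resp δ-eq (near-mul N (near-pow N e))
    where
    open ≡-Reasoning
    x = U 0
    δ-eq : δ * pow U e 0 + x * (dpow e x * δ) ≡ nat (suc e) * x ^ e * δ
    δ-eq = begin
      δ * pow U e 0 + x * (dpow e x * δ)  ≡⟨ cong₂ (λ p q → δ * p + q) (pow-zeroth U e) (sym (*-assoc _ _ _)) ⟩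
      δ * x ^ e + x * dpow e x * δ        ≡⟨ cong (λ p → δ * x ^ e + p * δ) (x*dpow e x) ⟩
      δ * x ^ e + nat e * x ^ e * δ       ≡⟨ solve 3 (λ d p n → d :* p :+ n :* p :* d := (:1 :+ n) :* p :* d)
                                               refl δ (x ^ e) (nat e) ⟩
      (1# + nat e) * x ^ e * δ            ≡⟨ cong (λ n → n * x ^ e * δ) (nat-suc e) ⟨
      nat (suc e) * x ^ e * δ             ∎

  near-Σ : ∀ {n} B {U U′ : ℕ → Series} {δ : ℕ → F} → (∀ i → Near n (U i) (U′ i) (δ i)) →
           Near n (λ m → Σ B (λ i → U i m)) (λ m → Σ B (λ i → U′ i m)) (Σ B δ)
  near-Σ B {U} {U′} {δ} N = near (λ j j≤n → Σ-cong B λ i → Near.below (N i) j j≤n)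
    (trans (Σ-cong B (λ i → Near.at (N i))) (Σ-+ B _ δ))

  near-scale : ∀ {n U U′ δ} c → Near n U U′ δ → Near n (λ m → c * U m) (λ m → c * U′ m) (c * δ)
  near-scale c (near b at) = near (λ j j≤n → cong (c *_) (b j j≤n)) (trans (cong (c *_) at) (distribˡ _ _ _))

  Coeff : Set
  Coeff = ℕ → ℕ → ℕ → F

  Σ³ : ℕ → Coeff → F
  Σ³ B g = Σ B λ i → Σ B λ j → Σ B λ k → g i j k

  Σ³-cong : ∀ B {g h} → (∀ i j k → g i j k ≡ h i j k) → Σ³ B g ≡ Σ³ B h
  Σ³-cong B eq = Σ-cong B λ i → Σ-cong B λ j → Σ-cong B λ k → eq i j k

  Σ³-+ : ∀ B g h → Σ³ B (λ i j k → g i j k + h i j k) ≡ Σ³ B g + Σ³ B h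
  Σ³-+ B g h = trans (Σ-cong B λ i → trans (Σ-cong B λ j → Σ-+ B _ _) (Σ-+ B _ _)) (Σ-+ B _ _)

  Σ³-*ˡ : ∀ B c g → Σ³ B (λ i j k → c * g i j k) ≡ c * Σ³ B g
  Σ³-*ˡ B c g = trans (Σ-cong B λ i → trans (Σ-cong B λ j → Σ-*ˡ B c _) (Σ-*ˡ B c _)) (Σ-*ˡ B c _)

  eval³ : ℕ → Coeff → F → F → F → F
  eval³ B a x y z = Σ³ B λ i j k → a i j k * (x ^ i * (y ^ j * z ^ k))

  eval³ₛ : ℕ → Coeff → Series → Series → Series → Series
  eval³ₛ B a X Y Z n = Σ³ B λ i j k → a i j k * mul (pow X i) (mul (pow Y j) (pow Z k)) n

  ∂x ∂y ∂z : Coeff → Coeff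
  ∂x a i j k = nat (suc i) * a (suc i) j k
  ∂y a i j k = nat (suc j) * a i (suc j) k
  ∂z a i j k = nat (suc k) * a i j (suc k)

  -- Evaluation sums over indices below `B` only. Inside the box no monomial is lost to this
  -- truncation, and the derivatives lose none either.
  InBox : ℕ → Coeff → Set
  InBox B a = ∀ i j k → B ℕ.≤ i ⊎ B ℕ.≤ j ⊎ B ℕ.≤ k → a i j k ≡ 0#

  module _ (B : ℕ) (a : Coeff) (box : InBox B a) (x y z : F) where
    private
      *-zero : ∀ {u} v → u ≡ 0# → u * v ≡ 0#
      *-zero v refl = zeroˡ v

    eval-∂x : Σ³ B (λ i j k → a i j k * (dpow i x * (y ^ j * z ^ k))) ≡ eval³ B (∂x a) x y z
    eval-∂x = Σ-shift B _ _
      (Σ-zero B λ j _ → Σ-zero B λ k _ → trans (cong (a 0 j k *_) (zeroˡ _)) (zeroʳ _))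
      (λ i → Σ-cong B λ j → Σ-cong B λ k →
        solve 4 (λ a n p w → a :* (n :* p :* w) := n :* a :* (p :* w)) refl
          (a (suc i) j k) (nat (suc i)) (x ^ i) (y ^ j * z ^ k))
      (Σ-zero B λ j _ → Σ-zero B λ k _ → *-zero _ (box B j k (inj₁ ℕₚ.≤-refl)))

    eval-∂y : Σ³ B (λ i j k → a i j k * (x ^ i * (dpow j y * z ^ k))) ≡ eval³ B (∂y a) x y z
    eval-∂y = Σ-cong B λ i → Σ-shift B _ _
      (Σ-zero B λ k _ → solve 3 (λ a p w → a :* (p :* (:0 :* w)) := :0) refl (a i 0 k) (x ^ i) (z ^ k))
      (λ j → Σ-cong B λ k →
        solve 5 (λ a p n r w → a :* (p :* (n :* r :* w)) := n :* a :* (p :* (r :* w))) refl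
          (a i (suc j) k) (x ^ i) (nat (suc j)) (y ^ j) (z ^ k))
      (Σ-zero B λ k _ → *-zero _ (box i B k (inj₂ (inj₁ ℕₚ.≤-refl))))

    eval-∂z : Σ³ B (λ i j k → a i j k * (x ^ i * (y ^ j * dpow k z))) ≡ eval³ B (∂z a) x y z
    eval-∂z = Σ-cong B λ i → Σ-cong B λ j → Σ-shift B _ _
      (solve 3 (λ a p r → a :* (p :* (r :* :0)) := :0) refl (a i j 0) (x ^ i) (y ^ j))
      (λ k → solve 5 (λ a p r n w → a :* (p :* (r :* (n :* w))) := n :* a :* (p :* (r :* w))) refl
          (a i j (suc k)) (x ^ i) (y ^ j) (nat (suc k)) (z ^ k))
      (*-zero _ (box i j B (inj₂ (inj₂ ℕₚ.≤-refl))))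

  -- First-order Taylor expansion. It serves twice: with `n` equal to 0 as the chain rule along a
  -- line, and for larger `n` as the linear equation that each Newton step solves.
  near-eval³ : ∀ {n X X′ Y Y′ Z Z′ ξ η ζ} B a → InBox B a →
    Near n X X′ ξ → Near n Y Y′ η → Near n Z Z′ ζ →
    Near n (eval³ₛ B a X Y Z) (eval³ₛ B a X′ Y′ Z′)
      (ξ * eval³ B (∂x a) (X 0) (Y 0) (Z 0) + η * eval³ B (∂y a) (X 0) (Y 0) (Z 0)
        + ζ * eval³ B (∂z a) (X 0) (Y 0) (Z 0))
  near-eval³ {n} {X} {X′} {Y} {Y′} {Z} {Z′} {ξ} {η} {ζ} B a box NX NY NZ =
    near-resp δ-eq (near-Σ B λ i → near-Σ B λ j → near-Σ B λ k → near-scale (a i j k)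
      (near-mul (near-pow NX i) (near-mul (near-pow NY j) (near-pow NZ k))))
    where
    open ≡-Reasoning
    x = X 0
    y = Y 0
    z = Z 0
    gx gy gz : Coeff
    gx i j k = a i j k * (dpow i x * (y ^ j * z ^ k))
    gy i j k = a i j k * (x ^ i * (dpow j y * z ^ k))
    gz i j k = a i j k * (x ^ i * (y ^ j * dpow k z))
    term : ∀ i j k →
      a i j k * (dpow i x * ξ * (pow Y j 0 * pow Z k 0)
        + pow X i 0 * (dpow j y * η * pow Z k 0 + pow Y j 0 * (dpow k z * ζ)))
      ≡ ξ * gx i j k + η * gy i j k + ζ * gz i j k
    term i j k rewrite pow-zeroth X i | pow-zeroth Y j | pow-zeroth Z k =
      solve 10 (λ a dx dy dz px py pz ξ η ζ →
        a :* (dx :* ξ :* (py :* pz) :+ px :* (dy :* η :* pz :+ py :* (dz :* ζ)))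
        := ξ :* (a :* (dx :* (py :* pz))) :+ η :* (a :* (px :* (dy :* pz))) :+ ζ :* (a :* (px :* (py :* dz))))
        refl (a i j k) (dpow i x) (dpow j y) (dpow k z) (x ^ i) (y ^ j) (z ^ k) ξ η ζ
    δ-eq : Σ³ B (λ i j k →
      a i j k * (dpow i x * ξ * (pow Y j 0 * pow Z k 0)
        + pow X i 0 * (dpow j y * η * pow Z k 0 + pow Y j 0 * (dpow k z * ζ))))
      ≡ ξ * eval³ B (∂x a) x y z + η * eval³ B (∂y a) x y z + ζ * eval³ B (∂z a) x y z
    δ-eq = begin
      _ ≡⟨ Σ³-cong B term ⟩
      Σ³ B (λ i j k → ξ * gx i j k + η * gy i j k + ζ * gz i j k)
        ≡⟨ trans (Σ³-+ B _ _) (cong₂ _+_ (Σ³-+ B _ _) refl) ⟩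
      Σ³ B (λ i j k → ξ * gx i j k) + Σ³ B (λ i j k → η * gy i j k) + Σ³ B (λ i j k → ζ * gz i j k)
        ≡⟨ cong₂ _+_ (cong₂ _+_ (Σ³-*ˡ B ξ gx) (Σ³-*ˡ B η gy)) (Σ³-*ˡ B ζ gz) ⟩
      ξ * Σ³ B gx + η * Σ³ B gy + ζ * Σ³ B gz
        ≡⟨ cong₂ _+_ (cong₂ _+_ (cong (ξ *_) (eval-∂x B a box x y z)) (cong (η *_) (eval-∂y B a box x y z)))
             (cong (ζ *_) (eval-∂z B a box x y z)) ⟩
      _ ∎

-- Univariate polynomials as coefficient lists, and root counting.

module Univariate (𝔽 : FiniteField) where
  open Field 𝔽
  open Series 𝔽

  coeff : List F → Series
  coeff []      n       = 0#
  coeff (a ∷ p) zero    = a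
  coeff (a ∷ p) (suc n) = coeff p n

  eval : List F → F → F
  eval []      t = 0#
  eval (a ∷ p) t = a + t * eval p t

  infixl 6 _⊞_
  _⊞_ : List F → List F → List F
  []      ⊞ q       = q
  (a ∷ p) ⊞ []      = a ∷ p
  (a ∷ p) ⊞ (b ∷ q) = (a + b) ∷ (p ⊞ q)

  scale : F → List F → List F
  scale c = map (c *_)

  infixl 7 _⊠_
  _⊠_ : List F → List F → List F
  []      ⊠ q = []
  (a ∷ p) ⊠ q = scale a q ⊞ (0# ∷ p ⊠ q)

  coeff-⊞ : ∀ p q n → coeff (p ⊞ q) n ≡ coeff p n + coeff q n
  coeff-⊞ []      q       n       = sym (+-identityˡ _)
  coeff-⊞ (a ∷ p) []      n       = sym (+-identityʳ _)
  coeff-⊞ (a ∷ p) (b ∷ q) zero    = refl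
  coeff-⊞ (a ∷ p) (b ∷ q) (suc n) = coeff-⊞ p q n

  coeff-scale : ∀ c p n → coeff (scale c p) n ≡ c * coeff p n
  coeff-scale c []      n       = sym (zeroʳ c)
  coeff-scale c (a ∷ p) zero    = refl
  coeff-scale c (a ∷ p) (suc n) = coeff-scale c p n

  private
    mul-zeroˡ : ∀ V n → mul (λ _ → 0#) V n ≡ 0#
    mul-zeroˡ V zero    = zeroˡ _
    mul-zeroˡ V (suc n) = trans (cong₂ _+_ (zeroˡ _) (mul-zeroˡ V n)) (+-identityˡ _)

  coeff-⊠ : ∀ p q n → coeff (p ⊠ q) n ≡ mul (coeff p) (coeff q) n
  coeff-⊠ []      q n       = sym (mul-zeroˡ (coeff q) n)
  coeff-⊠ (a ∷ p) q zero    = trans (coeff-⊞ (scale a q) _ 0)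
    (trans (+-identityʳ _) (coeff-scale a q 0))
  coeff-⊠ (a ∷ p) q (suc n) = trans (coeff-⊞ (scale a q) _ (suc n))
    (cong₂ _+_ (coeff-scale a q (suc n)) (coeff-⊠ p q n))

  eval-⊞ : ∀ p q t → eval (p ⊞ q) t ≡ eval p t + eval q t
  eval-⊞ []      q       t = sym (+-identityˡ _)
  eval-⊞ (a ∷ p) []      t = sym (+-identityʳ _)
  eval-⊞ (a ∷ p) (b ∷ q) t = trans (cong (λ e → a + b + t * e) (eval-⊞ p q t))
    (solve 5 (λ a b t p q → a :+ b :+ t :* (p :+ q) := a :+ t :* p :+ (b :+ t :* q)) refl
      a b t (eval p t) (eval q t))

  eval-scale : ∀ c p t → eval (scale c p) t ≡ c * eval p t
  eval-scale c []      t = sym (zeroʳ c)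
  eval-scale c (a ∷ p) t = trans (cong (λ e → c * a + t * e) (eval-scale c p t))
    (solve 4 (λ c a t p → c :* a :+ t :* (c :* p) := c :* (a :+ t :* p)) refl c a t (eval p t))

  eval-⊠ : ∀ p q t → eval (p ⊠ q) t ≡ eval p t * eval q t
  eval-⊠ []      q t = sym (zeroˡ _)
  eval-⊠ (a ∷ p) q t = begin
    eval (scale a q ⊞ (0# ∷ p ⊠ q)) t             ≡⟨ eval-⊞ (scale a q) _ t ⟩
    eval (scale a q) t + (0# + t * eval (p ⊠ q) t)
      ≡⟨ cong₂ (λ u v → u + (0# + t * v)) (eval-scale a q t) (eval-⊠ p q t) ⟩
    a * eval q t + (0# + t * (eval p t * eval q t))
      ≡⟨ solve 4 (λ a t p q → a :* q :+ (:0 :+ t :* (p :* q)) := (a :+ t :* p) :* q) refl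
           a t (eval p t) (eval q t) ⟩
    (a + t * eval p t) * eval q t                   ∎
    where open ≡-Reasoning

  length-⊞ : ∀ p q {n} → length p ℕ.≤ n → length q ℕ.≤ n → length (p ⊞ q) ℕ.≤ n
  length-⊞ []      q       lp       lq       = lq
  length-⊞ (a ∷ p) []      lp       lq       = lp
  length-⊞ (a ∷ p) (b ∷ q) (s≤s lp) (s≤s lq) = s≤s (length-⊞ p q lp lq)

  length-⊠ : ∀ p q {m n} → length p ℕ.≤ suc m → length q ℕ.≤ suc n → length (p ⊠ q) ℕ.≤ suc (m ℕ.+ n)
  length-⊠ []      q lp lq = z≤n
  length-⊠ (a ∷ p) q {m} {n} (s≤s lp) lq = length-⊞ (scale a q) _
    (ℕₚ.≤-trans (ℕₚ.≤-reflexive (length-map _ q)) (ℕₚ.≤-trans lq (s≤s (ℕₚ.m≤n+m n m))))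
    (s≤s (tail p m lp))
    where
    tail : ∀ p m → length p ℕ.≤ m → length (p ⊠ q) ℕ.≤ m ℕ.+ n
    tail []      m       _  = z≤n
    tail (b ∷ p) (suc m) lp = length-⊠ (b ∷ p) q lp lq

  -- The quotient of p by t − r: its coefficients are the values at r of the proper suffixes of p.
  quotient : F → List F → List F
  quotient r []      = []
  quotient r (a ∷ p) with p
  ... | []    = []
  ... | b ∷ s = eval (b ∷ s) r ∷ quotient r (b ∷ s)

  eval-quotient : ∀ r p t → eval p t ≡ eval p r + (t - r) * eval (quotient r p) t
  eval-quotient r []          t = sym (trans (+-identityˡ _) (zeroʳ _))
  eval-quotient r (a ∷ [])    t = solve 3 (λ a t r → a :+ t :* :0 := a :+ r :* :0 :+ (t :- r) :* :0) refl a t r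
  eval-quotient r (a ∷ b ∷ s) t = trans (cong (λ e → a + t * e) (eval-quotient r (b ∷ s) t))
    (solve 5 (λ a t r e w → a :+ t :* (e :+ (t :- r) :* w) := a :+ r :* e :+ (t :- r) :* (e :+ t :* w)) refl
      a t r (eval (b ∷ s) r) (eval (quotient r (b ∷ s)) t))

  length-quotient : ∀ r p {n} → length p ℕ.≤ suc n → length (quotient r p) ℕ.≤ n
  length-quotient r []          lp = z≤n
  length-quotient r (a ∷ [])    lp = z≤n
  length-quotient r (a ∷ b ∷ s) (s≤s {n = suc n} lp) = s≤s (length-quotient r (b ∷ s) lp)

  -- The leading entry of the quotient is the value at `r` of the tail of `p`, so `qz 0` is exactly
  -- the evaluation hypothesis needed for the tail.
  zero-quotient : ∀ r p → (∀ n → coeff (quotient r p) n ≡ 0#) → eval p r ≡ 0# → ∀ n → coeff p n ≡ 0#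
  zero-quotient r []          qz ev n       = refl
  zero-quotient r (a ∷ [])    qz ev zero    = trans (solve 2 (λ a r → a := a :+ r :* :0) refl a r) ev
  zero-quotient r (a ∷ [])    qz ev (suc n) = refl
  zero-quotient r (a ∷ b ∷ s) qz ev zero    = trans (trans (sym (+-identityʳ a))
    (cong (a +_) (sym (trans (cong (r *_) (qz 0)) (zeroʳ r))))) ev
  zero-quotient r (a ∷ b ∷ s) qz ev (suc n) = zero-quotient r (b ∷ s) (qz ∘ suc) (qz 0) n

  -- Dividing out one root shortens `p` by one, and the other roots survive in the quotient because
  -- they differ from the one removed.
  roots⇒zero : ∀ rs p → Unique rs → length p ℕ.≤ length rs → All (λ r → eval p r ≡ 0#) rs →
               ∀ n → coeff p n ≡ 0#
  roots⇒zero []       []      _ _ _ n = refl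
  roots⇒zero (r ∷ rs) p (r∉rs ∷ uniq) lp (root ∷ roots) = zero-quotient r p
    (roots⇒zero rs (quotient r p) uniq (length-quotient r p lp)
      (All.zipWith (λ { (r≢s , ps) → *≢0 (λ s-r≡0 → r≢s (sym (x-y≡0⇒x≡y s-r≡0)))
        (trans (sym (+-identityˡ _)) (trans (cong₂ _+_ (sym root) refl) (trans (sym (eval-quotient r p _)) ps))) })
        (r∉rs , roots)))
    root

  -- U is the coefficient sequence of a polynomial of degree at most n whose values are given by g.
  record Rep (n : ℕ) (U : Series) (g : F → F) : Set where
    constructor rep
    field
      list   : List F
      degree : length list ℕ.≤ suc n
      coeffs : ∀ k → coeff list k ≡ U k
      values : ∀ t → eval list t ≡ g t

  rep-weaken : ∀ {m n U g} → m ℕ.≤ n → Rep m U g → Rep n U g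
  rep-weaken m≤n (rep p l c v) = rep p (ℕₚ.≤-trans l (s≤s m≤n)) c v

  rep-zero : ∀ {n} → Rep n (λ _ → 0#) (λ _ → 0#)
  rep-zero = rep [] z≤n (λ _ → refl) (λ _ → refl)

  rep-resp : ∀ {n U U′ g g′} → (∀ k → U k ≡ U′ k) → (∀ t → g t ≡ g′ t) → Rep n U g → Rep n U′ g′
  rep-resp eU eg (rep p l c v) = rep p l (λ k → trans (c k) (eU k)) (λ t → trans (v t) (eg t))

  rep-add : ∀ {n U V g h} → Rep n U g → Rep n V h → Rep n (λ k → U k + V k) (λ t → g t + h t)
  rep-add (rep p l c v) (rep p′ l′ c′ v′) = rep (p ⊞ p′) (length-⊞ p p′ l l′)
    (λ k → trans (coeff-⊞ p p′ k) (cong₂ _+_ (c k) (c′ k)))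
    (λ t → trans (eval-⊞ p p′ t) (cong₂ _+_ (v t) (v′ t)))

  rep-scale : ∀ {n U g} a → Rep n U g → Rep n (λ k → a * U k) (λ t → a * g t)
  rep-scale a (rep p l c v) = rep (scale a p) (ℕₚ.≤-trans (ℕₚ.≤-reflexive (length-map _ p)) l)
    (λ k → trans (coeff-scale a p k) (cong (a *_) (c k)))
    (λ t → trans (eval-scale a p t) (cong (a *_) (v t)))

  rep-mul : ∀ {m n U V g h} → Rep m U g → Rep n V h → Rep (m ℕ.+ n) (mul U V) (λ t → g t * h t)
  rep-mul (rep p l c v) (rep p′ l′ c′ v′) = rep (p ⊠ p′) (length-⊠ p p′ l l′)
    (λ k → trans (coeff-⊠ p p′ k) (mul-cong k (λ j _ → c j) (λ j _ → c′ j)))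
    (λ t → trans (eval-⊠ p p′ t) (cong₂ _*_ (v t) (v′ t)))

  rep-pow : ∀ {n U g} → Rep n U g → ∀ e → Rep (e ℕ.* n) (pow U e) (λ t → g t ^ e)
  rep-pow R zero    = rep (1# ∷ []) (s≤s z≤n) (λ { zero → refl ; (suc k) → refl })
    (λ t → trans (cong (1# +_) (zeroʳ t)) (+-identityʳ 1#))
  rep-pow R (suc e) = rep-mul R (rep-pow R e)

  rep-Σ : ∀ {n} B {U : ℕ → Series} {g : ℕ → F → F} → (∀ i → Rep n (U i) (g i)) →
          Rep n (λ k → Σ B (λ i → U i k)) (λ t → Σ B (λ i → g i t))
  rep-Σ zero    R = rep-zero
  rep-Σ (suc B) R = rep-add (rep-Σ B R) (R B)

  Weighted : ℕ → ℕ → Coeff → Set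
  Weighted d D a = ∀ i j k → D ℕ.< i ℕ.+ (j ℕ.+ k ℕ.* d) → a i j k ≡ 0#

  -- The weights (1,1,d) are the degrees of the substituted polynomials. A monomial of weight above
  -- `D` has coefficient zero, so the zero polynomial represents it.
  rep-eval³ : ∀ {d D X Y Z g h e} B a → Weighted d D a → Rep 1 X g → Rep 1 Y h → Rep d Z e →
              Rep D (eval³ₛ B a X Y Z) (λ t → eval³ B a (g t) (h t) (e t))
  rep-eval³ {d} {D} {X} {Y} {Z} {g} {h} {e} B a wt RX RY RZ =
    rep-Σ B λ i → rep-Σ B λ j → rep-Σ B λ k → term i j k
    where
    term : ∀ i j k → Rep D (λ n → a i j k * mul (pow X i) (mul (pow Y j) (pow Z k)) n)
                           (λ t → a i j k * (g t ^ i * (h t ^ j * e t ^ k)))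
    term i j k with i ℕ.+ (j ℕ.+ k ℕ.* d) ℕ.≤? D
    ... | yes ≤D = rep-scale (a i j k) (rep-weaken
          (subst (ℕ._≤ D) (cong₂ (λ u v → u ℕ.+ (v ℕ.+ k ℕ.* d)) (sym (ℕₚ.*-identityʳ i)) (sym (ℕₚ.*-identityʳ j))) ≤D)
          (rep-mul (rep-pow RX i) (rep-mul (rep-pow RY j) (rep-pow RZ k))))
    ... | no ≰D = rep-resp (λ _ → zero-*) (λ _ → zero-*) rep-zero
      where
      zero-* : ∀ {x} → 0# ≡ a i j k * x
      zero-* {x} = sym (trans (cong (_* x) (wt i j k (ℕₚ.≰⇒> ≰D))) (zeroˡ x))

  rep-vanish : ∀ {n U g} → Rep n U g → ∀ ts → Unique ts → n ℕ.< length ts →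
               All (λ t → g t ≡ 0#) ts → ∀ k → U k ≡ 0#
  rep-vanish (rep p l c v) ts uniq n<ts roots k = trans (sym (c k))
    (roots⇒zero ts p uniq (ℕₚ.≤-trans l n<ts) (All.map (λ {t} → trans (v t)) roots) k)

-- Characteristic p and the Frobenius map.

-- Punching out a missed value would inject a finite set into a smaller one.
injective⇒surjective : ∀ n (h : Fin n → Fin n) → Injective _≡_ _≡_ h → ∀ j → ∃ λ i → h i ≡ j
injective⇒surjective (suc n) h inj j with Finₚ.any? (λ i → h i Fin.≟ j)
... | yes hit  = hit
... | no  miss = contradiction
  (Finₚ.injective⇒≤ {f = λ i → Fin.punchOut {i = j} {j = h i} (λ eq → miss (i , sym eq))}
    (λ {x} {y} eq → inj (Finₚ.punchOut-injective (λ e → miss (x , sym e)) (λ e → miss (y , sym e)) eq)))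
  (ℕₚ.<⇒≱ ℕₚ.≤-refl)

module Frobenius (𝔽 : FiniteField) where
  open Field 𝔽

  -- `p` is stored through its predecessor so that it reduces to a successor. In place of primality
  -- the record keeps minimality, which directly makes `nat k` invertible for 0 < k < p.
  record Characteristic : Set where
    field
      p-1      : ℕ
      p-1≢0    : 1 ℕ.≤ p-1
    p : ℕ
    p = suc p-1
    field
      nat-p    : nat p ≡ 0#
      minimal  : ∀ k → 0 ℕ.< k → k ℕ.< p → nat k ≢ 0#

  private
    to-from : ∀ x → Inverse.to enum (Inverse.from enum x) ≡ x
    to-from = Inverse.strictlyInverseˡ enum

    from-injective : ∀ {x y} → Inverse.from enum x ≡ Inverse.from enum y → x ≡ y
    from-injective eq = trans (sym (to-from _)) (trans (cong (Inverse.to enum) eq) (to-from _))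

    to-injective : ∀ {i j} → Inverse.to enum i ≡ Inverse.to enum j → i ≡ j
    to-injective eq = trans (sym (Inverse.strictlyInverseʳ enum _))
      (trans (cong (Inverse.from enum) eq) (Inverse.strictlyInverseʳ enum _))

    nat-period : ∃ λ n → 0 ℕ.< n × nat n ≡ 0#
    nat-period with Finₚ.pigeonhole {q} {suc q} ℕₚ.≤-refl (Inverse.from enum ∘ nat ∘ Fin.toℕ)
    ... | i , j , i<j , eq = Fin.toℕ j ℕ.∸ Fin.toℕ i , ℕₚ.m<n⇒0<n∸m i<j ,
      (begin
        nat (Fin.toℕ j ℕ.∸ Fin.toℕ i)
          ≡⟨ solve 2 (λ d e → d := d :+ e :- e) refl _ (nat (Fin.toℕ i)) ⟩
        nat (Fin.toℕ j ℕ.∸ Fin.toℕ i) + nat (Fin.toℕ i) - nat (Fin.toℕ i)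
          ≡⟨ cong (_- nat (Fin.toℕ i)) (nat-+ (Fin.toℕ j ℕ.∸ Fin.toℕ i) (Fin.toℕ i)) ⟨
        nat (Fin.toℕ j ℕ.∸ Fin.toℕ i ℕ.+ Fin.toℕ i) - nat (Fin.toℕ i)
          ≡⟨ cong (λ k → nat k - nat (Fin.toℕ i)) (ℕₚ.m∸n+n≡m (ℕₚ.<⇒≤ i<j)) ⟩
        nat (Fin.toℕ j) - nat (Fin.toℕ i)
          ≡⟨ cong (_- nat (Fin.toℕ i)) (sym nat-eq) ⟩
        nat (Fin.toℕ i) - nat (Fin.toℕ i)
          ≡⟨ -‿inverseʳ _ ⟩
        0# ∎)
      where
      open ≡-Reasoning
      nat-eq : nat (Fin.toℕ i) ≡ nat (Fin.toℕ j)
      nat-eq = from-injective eq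

    least-period : ∀ n → 0 ℕ.< n → nat n ≡ 0# → Characteristic
    least-period = <-rec _ step
      where
      step : ∀ n → (∀ {m} → m ℕ.< n → 0 ℕ.< m → nat m ≡ 0# → Characteristic) →
             0 ℕ.< n → nat n ≡ 0# → Characteristic
      step (suc zero) rec _ eq = contradiction (sym eq) 0≢1
      step n@(suc (suc n-2)) rec _ eq with ℕₚ.anyUpTo? (λ k → (1 ℕ.≤? k) ×-dec (nat k ≟ 0#)) n
      ... | yes (k , k<n , 0<k , eqk) = rec k<n 0<k eqk
      ... | no  none = record
        { p-1 = suc n-2 ; p-1≢0 = s≤s z≤n ; nat-p = eq
        ; minimal = λ k 0<k k<n eqk → none (k , k<n , 0<k , eqk) }

  abstract
    characteristic : Characteristic
    characteristic with n , 0<n , eq ← nat-period = least-period n 0<n eq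

  open Characteristic characteristic public

  -- binomial y n k = C(n,k) yⁿ⁻ᵏ, the coefficient of tᵏ in (y + t)ⁿ.
  binomial : F → ℕ → ℕ → F
  binomial y zero    zero    = 1#
  binomial y zero    (suc k) = 0#
  binomial y (suc n) zero    = y * binomial y n zero
  binomial y (suc n) (suc k) = y * binomial y n (suc k) + binomial y n k

  binomial-theorem : ∀ y t n N → n ℕ.< N → (y + t) ^ n ≡ Σ N (λ k → binomial y n k * t ^ k)
  binomial-theorem y t zero (suc N) _ = sym (begin
    Σ (suc N) (λ k → binomial y 0 k * t ^ k)                ≡⟨ Σ-head N _ ⟩
    1# * 1# + Σ N (λ k → 0# * t ^ suc k)                    ≡⟨ cong (1# * 1# +_) (Σ-zero N λ _ _ → zeroˡ _) ⟩
    1# * 1# + 0#                                            ≡⟨ solve 0 (:1 :* :1 :+ :0 := :1) refl ⟩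
    1#                                                      ∎)
    where open ≡-Reasoning
  binomial-theorem y t (suc n) (suc N) (s≤s n<N) = sym (begin
    Σ (suc N) (λ k → binomial y (suc n) k * t ^ k)
      ≡⟨ Σ-head N _ ⟩
    y * b 0 * 1# + Σ N (λ k → (y * b (suc k) + b k) * (t * t ^ k))
      ≡⟨ cong (y * b 0 * 1# +_) (Σ-cong N λ k →
           solve 5 (λ y u v t w → (y :* u :+ v) :* (t :* w) := y :* (u :* (t :* w)) :+ t :* (v :* w)) refl
             y (b (suc k)) (b k) t (t ^ k)) ⟩
    y * b 0 * 1# + Σ N (λ k → y * (b (suc k) * t ^ suc k) + t * (b k * t ^ k))
      ≡⟨ cong (y * b 0 * 1# +_) (trans (Σ-+ N _ _) (cong₂ _+_ (Σ-*ˡ N y _) (Σ-*ˡ N t _))) ⟩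
    y * b 0 * 1# + (y * Σ N (λ k → b (suc k) * t ^ suc k) + t * Σ N (λ k → b k * t ^ k))
      ≡⟨ solve 5 (λ y u s t v → y :* u :* :1 :+ (y :* s :+ t :* v) := y :* (u :* :1 :+ s) :+ t :* v) refl
           y (b 0) (Σ N (λ k → b (suc k) * t ^ suc k)) t (Σ N (λ k → b k * t ^ k)) ⟩
    y * (b 0 * 1# + Σ N (λ k → b (suc k) * t ^ suc k)) + t * Σ N (λ k → b k * t ^ k)
      ≡⟨ cong₂ (λ u v → y * u + t * v)
           (trans (sym (Σ-head N _)) (sym (binomial-theorem y t n (suc N) (ℕₚ.m<n⇒m<1+n n<N))))
           (sym (binomial-theorem y t n N n<N)) ⟩
    y * (y + t) ^ n + t * (y + t) ^ n
      ≡⟨ distribʳ _ _ _ ⟨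
    (y + t) ^ suc n ∎)
    where
    open ≡-Reasoning
    b = binomial y n

  binomial-0 : ∀ y n → binomial y n 0 ≡ y ^ n
  binomial-0 y zero    = refl
  binomial-0 y (suc n) = cong (y *_) (binomial-0 y n)

  binomial-> : ∀ y n k → n ℕ.< k → binomial y n k ≡ 0#
  binomial-> y zero    (suc k) _         = refl
  binomial-> y (suc n) (suc k) (s≤s n<k) = trans
    (cong₂ (λ u v → y * u + v) (binomial-> y n (suc k) (ℕₚ.m<n⇒m<1+n n<k)) (binomial-> y n k n<k))
    (trans (+-identityʳ _) (zeroʳ y))

  binomial-n : ∀ y n → binomial y n n ≡ 1#
  binomial-n y zero    = refl
  binomial-n y (suc n) = trans
    (cong₂ (λ u v → y * u + v) (binomial-> y n (suc n) ℕₚ.≤-refl) (binomial-n y n))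
    (trans (cong (_+ 1#) (zeroʳ y)) (+-identityˡ _))

  -- The identity (k+1) C(n+1,k+1) = (n+1) C(n,k). For n + 1 = p the right side is zero and k + 1 <
  -- p is invertible, so the inner binomial coefficients vanish without any divisibility argument on
  -- integers.
  binomial-absorb : ∀ y n k → nat (suc k) * binomial y (suc n) (suc k) ≡ nat (suc n) * binomial y n k
  binomial-absorb y zero    zero    = solve 1 (λ y → :1 :* (y :* :0 :+ :1) := :1 :* :1) refl y
  binomial-absorb y zero    (suc k) = solve 2 (λ y m → m :* (y :* :0 :+ :0) := :1 :* :0) refl y (nat (suc (suc k)))
  binomial-absorb y (suc n) zero    = begin
    1# * (y * binomial y (suc n) 1 + y * b)      ≡⟨ cong (λ u → 1# * (y * u + y * b)) (trans (sym (*-identityˡ _)) (binomial-absorb y n 0)) ⟩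
    1# * (y * (nat (suc n) * b) + y * b)         ≡⟨ solve 3 (λ y m b → :1 :* (y :* (m :* b) :+ y :* b) := (:1 :+ m) :* (y :* b)) refl y (nat (suc n)) b ⟩
    (1# + nat (suc n)) * (y * b)                 ∎
    where
    open ≡-Reasoning
    b = binomial y n 0
  binomial-absorb y (suc n) (suc k) = begin
    nat (suc (suc k)) * (y * b₂ + b₁)
      ≡⟨ solve 4 (λ y m u v → (:1 :+ m) :* (y :* u :+ v) := y :* ((:1 :+ m) :* u) :+ m :* v :+ v) refl
           y (nat (suc k)) b₂ b₁ ⟩
    y * (nat (suc (suc k)) * b₂) + nat (suc k) * b₁ + b₁
      ≡⟨ cong₂ (λ u v → y * u + v + b₁) (binomial-absorb y n (suc k)) (binomial-absorb y n k) ⟩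
    y * (nat (suc n) * binomial y n (suc k)) + nat (suc n) * binomial y n k + b₁
      ≡⟨ solve 4 (λ y m u v → y :* (m :* u) :+ m :* v :+ (y :* u :+ v) := (:1 :+ m) :* (y :* u :+ v)) refl
           y (nat (suc n)) (binomial y n (suc k)) (binomial y n k) ⟩
    nat (suc (suc n)) * b₁ ∎
    where
    open ≡-Reasoning
    b₁ = binomial y (suc n) (suc k)
    b₂ = binomial y (suc n) (suc (suc k))

  frobenius-+ : ∀ y t → (y + t) ^ p ≡ y ^ p + t ^ p
  frobenius-+ y t = begin
    (y + t) ^ p                                              ≡⟨ binomial-theorem y t p (suc p) ℕₚ.≤-refl ⟩
    Σ p (λ k → b k * t ^ k) + b p * t ^ p                    ≡⟨ cong (_+ b p * t ^ p) (Σ-head p-1 (λ k → b k * t ^ k)) ⟩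
    b 0 * 1# + Σ p-1 (λ k → b (suc k) * t ^ suc k) + b p * t ^ p
      ≡⟨ cong₂ (λ u v → b 0 * 1# + u + v * t ^ p) (Σ-zero p-1 middle) (binomial-n y p) ⟩
    b 0 * 1# + 0# + 1# * t ^ p                               ≡⟨ cong (λ u → u * 1# + 0# + 1# * t ^ p) (binomial-0 y p) ⟩
    y ^ p * 1# + 0# + 1# * t ^ p                             ≡⟨ solve 2 (λ u v → u :* :1 :+ :0 :+ :1 :* v := u :+ v) refl (y ^ p) (t ^ p) ⟩
    y ^ p + t ^ p                                            ∎
    where
    open ≡-Reasoning
    b = binomial y p
    middle : ∀ k → k ℕ.< p-1 → b (suc k) * t ^ suc k ≡ 0#
    middle k k<p-1 = trans (cong (_* t ^ suc k) (*≢0 (minimal (suc k) (s≤s z≤n) (s≤s k<p-1))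
      (trans (binomial-absorb y p-1 k) (trans (cong (_* binomial y p-1 k) nat-p) (zeroˡ _))))) (zeroˡ _)

  ^≡0 : ∀ x n → x ^ n ≡ 0# → x ≡ 0#
  ^≡0 x zero    eq = contradiction (sym eq) 0≢1
  ^≡0 x (suc n) eq with x ≟ 0#
  ... | yes x≡0 = x≡0
  ... | no  x≢0 = ^≡0 x n (*≢0 x≢0 eq)

  frobenius-Σ : ∀ n g → Σ n g ^ p ≡ Σ n (λ i → g i ^ p)
  frobenius-Σ zero    g = zeroˡ _
  frobenius-Σ (suc n) g = trans (frobenius-+ (Σ n g) (g n)) (cong (_+ g n ^ p) (frobenius-Σ n g))

  -- Expanding ((x - y) + y)ᵖ instead of (x - y)ᵖ avoids the sign (-1)ᵖ.
  frobenius-injective : ∀ {x y} → x ^ p ≡ y ^ p → x ≡ y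
  frobenius-injective {x} {y} eq = x-y≡0⇒x≡y (^≡0 (x - y) p (begin
    (x - y) ^ p                    ≡⟨ solve 2 (λ u v → u := u :+ v :- v) refl ((x - y) ^ p) (y ^ p) ⟩
    (x - y) ^ p + y ^ p - y ^ p    ≡⟨ cong (_- y ^ p) (frobenius-+ (x - y) y) ⟨
    (x - y + y) ^ p - y ^ p        ≡⟨ cong (λ u → u ^ p - y ^ p) (solve 2 (λ x y → x :- y :+ y := x) refl x y) ⟩
    x ^ p - y ^ p                  ≡⟨ cong (_- y ^ p) eq ⟩
    y ^ p - y ^ p                  ≡⟨ -‿inverseʳ _ ⟩
    0#                             ∎))
    where open ≡-Reasoning

  private
    frobenius-surjective : ∀ x → ∃ λ y → y ^ p ≡ x
    frobenius-surjective x = Inverse.to enum (proj₁ preimage) , from-injective (proj₂ preimage)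
      where
      preimage : ∃ λ i → Inverse.from enum (Inverse.to enum i ^ p) ≡ Inverse.from enum x
      preimage = injective⇒surjective q (λ i → Inverse.from enum (Inverse.to enum i ^ p))
        (λ eq → to-injective (frobenius-injective (from-injective eq))) (Inverse.from enum x)

  abstract
    root : F → F
    root x = proj₁ (frobenius-surjective x)

    root-^ : ∀ x → root x ^ p ≡ x
    root-^ x = proj₂ (frobenius-surjective x)

  root-0 : root 0# ≡ 0#
  root-0 = ^≡0 (root 0#) p (root-^ 0#)

  nat≡0⇒p∣ : ∀ n → nat n ≡ 0# → ∃ λ t → n ≡ t ℕ.* p
  nat≡0⇒p∣ n eq with n % p in r-eq
  ... | zero  = n / p , trans (m≡m%n+[m/n]*n n p) (cong (ℕ._+ n / p ℕ.* p) r-eq)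
  ... | suc r = contradiction nat-r (minimal (suc r) (s≤s z≤n) (subst (ℕ._< p) r-eq (m%n<n n p)))
    where
    open ≡-Reasoning
    nat-r : nat (suc r) ≡ 0#
    nat-r = begin
      nat (suc r)                           ≡⟨ solve 2 (λ a b → a := a :+ b :* :0) refl _ (nat (n / p)) ⟩
      nat (suc r) + nat (n / p) * 0#        ≡⟨ cong (λ z → nat (suc r) + nat (n / p) * z) nat-p ⟨
      nat (suc r) + nat (n / p) * nat p     ≡⟨ cong (nat (suc r) +_) (nat-* (n / p) p) ⟨
      nat (suc r) + nat (n / p ℕ.* p)       ≡⟨ nat-+ (suc r) _ ⟨
      nat (suc r ℕ.+ n / p ℕ.* p)           ≡⟨ cong (λ s → nat (s ℕ.+ n / p ℕ.* p)) r-eq ⟨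
      nat (n % p ℕ.+ n / p ℕ.* p)           ≡⟨ cong nat (m≡m%n+[m/n]*n n p) ⟨
      nat n                                 ≡⟨ eq ⟩
      0#                                    ∎

  Σ-split : ∀ m n g → Σ (m ℕ.+ n) g ≡ Σ n g + Σ m (λ r → g (r ℕ.+ n))
  Σ-split zero    n g = sym (+-identityʳ _)
  Σ-split (suc m) n g = trans (cong (_+ g (m ℕ.+ n)) (Σ-split m n g)) (+-assoc _ _ _)

  private
    nat-offset : ∀ r i → nat (r ℕ.+ i ℕ.* p) ≡ nat r
    nat-offset r i = trans (nat-+ r _) (trans (cong (nat r +_)
      (trans (nat-* i p) (trans (cong (nat i *_) nat-p) (zeroʳ _)))) (+-identityʳ _))

  -- The range is enlarged from `B` to `B * p` by zero terms; it then splits into `B` blocks of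
  -- length `p`, of which only the first terms survive.
  Σ-multiples : ∀ B g → (∀ i → nat i ≢ 0# → g i ≡ 0#) → (∀ i → B ℕ.≤ i → g i ≡ 0#) →
                Σ B g ≡ Σ B (λ i → g (i ℕ.* p))
  Σ-multiples B g sparse vanish = trans (sym (Σ-extend g (ℕₚ.m≤m*n B p) vanish)) (blocks B)
    where
    open ≡-Reasoning
    blocks : ∀ n → Σ (n ℕ.* p) g ≡ Σ n (λ i → g (i ℕ.* p))
    blocks zero    = refl
    blocks (suc n) = begin
      Σ (p ℕ.+ n ℕ.* p) g                                 ≡⟨ Σ-split p (n ℕ.* p) g ⟩
      Σ (n ℕ.* p) g + Σ p (λ r → g (r ℕ.+ n ℕ.* p))       ≡⟨ cong₂ _+_ (blocks n) (Σ-head p-1 (λ r → g (r ℕ.+ n ℕ.* p))) ⟩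
      Σ n (λ i → g (i ℕ.* p)) + (g (n ℕ.* p) + Σ p-1 (λ r → g (suc r ℕ.+ n ℕ.* p)))
        ≡⟨ cong (λ s → Σ n (λ i → g (i ℕ.* p)) + (g (n ℕ.* p) + s)) (Σ-zero p-1 λ r r<p-1 →
             sparse _ (λ eq → minimal (suc r) (s≤s z≤n) (s≤s r<p-1) (trans (sym (nat-offset (suc r) n)) eq))) ⟩
      Σ n (λ i → g (i ℕ.* p)) + (g (n ℕ.* p) + 0#)        ≡⟨ cong (Σ n (λ i → g (i ℕ.* p)) +_) (+-identityʳ _) ⟩
      Σ n (λ i → g (i ℕ.* p)) + g (n ℕ.* p)               ∎

-- Descent to a polynomial with a simple zero on the graph of f.

module Descent (𝔽 : FiniteField) (d D B : ℕ) (0<d : 0 ℕ.< d) (D<B : D ℕ.< B)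
               (f : Point 𝔽 → FiniteField.Carrier 𝔽) (S : List (Point 𝔽)) where
  open Field 𝔽
  open Series 𝔽
  open Univariate 𝔽
  open Frobenius 𝔽

  linear : F → F → Series
  linear c s zero          = c
  linear c s (suc zero)    = s
  linear c s (suc (suc _)) = 0#

  rep-linear : ∀ c s → Rep 1 (linear c s) (λ t → c + t * s)
  rep-linear c s = rep (c ∷ s ∷ []) (s≤s (s≤s z≤n))
    (λ { zero → refl ; (suc zero) → refl ; (suc (suc _)) → refl })
    (λ t → solve 3 (λ c s t → c :+ t :* (s :+ t :* :0) := c :+ t :* s) refl c s t)

  at : Coeff → Point 𝔽 → F
  at a b = eval³ B a (proj₁ b) (proj₂ b) (f b)

  Vanishes : Coeff → Set
  Vanishes a = ∀ {b} → b ∈ S → at a b ≡ 0#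

  -- On the line of slope m through a, f agrees at more than D points of S (the parameters ts)
  -- with a polynomial of degree at most d which takes the value f a at a.
  record Ray (a : Point 𝔽) (m : F) : Set where
    field
      coefficients : Series
      value        : F → F
      polynomial   : Rep d coefficients value
      start        : coefficients 0 ≡ f a
      ts           : List F
      unique       : Unique ts
      many         : D ℕ.< length ts
      agree        : All (λ t → linePt 𝔽 a (1# , m) t ∈ S × f (linePt 𝔽 a (1# , m) t) ≡ value t) ts

  along : Coeff → (a : Point 𝔽) (m : F) → Series → Series
  along A a m = eval³ₛ B A (linear (proj₁ a) 1#) (linear (proj₂ a) m)

  -- The restriction has degree at most `D`, and the ray supplies more than `D` distinct parameters
  -- at which it vanishes.
  along-ray : ∀ {A} → Weighted d D A → Vanishes A → ∀ {a m} (r : Ray a m) →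
              ∀ n → along A a m (Ray.coefficients r) n ≡ 0#
  along-ray {A} wt van {a} {m} r = rep-vanish
    (rep-eval³ B A wt (rep-linear (proj₁ a) 1#) (rep-linear (proj₂ a) m) polynomial) ts unique many
    (All.map (λ { {t} (b∈S , eq) →
      trans (cong (eval³ B A (proj₁ a + t * 1#) (proj₂ a + t * m)) (sym eq)) (van b∈S) }) agree)
    where open Ray r

  weighted⇒inBox : ∀ {A} → Weighted d D A → InBox B A
  weighted⇒inBox wt i j k (inj₁ B≤i) = wt i j k (ℕₚ.≤-trans D<B (ℕₚ.≤-trans B≤i (ℕₚ.m≤m+n i _)))
  weighted⇒inBox wt i j k (inj₂ (inj₁ B≤j)) = wt i j k
    (ℕₚ.≤-trans D<B (ℕₚ.≤-trans B≤j (ℕₚ.≤-trans (ℕₚ.m≤m+n j _) (ℕₚ.m≤n+m _ i))))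
  weighted⇒inBox wt i j k (inj₂ (inj₂ B≤k)) = wt i j k
    (ℕₚ.≤-trans D<B (ℕₚ.≤-trans B≤k (ℕₚ.≤-trans (ℕₚ.m≤m*n k d)
      (ℕₚ.≤-trans (ℕₚ.m≤n+m _ j) (ℕₚ.m≤n+m _ i)))))
    where instance _ = ℕ.>-nonZero 0<d

  private
    constant : F → Series
    constant c = linear c 0#

    mul-flat : ∀ U V → U 1 ≡ 0# → V 1 ≡ 0# → mul U V 1 ≡ 0#
    mul-flat U V u v = trans (cong₂ (λ a b → U 0 * a + b * V 0) v u)
      (trans (cong₂ _+_ (zeroʳ _) (zeroˡ _)) (+-identityˡ _))

    pow-flat : ∀ U → U 1 ≡ 0# → ∀ n → pow U n 1 ≡ 0#
    pow-flat U u zero    = refl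
    pow-flat U u (suc n) = mul-flat U (pow U n) u (pow-flat U u n)

    eval-flat : ∀ A X Y Z → X 1 ≡ 0# → Y 1 ≡ 0# → Z 1 ≡ 0# → eval³ₛ B A X Y Z 1 ≡ 0#
    eval-flat A X Y Z x y z = Σ-zero B λ i _ → Σ-zero B λ j _ → Σ-zero B λ k _ → trans
      (cong (A i j k *_) (mul-flat (pow X i) (mul (pow Y j) (pow Z k)) (pow-flat X x i)
        (mul-flat (pow Y j) (pow Z k) (pow-flat Y y j) (pow-flat Z z k)))) (zeroʳ _)

    near-constant : ∀ U → Near 0 U (constant (U 0)) (U 1)
    near-constant U = near (λ { zero z≤n → refl }) (sym (+-identityˡ _))

  -- The coefficient of t in A along the ray. The ray is compared with the constant series at its
  -- start, which contribute nothing in degree 1 (`eval-flat`); their difference is the directional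
  -- derivative.
  tangent : ∀ {A} → Weighted d D A → Vanishes A → ∀ {a m} (r : Ray a m) →
            at (∂x A) a + m * at (∂y A) a + Ray.coefficients r 1 * at (∂z A) a ≡ 0#
  tangent {A} wt van {a} {m} r = begin
    at (∂x A) a + m * at (∂y A) a + P 1 * at (∂z A) a
      ≡⟨ cong (λ s → s + m * at (∂y A) a + P 1 * at (∂z A) a) (*-identityˡ _) ⟨
    1# * at (∂x A) a + m * at (∂y A) a + P 1 * at (∂z A) a
      ≡⟨ cong (λ z → 1# * ev (∂x A) z + m * ev (∂y A) z + P 1 * ev (∂z A) z) start ⟨
    1# * ev (∂x A) (P 0) + m * ev (∂y A) (P 0) + P 1 * ev (∂z A) (P 0)
      ≡⟨ +-identityˡ _ ⟨
    0# + (1# * ev (∂x A) (P 0) + m * ev (∂y A) (P 0) + P 1 * ev (∂z A) (P 0))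
      ≡⟨ cong (_+ (1# * ev (∂x A) (P 0) + m * ev (∂y A) (P 0) + P 1 * ev (∂z A) (P 0)))
           (eval-flat A (constant (proj₁ a)) (constant (proj₂ a)) (constant (P 0)) refl refl refl) ⟨
    eval³ₛ B A (constant (proj₁ a)) (constant (proj₂ a)) (constant (P 0)) 1
      + (1# * ev (∂x A) (P 0) + m * ev (∂y A) (P 0) + P 1 * ev (∂z A) (P 0))
      ≡⟨ Near.at (near-eval³ B A (weighted⇒inBox wt) (near-constant (linear (proj₁ a) 1#))
           (near-constant (linear (proj₂ a) m)) (near-constant P)) ⟨
    along A a m P 1
      ≡⟨ along-ray wt van r 1 ⟩
    0# ∎
    where
    open ≡-Reasoning
    open Ray r using (start)
    P = Ray.coefficients r
    ev : Coeff → F → F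
    ev A z = eval³ B A (proj₁ a) (proj₂ a) z

  TwoRays : Point 𝔽 → Set
  TwoRays a = ∃ λ m → ∃ λ m′ → m ≢ m′ × Ray a m × Ray a m′

  -- Without the z-term the tangent relation is linear in the two remaining partial derivatives; two
  -- distinct slopes make the system regular.
  gradient-vanishes : (∀ {a} → a ∈ S → TwoRays a) → ∀ {A} → Weighted d D A → Vanishes A →
                      Vanishes (∂z A) → Vanishes (∂x A) × Vanishes (∂y A)
  gradient-vanishes rays {A} wt van vanz = (λ a∈S → proj₁ (both a∈S)) , (λ a∈S → proj₂ (both a∈S))
    where
    both : ∀ {a} → a ∈ S → at (∂x A) a ≡ 0# × at (∂y A) a ≡ 0#
    both {a} a∈S with m , m′ , m≢m′ , r , r′ ← rays a∈S = gx≡0 , gy≡0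
      where
      open ≡-Reasoning
      gx = at (∂x A) a
      gy = at (∂y A) a
      slope : ∀ {m} → Ray a m → gx + m * gy ≡ 0#
      slope {m} r = trans (solve 3 (λ x y c → x :+ y := x :+ y :+ c :* :0) refl gx (m * gy) (Ray.coefficients r 1))
        (trans (cong (λ z → gx + m * gy + Ray.coefficients r 1 * z) (sym (vanz a∈S))) (tangent wt van r))
      gy≡0 : gy ≡ 0#
      gy≡0 = *≢0 (λ eq → m≢m′ (x-y≡0⇒x≡y eq)) (begin
        (m - m′) * gy                       ≡⟨ solve 4 (λ m m′ x y → (m :- m′) :* y := x :+ m :* y :- (x :+ m′ :* y)) refl m m′ gx gy ⟩
        gx + m * gy - (gx + m′ * gy)        ≡⟨ cong₂ _-_ (slope r) (slope r′) ⟩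
        0# - 0#                             ≡⟨ -‿inverseʳ 0# ⟩
        0#                                  ∎)
      gx≡0 : gx ≡ 0#
      gx≡0 = trans (trans (sym (+-identityʳ gx)) (cong (gx +_) (sym (trans (cong (m *_) gy≡0) (zeroʳ m))))) (slope r)

  Nonzero : Coeff → Set
  Nonzero a = ∃ λ i → ∃ λ j → ∃ λ k → a i j k ≢ 0#

  nonzero? : ∀ a → InBox B a → Nonzero a ⊎ (∀ i j k → a i j k ≡ 0#)
  nonzero? a box with ℕₚ.anyUpTo? (λ i → ℕₚ.anyUpTo? (λ j → ℕₚ.anyUpTo? (λ k → ¬? (a i j k ≟ 0#)) B) B) B
  ... | yes (i , _ , j , _ , k , _ , a≢0) = inj₁ (i , j , k , a≢0)
  ... | no none = inj₂ zeros
    where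
    zeros : ∀ i j k → a i j k ≡ 0#
    zeros i j k with i ℕ.<? B | j ℕ.<? B | k ℕ.<? B
    ... | no i≮B | _ | _ = box i j k (inj₁ (ℕₚ.≮⇒≥ i≮B))
    ... | yes _ | no j≮B | _ = box i j k (inj₂ (inj₁ (ℕₚ.≮⇒≥ j≮B)))
    ... | yes _ | yes _ | no k≮B = box i j k (inj₂ (inj₂ (ℕₚ.≮⇒≥ k≮B)))
    ... | yes i<B | yes j<B | yes k<B = decidable-stable (a i j k ≟ 0#)
            (λ a≢0 → none (i , i<B , j , j<B , k , k<B , a≢0))

  -- The measure of the descent: differentiation and extraction of a p-th root both lower it, while
  -- the weighted bound `D` is carried along unchanged.
  Total : ℕ → Coeff → Set
  Total n a = ∀ i j k → n ℕ.< i ℕ.+ (j ℕ.+ k) → a i j k ≡ 0#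

  private
    nat*0 : ∀ n {x} → x ≡ 0# → nat n * x ≡ 0#
    nat*0 n refl = zeroʳ _

    total-∂x : ∀ {n a} → Total (suc n) a → Total n (∂x a)
    total-∂x tot i j k lt = nat*0 (suc i) (tot (suc i) j k (s≤s lt))

    total-∂y : ∀ {n a} → Total (suc n) a → Total n (∂y a)
    total-∂y {n} tot i j k lt = nat*0 (suc j) (tot i (suc j) k (subst (suc n ℕ.<_) (sym (ℕₚ.+-suc i (j ℕ.+ k))) (s≤s lt)))

    total-∂z : ∀ {n a} → Total (suc n) a → Total n (∂z a)
    total-∂z {n} tot i j k lt = nat*0 (suc k) (tot i j (suc k)
      (subst (suc n ℕ.<_) (sym (trans (cong (i ℕ.+_) (ℕₚ.+-suc j k)) (ℕₚ.+-suc i (j ℕ.+ k)))) (s≤s lt)))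

    weighted-∂x : ∀ {a} → Weighted d D a → Weighted d D (∂x a)
    weighted-∂x wt i j k lt = nat*0 (suc i) (wt (suc i) j k (ℕₚ.m<n⇒m<1+n lt))

    weighted-∂y : ∀ {a} → Weighted d D a → Weighted d D (∂y a)
    weighted-∂y wt i j k lt = nat*0 (suc j) (wt i (suc j) k
      (ℕₚ.≤-trans lt (ℕₚ.+-monoʳ-≤ i (ℕₚ.n≤1+n _))))

    weighted-∂z : ∀ {a} → Weighted d D a → Weighted d D (∂z a)
    weighted-∂z wt i j k lt = nat*0 (suc k) (wt i j (suc k)
      (ℕₚ.≤-trans lt (ℕₚ.+-monoʳ-≤ i (ℕₚ.+-monoʳ-≤ j (ℕₚ.m≤n+m _ d)))))

  module Root (A : Coeff) (box : InBox B A)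
              (dx : ∀ i j k → ∂x A i j k ≡ 0#) (dy : ∀ i j k → ∂y A i j k ≡ 0#) (dz : ∀ i j k → ∂z A i j k ≡ 0#)
              where
    -- Where all three derivatives vanish, only exponents divisible by `p` occur. Dividing the
    -- exponents by `p` and taking roots of the coefficients yields a polynomial whose p-th power
    -- has the values of `A`.
    rootOf : Coeff
    rootOf i j k = root (A (i ℕ.* p) (j ℕ.* p) (k ℕ.* p))

    private
      sparse-x : ∀ i j k → nat i ≢ 0# → A i j k ≡ 0#
      sparse-x zero    j k n≢0 = contradiction refl n≢0
      sparse-x (suc i) j k n≢0 = *≢0 n≢0 (dx i j k)

      sparse-y : ∀ i j k → nat j ≢ 0# → A i j k ≡ 0#
      sparse-y i zero    k n≢0 = contradiction refl n≢0
      sparse-y i (suc j) k n≢0 = *≢0 n≢0 (dy i j k)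

      sparse-z : ∀ i j k → nat k ≢ 0# → A i j k ≡ 0#
      sparse-z i j zero    n≢0 = contradiction refl n≢0
      sparse-z i j (suc k) n≢0 = *≢0 n≢0 (dz i j k)

      0* : ∀ {x} w → x ≡ 0# → x * w ≡ 0#
      0* w refl = zeroˡ w

    eval-rootOf : ∀ x y z → eval³ B rootOf x y z ^ p ≡ eval³ B A x y z
    eval-rootOf x y z = begin
      eval³ B rootOf x y z ^ p
        ≡⟨ trans (frobenius-Σ B _) (Σ-cong B λ i → trans (frobenius-Σ B _) (Σ-cong B λ j → frobenius-Σ B _)) ⟩
      Σ³ B (λ i j k → (rootOf i j k * (x ^ i * (y ^ j * z ^ k))) ^ p)
        ≡⟨ Σ³-cong B term ⟩
      Σ³ B (λ i j k → g (i ℕ.* p) (j ℕ.* p) (k ℕ.* p))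
        ≡⟨ Σ-cong B (λ i → Σ-cong B λ j → Σ-multiples B (g (i ℕ.* p) (j ℕ.* p))
             (λ k n≢0 → 0* _ (sparse-z _ _ k n≢0)) (λ k B≤k → 0* _ (box _ _ k (inj₂ (inj₂ B≤k))))) ⟨
      Σ B (λ i → Σ B (λ j → Σ B (g (i ℕ.* p) (j ℕ.* p))))
        ≡⟨ Σ-cong B (λ i → Σ-multiples B (λ j → Σ B (g (i ℕ.* p) j))
             (λ j n≢0 → Σ-zero B λ k _ → 0* _ (sparse-y _ j k n≢0))
             (λ j B≤j → Σ-zero B λ k _ → 0* _ (box _ j k (inj₂ (inj₁ B≤j))))) ⟨
      Σ B (λ i → Σ B (λ j → Σ B (g (i ℕ.* p) j)))
        ≡⟨ Σ-multiples B (λ i → Σ B (λ j → Σ B (g i j)))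
             (λ i n≢0 → Σ-zero B λ j _ → Σ-zero B λ k _ → 0* _ (sparse-x i j k n≢0))
             (λ i B≤i → Σ-zero B λ j _ → Σ-zero B λ k _ → 0* _ (box i j k (inj₁ B≤i))) ⟨
      eval³ B A x y z ∎
      where
      open ≡-Reasoning
      g : Coeff
      g i j k = A i j k * (x ^ i * (y ^ j * z ^ k))
      ^-^ : ∀ u n → (u ^ n) ^ p ≡ u ^ (n ℕ.* p)
      ^-^ u n = trans (sym (^-* u p n)) (cong (u ^_) (ℕₚ.*-comm p n))
      term : ∀ i j k → (rootOf i j k * (x ^ i * (y ^ j * z ^ k))) ^ p ≡ g (i ℕ.* p) (j ℕ.* p) (k ℕ.* p)
      term i j k = trans (^-distrib-* _ _ p) (cong₂ _*_ (root-^ _)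
        (trans (^-distrib-* _ _ p) (cong₂ _*_ (^-^ x i) (trans (^-distrib-* _ _ p) (cong₂ _*_ (^-^ y j) (^-^ z k))))))

    vanishes-rootOf : Vanishes A → Vanishes rootOf
    vanishes-rootOf van b∈S = ^≡0 _ p (trans (eval-rootOf _ _ _) (van b∈S))

    nonzero-rootOf : Nonzero A → Nonzero rootOf
    nonzero-rootOf (i , j , k , A≢0)
      with i′ , refl ← nat≡0⇒p∣ i (decidable-stable (nat i ≟ 0#) (A≢0 ∘ sparse-x i j k))
         | j′ , refl ← nat≡0⇒p∣ j (decidable-stable (nat j ≟ 0#) (A≢0 ∘ sparse-y i j k))
         | k′ , refl ← nat≡0⇒p∣ k (decidable-stable (nat k ≟ 0#) (A≢0 ∘ sparse-z i j k))
      = i′ , j′ , k′ , λ r≡0 → A≢0 (trans (sym (root-^ _)) (trans (cong (_^ p) r≡0) (zeroˡ _)))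

    private
      root≡0 : ∀ {x} → x ≡ 0# → root x ≡ 0#
      root≡0 refl = root-0

    weighted-rootOf : Weighted d D A → Weighted d D rootOf
    weighted-rootOf wt i j k lt = root≡0 (wt _ _ _ (ℕₚ.≤-trans lt
      (ℕₚ.+-mono-≤ (ℕₚ.m≤m*n i p) (ℕₚ.+-mono-≤ (ℕₚ.m≤m*n j p) (ℕₚ.*-monoˡ-≤ d (ℕₚ.m≤m*n k p))))))

    -- A monomial of degree e > n in the root comes from one of degree p·e in `A`, and p·e ≥ 2e > n
    -- + 1 because e ≥ 1.
    total-rootOf : ∀ {n} → Total (suc n) A → Total n rootOf
    total-rootOf {n} tot i j k lt = root≡0 (tot _ _ _ (begin
      suc (suc n)                              ≤⟨ s≤s lt ⟩
      suc (i ℕ.+ (j ℕ.+ k))                    ≤⟨ ℕₚ.+-monoˡ-≤ (i ℕ.+ (j ℕ.+ k)) (ℕₚ.≤-trans (s≤s z≤n) lt) ⟩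
      (i ℕ.+ (j ℕ.+ k)) ℕ.+ (i ℕ.+ (j ℕ.+ k))  ≡⟨ cong ((i ℕ.+ (j ℕ.+ k)) ℕ.+_) (ℕₚ.+-identityʳ _) ⟨
      2 ℕ.* (i ℕ.+ (j ℕ.+ k))                  ≤⟨ ℕₚ.*-monoˡ-≤ (i ℕ.+ (j ℕ.+ k)) (s≤s p-1≢0) ⟩
      p ℕ.* (i ℕ.+ (j ℕ.+ k))                  ≡⟨ ℕₚ.*-comm p _ ⟩
      (i ℕ.+ (j ℕ.+ k)) ℕ.* p                  ≡⟨ ℕₚ.*-distribʳ-+ p i (j ℕ.+ k) ⟩
      i ℕ.* p ℕ.+ (j ℕ.+ k) ℕ.* p              ≡⟨ cong (i ℕ.* p ℕ.+_) (ℕₚ.*-distribʳ-+ p j k) ⟩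
      i ℕ.* p ℕ.+ (j ℕ.* p ℕ.+ k ℕ.* p)        ∎))
      where open ℕₚ.≤-Reasoning

  private
    Σ-first : ∀ g → (∀ i → 1 ℕ.≤ i → g i ≡ 0#) → Σ B g ≡ g 0
    Σ-first g vanish = trans (Σ-extend g (ℕₚ.≤-trans (s≤s z≤n) D<B) vanish) (+-identityˡ _)

    constant-nonvanishing : ∀ {a} → Total 0 a → Nonzero a → ∀ x y z → eval³ B a x y z ≢ 0#
    constant-nonvanishing {a} tot (i , j , k , a≢0) x y z eq = a≢0 (a≡0 i j k)
      where
      z* : ∀ {u} w → u ≡ 0# → u * w ≡ 0#
      z* w refl = zeroˡ w
      collapse : eval³ B a x y z ≡ a 0 0 0 * (1# * (1# * 1#))
      collapse = trans (Σ-first _ λ { (suc i) _ → Σ-zero B λ j _ → Σ-zero B λ k _ → z* _ (tot (suc i) j k (s≤s z≤n)) })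
        (trans (Σ-first _ λ { (suc j) _ → Σ-zero B λ k _ → z* _ (tot 0 (suc j) k (s≤s z≤n)) })
        (Σ-first _ λ { (suc k) _ → z* _ (tot 0 0 (suc k) (s≤s z≤n)) }))
      a000 : a 0 0 0 ≡ 0#
      a000 = trans (solve 1 (λ u → u := u :* (:1 :* (:1 :* :1))) refl (a 0 0 0)) (trans (sym collapse) eq)
      a≡0 : ∀ i j k → a i j k ≡ 0#
      a≡0 zero    zero    zero    = a000
      a≡0 zero    zero    (suc k) = tot 0 0 (suc k) (s≤s z≤n)
      a≡0 zero    (suc j) k       = tot 0 (suc j) k (s≤s z≤n)
      a≡0 (suc i) j       k       = tot (suc i) j k (s≤s z≤n)

  record Separable : Set where
    field
      A        : Coeff
      weighted : Weighted d D A
      vanishes : Vanishes A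
      centre   : Point 𝔽
      centre∈S : centre ∈ S
      simple   : at (∂z A) centre ≢ 0#

  -- Descent on the degree: if ∂z A vanishes on the graph of f over S, so do ∂x A and ∂y A, and
  -- one of them may replace A unless A is the p-th power of a polynomial, which then replaces A.
  separable : ∀ {a₀} → a₀ ∈ S → (∀ {a} → a ∈ S → TwoRays a) →
              ∀ n A → Total n A → Weighted d D A → Nonzero A → Vanishes A → Separable
  separable a₀∈S rays zero    A tot wt nz van = contradiction (van a₀∈S) (constant-nonvanishing tot nz _ _ _)
  separable a₀∈S rays (suc n) A tot wt nz van = decide (Any.any? (λ b → ¬? (at (∂z A) b ≟ 0#)) S)
    where
    pthRoot : (∀ i j k → ∂x A i j k ≡ 0#) → (∀ i j k → ∂y A i j k ≡ 0#) → (∀ i j k → ∂z A i j k ≡ 0#) → Separable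
    pthRoot dx dy dz = separable a₀∈S rays n rootOf (total-rootOf tot) (weighted-rootOf wt)
                         (nonzero-rootOf nz) (vanishes-rootOf van)
      where open Root A (weighted⇒inBox wt) dx dy dz

    degenerate : Vanishes (∂z A) → Vanishes (∂x A) × Vanishes (∂y A) → Separable
    degenerate vanz (vanx , vany) =
      [ (λ nzz → separable a₀∈S rays n (∂z A) (total-∂z tot) (weighted-∂z wt) nzz vanz)
      , (λ dz → [ (λ nzy → separable a₀∈S rays n (∂y A) (total-∂y tot) (weighted-∂y wt) nzy vany)
                , (λ dy → [ (λ nzx → separable a₀∈S rays n (∂x A) (total-∂x tot) (weighted-∂x wt) nzx vanx)
                          , (λ dx → pthRoot dx dy dz) ]′ (nonzero? (∂x A) (weighted⇒inBox (weighted-∂x wt))))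
                ]′ (nonzero? (∂y A) (weighted⇒inBox (weighted-∂y wt))))
      ]′ (nonzero? (∂z A) (weighted⇒inBox (weighted-∂z wt)))

    decide : Dec (Any (λ b → at (∂z A) b ≢ 0#) S) → Separable
    decide (yes some) = record
      { A = A ; weighted = wt ; vanishes = van ; centre = proj₁ (find some)
      ; centre∈S = proj₁ (proj₂ (find some)) ; simple = proj₂ (proj₂ (find some)) }
    decide (no none) = degenerate vanz (gradient-vanishes rays wt van vanz)
      where
      vanz : Vanishes (∂z A)
      vanz {b} b∈S = decidable-stable (at (∂z A) b ≟ 0#) (λ ≢0 → none (lose b∈S ≢0))

-- Bivariate polynomials and forms centred at a point.

module Bivariate (𝔽 : FiniteField) where
  open Field 𝔽
  open Series 𝔽
  open Univariate 𝔽

  -- The recursions inside evalUni and evalBi are local definitions without a name; each is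
  -- recovered here as the solution of a metavariable applied to a variable list.
  private mutual
    loopUni : ∀ d → (Fin (suc d) → F) → F → List (Fin (suc d)) → F
    loopUni d c t w = _

    unfoldUni : ∀ d c t → ∃ λ (h : F) → evalUni 𝔽 d c t ≡ h + loopUni d c t (tabulate {n = d} Fin.suc)
    unfoldUni d c t with tabulate {n = d} Fin.suc
    ... | w = _ , refl

  private mutual
    loopBi : ∀ d → (ℕ → ℕ → F) → F → F → List ℕ → F
    loopBi d c x y w = _

    unfoldBi : ∀ d c x y → ∃ λ (h : F) → evalBi 𝔽 d c (x , y) ≡ h + loopBi d c x y (applyUpTo suc d)
    unfoldBi d c x y with applyUpTo suc d
    ... | w = _ , refl

  private mutual
    loopRow : ∀ d → (ℕ → ℕ → F) → F → F → ℕ → List ℕ → F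
    loopRow d c x y i w = _

    unfoldRow : ∀ d c x y i is → ∃ λ (h : F) →
                loopBi d c x y (i ∷ is) ≡ h + loopRow d c x y i (applyUpTo suc (d ℕ.∸ i)) + loopBi d c x y is
    unfoldRow d c x y i is with applyUpTo suc (d ℕ.∸ i)
    ... | w = _ , refl

  Σ-applyUpTo : ∀ (g : List ℕ → F) (h : ℕ → F) → g [] ≡ 0# → (∀ i is → g (i ∷ is) ≡ h i + g is) →
                ∀ n φ → g (applyUpTo φ n) ≡ Σ n (h ∘ φ)
  Σ-applyUpTo g h gn gc zero    φ = gn
  Σ-applyUpTo g h gn gc (suc n) φ = trans (gc _ _)
    (trans (cong (h (φ 0) +_) (Σ-applyUpTo g h gn gc n (φ ∘ suc))) (sym (Σ-head n (h ∘ φ))))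

  private
    row-Σ : ∀ d c x y i n φ → loopRow d c x y i (applyUpTo φ n) ≡ Σ n (λ j → c i (φ j) * x ^ i * y ^ φ j)
    row-Σ d c x y i = Σ-applyUpTo (loopRow d c x y i) (λ j → c i j * x ^ i * y ^ j) refl (λ _ _ → refl)

  evalBi-Σ : ∀ d c x y → evalBi 𝔽 d c (x , y) ≡ Σ (suc d) (λ i → Σ (suc (d ℕ.∸ i)) (λ j → c i j * x ^ i * y ^ j))
  evalBi-Σ d c x y = Σ-applyUpTo (loopBi d c x y) _ refl
    (λ i is → cong (_+ loopBi d c x y is) (row-Σ d c x y i (suc (d ℕ.∸ i)) (λ j → j))) (suc d) (λ i → i)

  private
    -- A tail of the sum in `evalUni` starts at tˢ, whereas the Horner scheme of `eval` restarts at
    -- t⁰; the offset `s` carries the induction across this difference.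
    loopUni-eval : ∀ d c t n φ s → (∀ (i : Fin n) → Fin.toℕ (φ i) ≡ Fin.toℕ i ℕ.+ s) →
                   loopUni d c t (tabulate φ) ≡ t ^ s * eval (tabulate (c ∘ φ)) t
    loopUni-eval d c t zero    φ s eq = sym (zeroʳ _)
    loopUni-eval d c t (suc n) φ s eq = trans
      (cong₂ (λ e r → c (φ Fin.zero) * t ^ e + r) (eq Fin.zero)
        (loopUni-eval d c t n (φ ∘ Fin.suc) (suc s) (λ i → trans (eq (Fin.suc i)) (sym (ℕₚ.+-suc _ s)))))
      (solve 4 (λ c p t e → c :* p :+ t :* p :* e := p :* (c :+ t :* e)) refl
        (c (φ Fin.zero)) (t ^ s) t (eval (tabulate (c ∘ φ ∘ Fin.suc)) t))

  rep-evalUni : ∀ d c → Rep d (coeff (tabulate c)) (evalUni 𝔽 d c)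
  rep-evalUni d c = rep (tabulate c) (ℕₚ.≤-reflexive (length-tabulate c)) (λ _ → refl)
    (λ t → sym (trans (loopUni-eval d c t (suc d) (λ i → i) 0 (λ i → sym (ℕₚ.+-identityʳ _))) (*-identityˡ _)))

  rep-Σ-value : ∀ {n U g} → Rep n U g → ∀ t → g t ≡ Σ (suc n) (λ k → U k * t ^ k)
  rep-Σ-value {n} (rep p l c v) t = trans (sym (v t)) (trans (expand p (suc n) l)
    (Σ-cong (suc n) λ k → cong (_* t ^ k) (c k)))
    where
    expand : ∀ p N → length p ℕ.≤ N → eval p t ≡ Σ N (λ k → coeff p k * t ^ k)
    expand []      N       l       = sym (Σ-zero N λ _ _ → zeroˡ _)
    expand (a ∷ p) (suc N) (s≤s l) = begin
      a + t * eval p t                                     ≡⟨ cong (λ e → a + t * e) (expand p N l) ⟩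
      a + t * Σ N (λ k → coeff p k * t ^ k)                ≡⟨ cong₂ _+_ (sym (*-identityʳ a)) (sym (Σ-*ˡ N t _)) ⟩
      a * 1# + Σ N (λ k → t * (coeff p k * t ^ k))         ≡⟨ cong (a * 1# +_) (Σ-cong N λ k →
        solve 3 (λ t c w → t :* (c :* w) := c :* (t :* w)) refl t (coeff p k) (t ^ k)) ⟩
      a * 1# + Σ N (λ k → coeff p k * t ^ suc k)           ≡⟨ Σ-head N (λ k → coeff (a ∷ p) k * t ^ k) ⟨
      Σ (suc N) (λ k → coeff (a ∷ p) k * t ^ k)            ∎
      where open ≡-Reasoning

  -- Certificates of being polynomial of total degree at most `n`. Sums and products are formed on
  -- certificates, and coefficients are extracted only once, in `pol⇒Σ²`. The constructor `ext`
  -- takes the place of function extensionality.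
  data Pol : ℕ → (Point 𝔽 → F) → Set where
    cst : ∀ {n} c → Pol n (λ _ → c)
    add  : ∀ {n g h} → Pol n g → Pol n h → Pol n (λ b → g b + h b)
    mulx : ∀ {n g} → Pol n g → Pol (suc n) (λ b → proj₁ b * g b)
    muly : ∀ {n g} → Pol n g → Pol (suc n) (λ b → proj₂ b * g b)
    ext  : ∀ {n g h} → Pol n g → (∀ b → g b ≡ h b) → Pol n h

  pol-weaken : ∀ {m n g} → m ℕ.≤ n → Pol m g → Pol n g
  pol-weaken m≤n       (cst c)  = cst c
  pol-weaken m≤n       (add p r) = add (pol-weaken m≤n p) (pol-weaken m≤n r)
  pol-weaken (s≤s m≤n) (mulx p)  = mulx (pol-weaken m≤n p)
  pol-weaken (s≤s m≤n) (muly p)  = muly (pol-weaken m≤n p)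
  pol-weaken m≤n       (ext p e) = ext (pol-weaken m≤n p) e

  pol-scale : ∀ {n g} c → Pol n g → Pol n (λ b → c * g b)
  pol-scale c (cst a)  = cst (c * a)
  pol-scale c (add p r) = ext (add (pol-scale c p) (pol-scale c r)) (λ b → sym (distribˡ _ _ _))
  pol-scale c (mulx {g = g} p) = ext (mulx (pol-scale c p))
    (λ b → solve 3 (λ x c g → x :* (c :* g) := c :* (x :* g)) refl (proj₁ b) c (g b))
  pol-scale c (muly {g = g} p) = ext (muly (pol-scale c p))
    (λ b → solve 3 (λ x c g → x :* (c :* g) := c :* (x :* g)) refl (proj₂ b) c (g b))
  pol-scale c (ext p e) = ext (pol-scale c p) (λ b → cong (c *_) (e b))

  pol-mul : ∀ {m n g h} → Pol m g → Pol n h → Pol (m ℕ.+ n) (λ b → g b * h b)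
  pol-mul {m} {n} (cst c) r = pol-weaken (ℕₚ.m≤n+m n m) (pol-scale c r)
  pol-mul (add p p′) r = ext (add (pol-mul p r) (pol-mul p′ r)) (λ b → sym (distribʳ _ _ _))
  pol-mul (mulx p)   r = ext (mulx (pol-mul p r)) (λ b → sym (*-assoc _ _ _))
  pol-mul (muly p)   r = ext (muly (pol-mul p r)) (λ b → sym (*-assoc _ _ _))
  pol-mul {h = h} (ext p e)  r = ext (pol-mul p r) (λ b → cong (_* h b) (e b))

  pol-Σ : ∀ {n} N {g : ℕ → Point 𝔽 → F} → (∀ i → i ℕ.< N → Pol n (g i)) → Pol n (λ b → Σ N (λ i → g i b))
  pol-Σ zero    P = cst 0#
  pol-Σ (suc N) P = add (pol-Σ N λ i i<N → P i (ℕₚ.m<n⇒m<1+n i<N)) (P N ℕₚ.≤-refl)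

  private
    Σ² : ℕ → (ℕ → ℕ → F) → F
    Σ² n g = Σ (suc n) λ i → Σ (suc (n ℕ.∸ i)) (g i)

    constantCoeff : F → ℕ → ℕ → F
    constantCoeff c zero    zero    = c
    constantCoeff c zero    (suc _) = 0#
    constantCoeff c (suc _) _       = 0#

    shiftx shifty : (ℕ → ℕ → F) → ℕ → ℕ → F
    shiftx c zero    j = 0#
    shiftx c (suc i) j = c i j
    shifty c i zero    = 0#
    shifty c i (suc j) = c i j

    0** : ∀ u v → 0# * u * v ≡ 0#
    0** u v = trans (cong (_* v) (zeroˡ u)) (zeroˡ v)

    eval-constantCoeff : ∀ n c x y → Σ² n (λ i j → constantCoeff c i j * x ^ i * y ^ j) ≡ c
    eval-constantCoeff n c x y = begin
      Σ² n (λ i j → constantCoeff c i j * x ^ i * y ^ j)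
        ≡⟨ Σ-head n _ ⟩
      Σ (suc n) (λ j → constantCoeff c 0 j * 1# * y ^ j)
        + Σ n (λ i → Σ (suc (n ℕ.∸ suc i)) (λ j → 0# * x ^ suc i * y ^ j))
        ≡⟨ cong₂ _+_ (Σ-head n _) (Σ-zero n λ i _ → Σ-zero (suc (n ℕ.∸ suc i)) λ j _ → 0** _ _) ⟩
      c * 1# * 1# + Σ n (λ j → 0# * 1# * y ^ suc j) + 0#
        ≡⟨ cong (λ s → c * 1# * 1# + s + 0#) (Σ-zero n λ j _ → 0** _ _) ⟩
      c * 1# * 1# + 0# + 0#
        ≡⟨ solve 1 (λ c → c :* :1 :* :1 :+ :0 :+ :0 := c) refl c ⟩
      c ∎
      where open ≡-Reasoning

    eval-shiftx : ∀ n c x y → Σ² (suc n) (λ i j → shiftx c i j * x ^ i * y ^ j)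
                              ≡ x * Σ² n (λ i j → c i j * x ^ i * y ^ j)
    eval-shiftx n c x y = begin
      Σ² (suc n) (λ i j → shiftx c i j * x ^ i * y ^ j)
        ≡⟨ Σ-head (suc n) _ ⟩
      Σ (suc (suc n)) (λ j → 0# * 1# * y ^ j) + Σ² n (λ i j → c i j * (x * x ^ i) * y ^ j)
        ≡⟨ cong₂ _+_ (Σ-zero (suc (suc n)) λ j _ → 0** _ _)
             (Σ-cong (suc n) λ i → trans (Σ-cong (suc (n ℕ.∸ i)) λ j →
               solve 4 (λ c x p r → c :* (x :* p) :* r := x :* (c :* p :* r)) refl (c i j) x (x ^ i) (y ^ j))
               (Σ-*ˡ (suc (n ℕ.∸ i)) x _)) ⟩
      0# + Σ (suc n) (λ i → x * Σ (suc (n ℕ.∸ i)) (λ j → c i j * x ^ i * y ^ j))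
        ≡⟨ trans (+-identityˡ _) (Σ-*ˡ (suc n) x _) ⟩
      x * Σ² n (λ i j → c i j * x ^ i * y ^ j) ∎
      where open ≡-Reasoning

    eval-shifty : ∀ n c x y → Σ² (suc n) (λ i j → shifty c i j * x ^ i * y ^ j)
                              ≡ y * Σ² n (λ i j → c i j * x ^ i * y ^ j)
    eval-shifty n c x y = begin
      Σ (suc n) row + row (suc n)
        ≡⟨ cong₂ _+_ (Σ-cong< (suc n) row-eq) last ⟩
      Σ (suc n) (λ i → y * Σ (suc (n ℕ.∸ i)) (λ j → c i j * x ^ i * y ^ j)) + 0#
        ≡⟨ trans (+-identityʳ _) (Σ-*ˡ (suc n) y _) ⟩
      y * Σ² n (λ i j → c i j * x ^ i * y ^ j) ∎
      where
      open ≡-Reasoning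
      row : ℕ → F
      row i = Σ (suc (suc n ℕ.∸ i)) (λ j → shifty c i j * x ^ i * y ^ j)
      -- The top row has the single entry j = 0, where `shifty` is zero.
      last : row (suc n) ≡ 0#
      last rewrite ℕₚ.n∸n≡0 n = trans (+-identityˡ _) (0** _ _)
      row-eq : ∀ i → i ℕ.< suc n → row i ≡ y * Σ (suc (n ℕ.∸ i)) (λ j → c i j * x ^ i * y ^ j)
      row-eq i (s≤s i≤n) rewrite ℕₚ.+-∸-assoc 1 i≤n = begin
        Σ (suc (suc (n ℕ.∸ i))) (λ j → shifty c i j * x ^ i * y ^ j)
          ≡⟨ Σ-head (suc (n ℕ.∸ i)) _ ⟩
        0# * x ^ i * 1# + Σ (suc (n ℕ.∸ i)) (λ j → c i j * x ^ i * (y * y ^ j))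
          ≡⟨ cong₂ _+_ (0** _ _) (trans (Σ-cong (suc (n ℕ.∸ i)) λ j →
               solve 4 (λ c p y r → c :* p :* (y :* r) := y :* (c :* p :* r)) refl (c i j) (x ^ i) y (y ^ j))
               (Σ-*ˡ (suc (n ℕ.∸ i)) y _)) ⟩
        0# + y * Σ (suc (n ℕ.∸ i)) (λ j → c i j * x ^ i * y ^ j)
          ≡⟨ +-identityˡ _ ⟩
        y * Σ (suc (n ℕ.∸ i)) (λ j → c i j * x ^ i * y ^ j) ∎

    pol⇒Σ² : ∀ {n g} → Pol n g → ∃ λ c → ∀ b → g b ≡ Σ² n (λ i j → c i j * proj₁ b ^ i * proj₂ b ^ j)
    pol⇒Σ² {n} (cst a) = constantCoeff a , λ b → sym (eval-constantCoeff n a _ _)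
    pol⇒Σ² {n} (add p p′) with c , eq ← pol⇒Σ² p | c′ , eq′ ← pol⇒Σ² p′ =
      (λ i j → c i j + c′ i j) , λ b → sym (trans
        (Σ-cong (suc n) λ i → trans (Σ-cong (suc (n ℕ.∸ i)) λ j →
          solve 4 (λ u v p r → (u :+ v) :* p :* r := u :* p :* r :+ v :* p :* r) refl
            (c i j) (c′ i j) (proj₁ b ^ i) (proj₂ b ^ j)) (Σ-+ (suc (n ℕ.∸ i)) _ _))
        (trans (Σ-+ (suc n) _ _) (cong₂ _+_ (sym (eq b)) (sym (eq′ b)))))
    pol⇒Σ² (mulx {n = n} p) with c , eq ← pol⇒Σ² p =
      shiftx c , λ b → trans (cong (proj₁ b *_) (eq b)) (sym (eval-shiftx n c _ _))
    pol⇒Σ² (muly {n = n} p) with c , eq ← pol⇒Σ² p =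
      shifty c , λ b → trans (cong (proj₂ b *_) (eq b)) (sym (eval-shifty n c _ _))
    pol⇒Σ² (ext p e) with c , eq ← pol⇒Σ² p = c , λ b → trans (sym (e b)) (eq b)

  pol⇒evalBi : ∀ {n g} → Pol n g → ∃ λ c → ∀ b → g b ≡ evalBi 𝔽 n c b
  pol⇒evalBi {n} p with c , eq ← pol⇒Σ² p = c , λ b → trans (eq b) (sym (evalBi-Σ n c (proj₁ b) (proj₂ b)))

  module Homogeneous (a : Point 𝔽) where
    -- h is the restriction to (1 , m) of a form of degree k in the coordinates centred at a.
    Hom : ℕ → (F → F) → Set
    Hom k h = ∃ λ H → Pol k H × (∀ t m → H (linePt 𝔽 a (1# , m) t) ≡ t ^ k * h m)

    hom-cast : ∀ {k l h} → k ≡ l → Hom k h → Hom l h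
    hom-cast refl hom = hom

    hom-add : ∀ {k g h} → Hom k g → Hom k h → Hom k (λ m → g m + h m)
    hom-add (G , pG , eG) (H , pH , eH) = (λ b → G b + H b) , add pG pH ,
      λ t m → trans (cong₂ _+_ (eG t m) (eH t m)) (sym (distribˡ _ _ _))

    hom-scale : ∀ {k h} c → Hom k h → Hom k (λ m → c * h m)
    hom-scale {k} {h} c (H , pH , eH) = (λ b → c * H b) , pol-scale c pH ,
      λ t m → trans (cong (c *_) (eH t m)) (solve 3 (λ c p h → c :* (p :* h) := p :* (c :* h)) refl c (t ^ k) (h m))

    hom-mul : ∀ {k l g h} → Hom k g → Hom l h → Hom (k ℕ.+ l) (λ m → g m * h m)
    hom-mul {k} {l} {g} {h} (G , pG , eG) (H , pH , eH) = (λ b → G b * H b) , pol-mul pG pH ,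
      λ t m → trans (cong₂ _*_ (eG t m) (eH t m)) (trans
        (solve 4 (λ p g r h → p :* g :* (r :* h) := p :* r :* (g :* h)) refl (t ^ k) (g m) (t ^ l) (h m))
        (cong (_* (g m * h m)) (sym (^-+ t k l))))

    hom-zero : ∀ {k} → Hom k (λ _ → 0#)
    hom-zero = (λ _ → 0#) , cst 0# , λ t m → sym (zeroʳ _)

    hom-constant : ∀ c → Hom 0 (λ _ → c)
    hom-constant c = (λ _ → c) , cst c , λ t m → sym (*-identityˡ c)

    hom-Σ : ∀ {k} B {h : ℕ → F → F} → (∀ i → Hom k (h i)) → Hom k (λ m → Σ B (λ i → h i m))
    hom-Σ zero    hs = hom-zero
    hom-Σ (suc B) hs = hom-add (hom-Σ B hs) (hs B)

    -- A family of series indexed by the slope `m` whose k-th coefficient is a form of degree `k` in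
    -- the direction (1 , m). Substitution into a polynomial preserves this grading, so Newton
    -- iteration never leaves it.
    Tame : (F → Series) → Set
    Tame G = ∀ k → Hom k (λ m → G m k)

    private
      -- `mul` recurses by shifting its left factor, which raises the degree of every coefficient
      -- relative to its index; `s` counts the shifts.
      tame-mul′ : ∀ n s {U V : F → Series} → (∀ k → Hom (s ℕ.+ k) (λ m → U m k)) → Tame V →
                  Hom (s ℕ.+ n) (λ m → mul (U m) (V m) n)
      tame-mul′ zero    s tU tV = hom-cast (ℕₚ.+-identityʳ _) (hom-mul (tU 0) (tV 0))
      tame-mul′ (suc n) s tU tV = hom-add
        (hom-cast (cong (ℕ._+ suc n) (ℕₚ.+-identityʳ s)) (hom-mul (tU 0) (tV (suc n))))
        (hom-cast (sym (ℕₚ.+-suc s n)) (tame-mul′ n (suc s) (λ k → hom-cast (ℕₚ.+-suc s k) (tU (suc k))) tV))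

    tame-mul : ∀ {U V} → Tame U → Tame V → Tame (λ m → mul (U m) (V m))
    tame-mul tU tV n = tame-mul′ n 0 tU tV

    tame-pow : ∀ {U} → Tame U → ∀ e → Tame (λ m → pow (U m) e)
    tame-pow tU zero    zero    = hom-constant 1#
    tame-pow tU zero    (suc k) = hom-zero
    tame-pow tU (suc e) = tame-mul tU (tame-pow tU e)

    tame-eval³ : ∀ B A {X Y Z} → Tame X → Tame Y → Tame Z → Tame (λ m → eval³ₛ B A (X m) (Y m) (Z m))
    tame-eval³ B A tX tY tZ n = hom-Σ B λ i → hom-Σ B λ j → hom-Σ B λ k →
      hom-scale (A i j k) (tame-mul (tame-pow tX i) (tame-mul (tame-pow tY j) (tame-pow tZ k)) n)

    hom-x : Hom 1 (λ _ → 1#)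
    hom-x = (λ b → proj₁ b * 1# + - proj₁ a) , add (mulx (cst 1#)) (cst _) ,
      λ t m → solve 2 (λ x t → (x :+ t :* :1) :* :1 :- x := t :* :1 :* :1) refl (proj₁ a) t

    hom-y : Hom 1 (λ m → m)
    hom-y = (λ b → proj₂ b * 1# + - proj₂ a) , add (muly (cst 1#)) (cst _) ,
      λ t m → solve 3 (λ y t m → (y :+ t :* m) :* :1 :- y := t :* :1 :* m) refl (proj₂ a) t m

-- Newton iteration at the centre.

module Newton (𝔽 : FiniteField) (d D B : ℕ) (0<d : 0 ℕ.< d) (D<B : D ℕ.< B)
              (f : Point 𝔽 → FiniteField.Carrier 𝔽) (S : List (Point 𝔽))
              (sep : Descent.Separable 𝔽 d D B 0<d D<B f S) where
  open Field 𝔽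
  open Series 𝔽
  open Univariate 𝔽
  open Bivariate 𝔽
  open Descent 𝔽 d D B 0<d D<B f S
  open Separable sep
  open Homogeneous centre

  private
    κ = at (∂z A) centre
    κ⁻¹ = proj₁ (inverse κ simple)

    tame-x : Tame (λ _ → linear (proj₁ centre) 1#)
    tame-x zero          = hom-constant _
    tame-x (suc zero)    = hom-x
    tame-x (suc (suc _)) = hom-zero

    tame-y : Tame (λ m → linear (proj₂ centre) m)
    tame-y zero          = hom-constant _
    tame-y (suc zero)    = hom-y
    tame-y (suc (suc _)) = hom-zero

    near-self : ∀ {n} U → Near n U U 0#
    near-self U = near (λ _ _ → refl) (sym (+-identityʳ _))

  -- Newton iteration: since ∂z A does not vanish at the centre, the equation A(X, Y, P) = 0 determines
  -- the coefficients of P one after the other, by a recursion which is the same for all slopes.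
  lift : ∀ k → ∃ λ G → Tame G × (∀ {m} (r : Ray centre m) j → j ℕ.≤ k → G m j ≡ Ray.coefficients r j)
  lift zero = (λ _ → linear (f centre) 0#) , tame , λ { r zero z≤n → sym (Ray.start r) }
    where
    tame : Tame (λ _ → linear (f centre) 0#)
    tame zero          = hom-constant _
    tame (suc zero)    = hom-zero
    tame (suc (suc _)) = hom-zero
  lift (suc k) with G , tG , G-eq ← lift k = G′ , tG′ , G′-eq
    where
    residue : F → F
    residue m = along A centre m (G m) (suc k)

    G′ : F → Series
    G′ m j with j ℕ.≟ suc k
    -- Adding h to this coefficient adds κ h to the residue, so this correction cancels it. The
    -- residue is itself a form of degree k + 1, which keeps the family tame.
    ... | yes _ = G m j + (- κ⁻¹) * residue m
    ... | no  _ = G m j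

    tG′ : Tame G′
    tG′ j with j ℕ.≟ suc k
    ... | yes refl = hom-add (tG j) (hom-scale (- κ⁻¹) (tame-eval³ B A tame-x tame-y tG (suc k)))
    ... | no  _    = tG j

    G′-eq : ∀ {m} (r : Ray centre m) j → j ℕ.≤ suc k → G′ m j ≡ Ray.coefficients r j
    G′-eq {m} r j j≤1+k with j ℕ.≟ suc k
    ... | no j≢1+k = G-eq r j (ℕ.s≤s⁻¹ (ℕₚ.≤∧≢⇒< j≤1+k j≢1+k))
    ... | yes refl = begin
      g + (- κ⁻¹) * ρ                       ≡⟨ cong (λ s → g + (- κ⁻¹) * s) ρ-eq ⟩
      g + (- κ⁻¹) * - ((P j - g) * κ)       ≡⟨ solve 4 (λ g i p k → g :+ (:- i) :* :- ((p :- g) :* k) := g :+ (p :- g) :* (k :* i)) refl g κ⁻¹ (P j) κ ⟩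
      g + (P j - g) * (κ * κ⁻¹)             ≡⟨ cong (λ s → g + (P j - g) * s) (proj₂ (inverse κ simple)) ⟩
      g + (P j - g) * 1#                    ≡⟨ solve 2 (λ g p → g :+ (p :- g) :* :1 := p) refl g (P j) ⟩
      P j                                   ∎
      where
      open ≡-Reasoning
      P = Ray.coefficients r
      g = G m (suc k)
      ρ = residue m
      -- The ray and the approximation first differ in degree k + 1. Since `A` vanishes along the
      -- ray, this difference times κ is minus the residue.
      N : Near k P (G m) (P (suc k) - g)
      N = near (λ i i≤k → sym (G-eq r i i≤k)) (solve 2 (λ p g → p := g :+ (p :- g)) refl (P (suc k)) g)
      ev : Coeff → F → F
      ev A z = eval³ B A (proj₁ centre) (proj₂ centre) z
      ρ-eq : ρ ≡ - ((P (suc k) - g) * κ)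
      ρ-eq = begin
        ρ ≡⟨ solve 4 (λ ρ e u v → ρ := ρ :+ (:0 :* u :+ :0 :* v :+ e) :- e) refl
               ρ ((P (suc k) - g) * κ) (ev (∂x A) (P 0)) (ev (∂y A) (P 0)) ⟩
        ρ + (0# * ev (∂x A) (P 0) + 0# * ev (∂y A) (P 0) + (P (suc k) - g) * κ) - (P (suc k) - g) * κ
          ≡⟨ cong (λ z → ρ + (0# * ev (∂x A) (P 0) + 0# * ev (∂y A) (P 0) + (P (suc k) - g) * ev (∂z A) z) - (P (suc k) - g) * κ)
               (Ray.start r) ⟨
        ρ + (0# * ev (∂x A) (P 0) + 0# * ev (∂y A) (P 0) + (P (suc k) - g) * ev (∂z A) (P 0)) - (P (suc k) - g) * κ
          ≡⟨ cong (_- (P (suc k) - g) * κ) (Near.at (near-eval³ B A (weighted⇒inBox weighted)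
               (near-self (linear (proj₁ centre) 1#)) (near-self (linear (proj₂ centre) m)) N)) ⟨
        along A centre m P (suc k) - (P (suc k) - g) * κ
          ≡⟨ cong (_- (P (suc k) - g) * κ) (along-ray weighted vanishes r (suc k)) ⟩
        0# - (P (suc k) - g) * κ
          ≡⟨ +-identityˡ _ ⟩
        - ((P (suc k) - g) * κ) ∎

  global : ∃ λ Q → ∀ {m} (r : Ray centre m) t → evalBi 𝔽 d Q (linePt 𝔽 centre (1# , m) t) ≡ Ray.value r t
  global = assemble (lift d)
    where
    assemble : (∃ λ G → Tame G × (∀ {m} (r : Ray centre m) j → j ℕ.≤ d → G m j ≡ Ray.coefficients r j)) →
               ∃ λ Q → ∀ {m} (r : Ray centre m) t → evalBi 𝔽 d Q (linePt 𝔽 centre (1# , m) t) ≡ Ray.value r t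
    assemble (G , tG , G-eq) = proj₁ poly , λ {m} r t →
      trans (sym (proj₂ poly (linePt 𝔽 centre (1# , m) t))) (trans
        (Σ-cong< (suc d) λ k k≤d → trans (proj₂ (proj₂ (tG k)) t m)
          (trans (*-comm _ _) (cong (_* t ^ k) (G-eq r k (ℕ.s≤s⁻¹ k≤d)))))
        (sym (rep-Σ-value (Ray.polynomial r) t)))
      where
      form : ℕ → Point 𝔽 → F
      form k = proj₁ (tG k)
      poly : ∃ λ c → ∀ b → Σ (suc d) (λ k → form k b) ≡ evalBi 𝔽 d c b
      poly = pol⇒evalBi (pol-Σ (suc d) {g = form} λ k k≤d → pol-weaken (ℕ.s≤s⁻¹ k≤d) (proj₁ (proj₂ (tG k))))

-- Cardinalities of duplicate-free lists.

extract : ∀ {A : Set} {x : A} {xs} → x ∈ xs → ∃ λ ys → xs ↭ x ∷ ys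
extract x∈xs with ys , zs , refl ← ∈-∃++ x∈xs = ys ++ zs , shift _ ys zs

unique-resp-↭ : ∀ {A : Set} {xs ys : List A} → xs ↭ ys → Unique xs → Unique ys
unique-resp-↭ Perm.refl          u = u
unique-resp-↭ (prep x σ)    (x∉ ∷ u) = All.tabulate (λ y∈ → All.lookup x∉ (∈-resp-↭ (↭-sym σ) y∈)) ∷ unique-resp-↭ σ u
unique-resp-↭ (swap x y σ)  ((x≢y ∷ x∉) ∷ (y∉ ∷ u)) =
  ((λ y≡x → x≢y (sym y≡x)) ∷ All.tabulate (λ z∈ → All.lookup y∉ (∈-resp-↭ (↭-sym σ) z∈)))
  ∷ (All.tabulate (λ z∈ → All.lookup x∉ (∈-resp-↭ (↭-sym σ) z∈)) ∷ unique-resp-↭ σ u)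
unique-resp-↭ (Perm.trans σ τ)   u = unique-resp-↭ τ (unique-resp-↭ σ u)

unique-⊆-length : ∀ {A : Set} {xs ys : List A} → Unique xs → (∀ {x} → x ∈ xs → x ∈ ys) → length xs ℕ.≤ length ys
unique-⊆-length {xs = []} _ _ = z≤n
unique-⊆-length {xs = x ∷ xs} {ys} (x∉ ∷ u) sub with zs , σ ← extract (sub (here refl)) =
  subst (suc (length xs) ℕ.≤_) (sym (↭-length σ)) (s≤s (unique-⊆-length u λ y∈xs → rest y∈xs (∈-resp-↭ σ (sub (there y∈xs)))))
  where
  rest : ∀ {y} → y ∈ xs → y ∈ x ∷ zs → y ∈ zs
  rest y∈xs (here refl)  = contradiction refl (All.lookup x∉ y∈xs)
  rest y∈xs (there y∈zs) = y∈zs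

unique-map : ∀ {A B : Set} (φ : A → B) {xs} → (∀ {x y} → x ∈ xs → y ∈ xs → φ x ≡ φ y → x ≡ y) →
             Unique xs → Unique (map φ xs)
unique-map φ inj [] = []
unique-map φ {x ∷ xs} inj (x∉ ∷ u) = All.tabulate distinct ∷ unique-map φ (λ y∈ z∈ → inj (there y∈) (there z∈)) u
  where
  distinct : ∀ {b} → b ∈ map φ xs → φ x ≢ b
  distinct b∈ φx≡b with y , y∈xs , refl ← ∈-map⁻ φ b∈ =
    All.lookup x∉ y∈xs (inj (here refl) (there y∈xs) φx≡b)

length-remove : ∀ {A : Set} (_≟_ : ∀ (x y : A) → Dec (x ≡ y)) a {xs} → Unique xs →
                length xs ℕ.≤ suc (length (filter (λ x → ¬? (x ≟ a)) xs))
length-remove _≟_ a {xs} u = unique-⊆-length u split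
  where
  split : ∀ {x} → x ∈ xs → x ∈ a ∷ filter (λ x → ¬? (x ≟ a)) xs
  split {x} x∈xs with x ≟ a
  ... | yes x≡a = here x≡a
  ... | no  x≢a = there (∈-filter⁺ (λ x → ¬? (x ≟ a)) x∈xs x≢a)

length-filter-cons : ∀ {A : Set} {P : A → Set} (P? : Decidable P) x xs →
                     length (filter P? (x ∷ xs)) ≡ length (filter P? (x ∷ [])) ℕ.+ length (filter P? xs)
length-filter-cons P? x xs with P? x
... | yes _ = refl
... | no  _ = refl

length-filter-++ : ∀ {A : Set} {P : A → Set} (P? : Decidable P) xs ys →
                   length (filter P? (xs ++ ys)) ≡ length (filter P? xs) ℕ.+ length (filter P? ys)
length-filter-++ P? []       ys = refl
length-filter-++ P? (x ∷ xs) ys = begin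
  length (filter P? (x ∷ xs ++ ys))            ≡⟨ length-filter-cons P? x (xs ++ ys) ⟩
  p ℕ.+ length (filter P? (xs ++ ys))          ≡⟨ cong (p ℕ.+_) (length-filter-++ P? xs ys) ⟩
  p ℕ.+ (length (filter P? xs) ℕ.+ n)          ≡⟨ ℕₚ.+-assoc p _ n ⟨
  p ℕ.+ length (filter P? xs) ℕ.+ n            ≡⟨ cong (ℕ._+ n) (length-filter-cons P? x xs) ⟨
  length (filter P? (x ∷ xs)) ℕ.+ n            ∎
  where
  open ≡-Reasoning
  p = length (filter P? (x ∷ []))
  n = length (filter P? ys)

length-filter-map : ∀ {A B : Set} {P : B → Set} (P? : Decidable P) (φ : A → B) xs →
                    length (filter P? (map φ xs)) ≡ length (filter (λ x → P? (φ x)) xs)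
length-filter-map P? φ []       = refl
length-filter-map P? φ (x ∷ xs) with P? (φ x)
... | yes _ = cong suc (length-filter-map P? φ xs)
... | no  _ = length-filter-map P? φ xs

length-filter-↭ : ∀ {A : Set} {P : A → Set} (P? : Decidable P) {xs ys} → xs ↭ ys →
                  length (filter P? xs) ≡ length (filter P? ys)
length-filter-↭ P? Perm.refl = refl
length-filter-↭ P? (prep {xs} {ys} x σ) = trans (length-filter-cons P? x xs)
  (trans (cong (length (filter P? (x ∷ [])) ℕ.+_) (length-filter-↭ P? σ)) (sym (length-filter-cons P? x ys)))
length-filter-↭ P? (swap {xs} {ys} x y σ) = begin
  length (filter P? (x ∷ y ∷ xs))               ≡⟨ two x y xs ⟩
  p x ℕ.+ (p y ℕ.+ length (filter P? xs))       ≡⟨ cong (λ n → p x ℕ.+ (p y ℕ.+ n)) (length-filter-↭ P? σ) ⟩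
  p x ℕ.+ (p y ℕ.+ length (filter P? ys))       ≡⟨ x∙yz≈y∙xz (p x) (p y) _ ⟩
  p y ℕ.+ (p x ℕ.+ length (filter P? ys))       ≡⟨ two y x ys ⟨
  length (filter P? (y ∷ x ∷ ys))               ∎
  where
  open ≡-Reasoning
  p : _ → ℕ
  p x = length (filter P? (x ∷ []))
  two : ∀ x y xs → length (filter P? (x ∷ y ∷ xs)) ≡ p x ℕ.+ (p y ℕ.+ length (filter P? xs))
  two x y xs = trans (length-filter-cons P? x (y ∷ xs)) (cong (p x ℕ.+_) (length-filter-cons P? y xs))
length-filter-↭ P? (Perm.trans σ τ) = trans (length-filter-↭ P? σ) (length-filter-↭ P? τ)

-- The core of a dense bipartite graph.

module Bipartite {V W : Set} {E : V → W → Set} (E? : ∀ v w → Dec (E v w)) (T : ℕ) where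
  deg : V → List W → ℕ
  deg v ws = length (filter (E? v) ws)

  codeg : W → List V → ℕ
  codeg w vs = length (filter (λ v → E? v w) vs)

  edges : List V → List W → ℕ
  edges vs ws = sum (map (λ v → deg v ws) vs)

  edges-↭ˡ : ∀ {vs vs′} ws → vs ↭ vs′ → edges vs ws ≡ edges vs′ ws
  edges-↭ˡ ws Perm.refl         = refl
  edges-↭ˡ ws (prep v σ)   = cong (deg v ws ℕ.+_) (edges-↭ˡ ws σ)
  edges-↭ˡ ws (swap {xs} u v σ) = trans (x∙yz≈y∙xz (deg u ws) (deg v ws) (edges xs ws))
    (cong (λ n → deg v ws ℕ.+ (deg u ws ℕ.+ n)) (edges-↭ˡ ws σ))
  edges-↭ˡ ws (Perm.trans σ τ)  = trans (edges-↭ˡ ws σ) (edges-↭ˡ ws τ)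

  edges-↭ʳ : ∀ vs {ws ws′} → ws ↭ ws′ → edges vs ws ≡ edges vs ws′
  edges-↭ʳ []       σ = refl
  edges-↭ʳ (v ∷ vs) σ = cong₂ ℕ._+_ (length-filter-↭ (E? v) σ) (edges-↭ʳ vs σ)

  -- Edges are summed from the left side, so the loss caused by deleting a right vertex has to be
  -- double counted.
  edges-consʳ : ∀ vs w ws → edges vs (w ∷ ws) ≡ codeg w vs ℕ.+ edges vs ws
  edges-consʳ []       w ws = refl
  edges-consʳ (v ∷ vs) w ws = trans (cong (deg v (w ∷ ws) ℕ.+_) (edges-consʳ vs w ws)) step
    where
    step : deg v (w ∷ ws) ℕ.+ (codeg w vs ℕ.+ edges vs ws) ≡ codeg w (v ∷ vs) ℕ.+ (deg v ws ℕ.+ edges vs ws)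
    step with E? v w
    ... | yes _ = cong suc (x∙yz≈y∙xz (deg v ws) (codeg w vs) (edges vs ws))
    ... | no  _ = x∙yz≈y∙xz (deg v ws) (codeg w vs) (edges vs ws)

  record Core : Set where
    field
      vs       : List V
      ws       : List W
      vs-unique : Unique vs
      ws-unique : Unique ws
      member   : ∃ λ v → v ∈ vs
      deg>     : ∀ {v} → v ∈ vs → T ℕ.< deg v ws
      codeg>   : ∀ {w} → w ∈ ws → T ℕ.< codeg w vs

  private
    drop-step : ∀ n {e e′ δ} → δ ℕ.≤ T → e ≡ δ ℕ.+ e′ → T ℕ.* suc n ℕ.< e → T ℕ.* n ℕ.< e′
    drop-step n {e} {e′} {δ} δ≤T refl lt = ℕₚ.+-cancelˡ-< T _ _ (begin-strict
      T ℕ.+ T ℕ.* n   ≡⟨ ℕₚ.*-suc T n ⟨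
      T ℕ.* suc n     <⟨ lt ⟩
      δ ℕ.+ e′        ≤⟨ ℕₚ.+-monoˡ-≤ e′ δ≤T ⟩
      T ℕ.+ e′        ∎)
      where open ℕₚ.≤-Reasoning

    nonempty : ∀ vs ws → 0 ℕ.< edges vs ws → ∃ λ v → v ∈ vs
    nonempty (v ∷ vs) ws _ = v , here refl

    unique-tail : ∀ {A : Set} {x : A} {xs} → Unique (x ∷ xs) → Unique xs
    unique-tail (_ ∷ u) = u

  -- Deleting a vertex of degree at most T preserves edges > T · (number of vertices).
  core : ∀ n vs ws → length vs ℕ.+ length ws ≡ n → Unique vs → Unique ws → T ℕ.* n ℕ.< edges vs ws → Core
  core n vs ws eq uv uw lt with Any.any? (λ v → deg v ws ℕ.≤? T) vs
  core zero [] [] eq uv uw lt | yes ()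
  core (suc n) vs ws eq uv uw lt | yes low
    with v , v∈vs , deg≤T ← find low
    with vs′ , σ ← extract v∈vs
    = core n vs′ ws (ℕₚ.suc-injective (trans (cong (ℕ._+ length ws) (sym (↭-length σ))) eq))
        (unique-tail (unique-resp-↭ σ uv)) uw (drop-step n deg≤T (edges-↭ˡ ws σ) lt)
  core n vs ws eq uv uw lt | no high with Any.any? (λ w → codeg w vs ℕ.≤? T) ws
  core (suc n) vs ws eq uv uw lt | no _ | yes low
    with w , w∈ws , codeg≤T ← find low
    with ws′ , σ ← extract w∈ws
    = core n vs ws′ (ℕₚ.suc-injective (trans (sym (ℕₚ.+-suc (length vs) _))
          (trans (cong (length vs ℕ.+_) (sym (↭-length σ))) eq)))
        uv (unique-tail (unique-resp-↭ σ uw))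
        (drop-step n codeg≤T (trans (edges-↭ʳ vs σ) (edges-consʳ vs w ws′)) lt)
  core zero [] [] eq uv uw lt | no _ | yes ()
  core n vs ws eq uv uw lt | no high | no cohigh = record
    { vs = vs ; ws = ws ; vs-unique = uv ; ws-unique = uw
    -- The invariant is strict, so at least one edge remains and the deletions cannot exhaust the
    -- graph.
    ; member = nonempty vs ws (ℕₚ.≤-<-trans z≤n lt)
    ; deg>   = λ v∈vs → ℕₚ.≰⇒> (λ ≤T → high (lose v∈vs ≤T))
    ; codeg> = λ w∈ws → ℕₚ.≰⇒> (λ ≤T → cohigh (lose w∈ws ≤T)) }

-- Meant for the lines through the centre: once the centre is removed, their point lists are
-- pairwise disjoint.
disjoint-lists-length : ∀ {V W : Set} (l : W → List V) T {A : List V} ws → Unique ws →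
  (∀ {w} → w ∈ ws → Unique (l w) × T ℕ.≤ length (l w) × (∀ {v} → v ∈ l w → v ∈ A)) →
  (∀ {v w w′} → w ∈ ws → w′ ∈ ws → v ∈ l w → v ∈ l w′ → w ≡ w′) →
  length ws ℕ.* T ℕ.≤ length A
disjoint-lists-length l T {A} ws uw each disjoint =
  ℕₚ.≤-trans (long ws (λ w∈ → proj₁ (proj₂ (each w∈))))
    (unique-⊆-length (uniq ws uw (λ w∈ → proj₁ (each w∈)) disjoint) sub)
  where
  inside : ∀ {v} ws → v ∈ concatMap l ws → ∃ λ w → w ∈ ws × v ∈ l w
  inside (w ∷ ws) v∈ with ∈-++⁻ (l w) v∈
  ... | inj₁ v∈l = w , here refl , v∈l
  ... | inj₂ v∈r with w′ , w′∈ , v∈w′ ← inside ws v∈r = w′ , there w′∈ , v∈w′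
  sub : ∀ {v} → v ∈ concatMap l ws → v ∈ A
  sub v∈ with w , w∈ , v∈l ← inside ws v∈ = proj₂ (proj₂ (each w∈)) v∈l
  long : ∀ ws → (∀ {w} → w ∈ ws → T ℕ.≤ length (l w)) → length ws ℕ.* T ℕ.≤ length (concatMap l ws)
  long []       _ = z≤n
  long (w ∷ ws) h = ℕₚ.≤-trans (ℕₚ.+-mono-≤ (h (here refl)) (long ws (h ∘ there)))
    (ℕₚ.≤-reflexive (sym (length-++ (l w))))
  uniq : ∀ ws → Unique ws → (∀ {w} → w ∈ ws → Unique (l w)) →
         (∀ {v w w′} → w ∈ ws → w′ ∈ ws → v ∈ l w → v ∈ l w′ → w ≡ w′) → Unique (concatMap l ws)
  uniq []       _ _ _ = []
  uniq (w ∷ ws) (w∉ ∷ uw) h dis = Uniqueₚ.++⁺ (h (here refl))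
    (uniq ws uw (h ∘ there) (λ w∈ w′∈ → dis (there w∈) (there w′∈)))
    (λ { (v∈l , v∈r) → clash v∈l (inside ws v∈r) })
    where
    clash : ∀ {v} → v ∈ l w → ¬ (∃ λ w′ → w′ ∈ ws × v ∈ l w′)
    clash v∈l (w′ , w′∈ , v∈w′) = All.lookup w∉ w′∈ (dis (here refl) (there w′∈) v∈l v∈w′)

length-cartesianProduct : ∀ {A B : Set} (xs : List A) (ys : List B) →
                          length (cartesianProduct xs ys) ≡ length xs ℕ.* length ys
length-cartesianProduct []       ys = refl
length-cartesianProduct (x ∷ xs) ys = trans (length-++ (map (x ,_) ys))
  (cong₂ ℕ._+_ (length-map (x ,_) ys) (length-cartesianProduct xs ys))

concatMap-pairs : ∀ {A B : Set} (xs : List A) (ys : List B) →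
                  concatMap (λ x → map (λ y → (x , y)) ys) xs ≡ cartesianProduct xs ys
concatMap-pairs []       ys = refl
concatMap-pairs (x ∷ xs) ys = cong (map (x ,_) ys ++_) (concatMap-pairs xs ys)

length-filter-pairs : ∀ {A B : Set} {P : A × B → Set} (P? : Decidable P) (xs : List A) (ys : List B) (g : A → ℕ) →
                      (∀ x → length (filter (λ y → P? (x , y)) ys) ℕ.≤ g x) →
                      length (filter P? (concatMap (λ x → map (λ y → (x , y)) ys) xs)) ℕ.≤ sum (map g xs)
length-filter-pairs P? []       ys g bound = z≤n
length-filter-pairs P? (x ∷ xs) ys g bound = ℕₚ.≤-trans (ℕₚ.≤-reflexive (length-filter-++ P? (map (x ,_) ys) _))
  (ℕₚ.+-mono-≤ (ℕₚ.≤-trans (ℕₚ.≤-reflexive (length-filter-map P? (x ,_) ys)) (bound x))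
    (length-filter-pairs P? xs ys g bound))

sum-affine : ∀ {A : Set} (xs : List A) (g : A → ℕ) q →
             sum (map (λ x → q ℕ.+ q ℕ.* g x) xs) ≡ length xs ℕ.* q ℕ.+ q ℕ.* sum (map g xs)
sum-affine []       g q = sym (ℕₚ.*-zeroʳ q)
sum-affine (x ∷ xs) g q = begin
  (q ℕ.+ q ℕ.* g x) ℕ.+ sum (map (λ x → q ℕ.+ q ℕ.* g x) xs)
    ≡⟨ cong (q ℕ.+ q ℕ.* g x ℕ.+_) (sum-affine xs g q) ⟩
  (q ℕ.+ q ℕ.* g x) ℕ.+ (n ℕ.+ q ℕ.* s)
    ≡⟨ interchange q (q ℕ.* g x) n (q ℕ.* s) ⟩
  q ℕ.+ n ℕ.+ (q ℕ.* g x ℕ.+ q ℕ.* s)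
    ≡⟨ cong (q ℕ.+ n ℕ.+_) (ℕₚ.*-distribˡ-+ q (g x) s) ⟨
  q ℕ.+ n ℕ.+ q ℕ.* (g x ℕ.+ s) ∎
  where
  open ≡-Reasoning
  n = length xs ℕ.* q
  s = sum (map g xs)

-- Homogeneous linear systems.

module ListSum (𝔽 : FiniteField) where
  open Field 𝔽
  open Bivariate 𝔽 using (Σ-applyUpTo)

  ΣL : {A : Set} → List A → (A → F) → F
  ΣL []       g = 0#
  ΣL (i ∷ is) g = g i + ΣL is g

  ΣL-cong : ∀ {A : Set} (is : List A) {g h : A → F} → (∀ {i} → i ∈ is → g i ≡ h i) → ΣL is g ≡ ΣL is h
  ΣL-cong []       eq = refl
  ΣL-cong (i ∷ is) eq = cong₂ _+_ (eq (here refl)) (ΣL-cong is (eq ∘ there))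

  ΣL-zero : ∀ {A : Set} (is : List A) {g : A → F} → (∀ {i} → i ∈ is → g i ≡ 0#) → ΣL is g ≡ 0#
  ΣL-zero []       eq = refl
  ΣL-zero (i ∷ is) eq = trans (cong₂ _+_ (eq (here refl)) (ΣL-zero is (eq ∘ there))) (+-identityˡ _)

  ΣL-↭ : ∀ {A : Set} {is js : List A} (g : A → F) → is ↭ js → ΣL is g ≡ ΣL js g
  ΣL-↭ g Perm.refl        = refl
  ΣL-↭ g (prep i σ)       = cong (g i +_) (ΣL-↭ g σ)
  ΣL-↭ g (swap {is} {js} i j σ) = trans (cong (λ s → g i + (g j + s)) (ΣL-↭ g σ))
    (solve 3 (λ a b c → a :+ (b :+ c) := b :+ (a :+ c)) refl (g i) (g j) (ΣL js g))
  ΣL-↭ g (Perm.trans σ τ) = trans (ΣL-↭ g σ) (ΣL-↭ g τ)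

  ΣL-eliminate : ∀ {A : Set} (is : List A) (c g h : A → F) s → ΣL is (λ j → c j * (g j - h j * s))
                 ≡ ΣL is (λ j → c j * g j) - ΣL is (λ j → c j * h j) * s
  ΣL-eliminate []       c g h s = solve 1 (λ s → :0 := :0 :- :0 :* s) refl s
  ΣL-eliminate (i ∷ is) c g h s = trans (cong (c i * (g i - h i * s) +_) (ΣL-eliminate is c g h s))
    (solve 6 (λ c g h s u v → c :* (g :- h :* s) :+ (u :- v :* s) := c :* g :+ u :- (c :* h :+ v) :* s) refl
      (c i) (g i) (h i) s (ΣL is (λ j → c j * g j)) (ΣL is (λ j → c j * h j)))

  ΣL-++ : ∀ {A : Set} (xs ys : List A) (g : A → F) → ΣL (xs ++ ys) g ≡ ΣL xs g + ΣL ys g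
  ΣL-++ []       ys g = sym (+-identityˡ _)
  ΣL-++ (x ∷ xs) ys g = trans (cong (g x +_) (ΣL-++ xs ys g)) (sym (+-assoc _ _ _))

  ΣL-map : ∀ {A B : Set} (φ : A → B) xs (g : B → F) → ΣL (map φ xs) g ≡ ΣL xs (g ∘ φ)
  ΣL-map φ []       g = refl
  ΣL-map φ (x ∷ xs) g = cong (g (φ x) +_) (ΣL-map φ xs g)

  ΣL-product : ∀ {A B : Set} (xs : List A) (ys : List B) (g : A × B → F) →
               ΣL (cartesianProduct xs ys) g ≡ ΣL xs (λ x → ΣL ys (λ y → g (x , y)))
  ΣL-product []       ys g = refl
  ΣL-product (x ∷ xs) ys g = trans (ΣL-++ (map (x ,_) ys) _ g)
    (cong₂ _+_ (ΣL-map (x ,_) ys g) (ΣL-product xs ys g))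

  ΣL-upTo : ∀ n g → ΣL (upTo n) g ≡ Σ n g
  ΣL-upTo n g = Σ-applyUpTo (λ is → ΣL is g) g refl (λ _ _ → refl) n (λ i → i)

module LinearSystem (𝔽 : FiniteField) {I E : Set} (_≟ᴵ_ : DecidableEquality I) where
  open Field 𝔽
  open ListSum 𝔽

  -- The solution is a function on all of `I` supported on the unknowns, so that it can be read
  -- directly as the coefficient function of a polynomial.
  Solution : List I → List E → (I → E → F) → Set
  Solution is es g = ∃ λ (c : I → F) → (∃ λ (i : I) → c i ≢ 0#) × (∀ j → j ∉ is → c j ≡ 0#)
                           × (∀ {e} → e ∈ es → ΣL is (λ i → c i * g i e) ≡ 0#)

  private
    δ : I → I → F → F
    δ i j x with j ≟ᴵ i
    ... | yes _ = x
    ... | no  _ = 0#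

    δ-≡ : ∀ i x → δ i i x ≡ x
    δ-≡ i x with i ≟ᴵ i
    ... | yes _   = refl
    ... | no  i≢i = contradiction refl i≢i

    δ-≢ : ∀ {i j} x → j ≢ i → δ i j x ≡ 0#
    δ-≢ {i} {j} x j≢i with j ≟ᴵ i
    ... | yes j≡i = contradiction j≡i j≢i
    ... | no  _   = refl

    module Pivot (e : E) (es : List E) (g : I → E → F) (i : I) (is : List I) (i∉is : i ∉ is)
                 (nz : g i e ≢ 0#) where
      v = proj₁ (inverse (g i e) nz)

      -- Column elimination: a multiple of the pivot column `i` is subtracted from column `j` to
      -- clear its entry at `e`. A linear dependence among the new columns becomes one among the old
      -- columns once `i` receives the coefficient `β` of `extend`.
      g′ : I → E → F
      g′ j e′ = g j e′ - g j e * v * g i e′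

      g′-e : ∀ j → g′ j e ≡ 0#
      g′-e j = begin
        g j e - g j e * v * g i e     ≡⟨ solve 3 (λ a v b → a :- a :* v :* b := a :- a :* (b :* v)) refl (g j e) v (g i e) ⟩
        g j e - g j e * (g i e * v)   ≡⟨ cong (λ u → g j e - g j e * u) (proj₂ (inverse (g i e) nz)) ⟩
        g j e - g j e * 1#            ≡⟨ solve 1 (λ a → a :- a :* :1 := :0) refl (g j e) ⟩
        0#                            ∎
        where open ≡-Reasoning

      extend : Solution is es g′ → Solution (i ∷ is) (e ∷ es) g
      extend (c′ , (j₀ , c′j₀≢0) , supp′ , sols′) = c , (j₀ , nonzero) , supp , sols
        where
        open ≡-Reasoning
        β = - ΣL is (λ j → c′ j * (g j e * v))
        c : I → F
        c j = c′ j + δ i j β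
        c′i≡0 : c′ i ≡ 0#
        c′i≡0 = supp′ i i∉is
        c-≢ : ∀ {j} → j ≢ i → c j ≡ c′ j
        c-≢ {j} j≢i = trans (cong (c′ j +_) (δ-≢ β j≢i)) (+-identityʳ _)
        nonzero : c j₀ ≢ 0#
        nonzero c≡0 = c′j₀≢0 (trans (sym (c-≢ (λ { refl → c′j₀≢0 c′i≡0 }))) c≡0)
        supp : ∀ j → j ∉ i ∷ is → c j ≡ 0#
        supp j j∉ = trans (c-≢ (j∉ ∘ here)) (supp′ j (j∉ ∘ there))
        reduced : ∀ {e′} → e′ ∈ e ∷ es → ΣL is (λ j → c′ j * g′ j e′) ≡ 0#
        reduced (here refl) = ΣL-zero is λ {j} _ → trans (cong (c′ j *_) (g′-e j)) (zeroʳ _)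
        reduced (there e′∈) = sols′ e′∈
        sols : ∀ {e′} → e′ ∈ e ∷ es → ΣL (i ∷ is) (λ j → c j * g j e′) ≡ 0#
        sols {e′} e′∈ = begin
          c i * g i e′ + ΣL is (λ j → c j * g j e′)
            ≡⟨ cong₂ (λ u w → u * g i e′ + w) (trans (cong₂ _+_ c′i≡0 (δ-≡ i β)) (+-identityˡ β))
                 (ΣL-cong is λ {j} j∈ → cong (_* g j e′) (c-≢ λ { refl → i∉is j∈ })) ⟩
          β * g i e′ + ΣL is (λ j → c′ j * g j e′)
            ≡⟨ solve 3 (λ b x s → (:- b) :* x :+ s := s :- b :* x) refl
                 (ΣL is (λ j → c′ j * (g j e * v))) (g i e′) (ΣL is (λ j → c′ j * g j e′)) ⟩
          ΣL is (λ j → c′ j * g j e′) - ΣL is (λ j → c′ j * (g j e * v)) * g i e′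
            ≡⟨ ΣL-eliminate is c′ (λ j → g j e′) (λ j → g j e * v) (g i e′) ⟨
          ΣL is (λ j → c′ j * g′ j e′)
            ≡⟨ reduced e′∈ ⟩
          0# ∎

  solution-↭ : ∀ {is js es g} → is ↭ js → Solution js es g → Solution is es g
  solution-↭ σ (c , nz , supp , sols) = c , nz , (λ j j∉ → supp j (j∉ ∘ ∈-resp-↭ (↭-sym σ))) ,
    (λ e∈ → trans (ΣL-↭ _ σ) (sols e∈))

  -- A pivot uses up one equation and one unknown, which preserves the strict inequality; an
  -- equation without pivot holds for every choice of coefficients.
  solve-homogeneous : ∀ es is g → Unique is → length es ℕ.< length is → Solution is es g
  solve-homogeneous [] (i ∷ is) g _ _ = (λ j → δ i j 1#) , (i , λ eq → 0≢1 (trans (sym eq) (δ-≡ i 1#))) ,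
    (λ j j∉ → δ-≢ 1# (j∉ ∘ here)) , λ ()
  solve-homogeneous (e ∷ es) is g uniq lt = decide (Any.any? (λ i → ¬? (g i e ≟ 0#)) is)
    where
    eliminate : ∀ {i} → g i e ≢ 0# → ∀ {js} → is ↭ i ∷ js → Unique (i ∷ js) → Solution is (e ∷ es) g
    eliminate {i} nz {js} σ (i∉ ∷ u) = solution-↭ σ (Pivot.extend e es g i js (λ i∈ → All.lookup i∉ i∈ refl) nz
      (solve-homogeneous es js _ u (ℕ.s≤s⁻¹ (subst (suc (length es) ℕ.<_) (↭-length σ) lt))))
    decide : Dec (Any (λ i → g i e ≢ 0#) is) → Solution is (e ∷ es) g
    decide (yes pivot) = eliminate (proj₂ (proj₂ (find pivot))) (proj₂ ex) (unique-resp-↭ (proj₂ ex) uniq)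
      where ex = extract (proj₁ (proj₂ (find pivot)))
    decide (no none) = add-equation (solve-homogeneous es is g uniq (ℕₚ.<-trans ℕₚ.≤-refl lt))
      where
      add-equation : Solution is es g → Solution is (e ∷ es) g
      add-equation (c , nz , supp , sols) = c , nz , supp , λ
        { (here refl) → ΣL-zero is λ {i} i∈ → trans
            (cong (c i *_) (decidable-stable (g i e ≟ 0#) (λ ≢0 → none (lose i∈ ≢0)))) (zeroʳ _)
        ; (there e∈) → sols e∈ }

-- Interpolation of the graph of f.

module Interpolation (𝔽 : FiniteField) (f : Point 𝔽 → FiniteField.Carrier 𝔽) (sample : List (Point 𝔽)) where
  open Field 𝔽
  open Series 𝔽
  open Univariate 𝔽
  open Bivariate 𝔽
  open ListSum 𝔽
  open LinearSystem 𝔽 {ℕ × ℕ × ℕ} {Point 𝔽} (≡-dec ℕ._≟_ (≡-dec ℕ._≟_ ℕ._≟_))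

  module _ (s r d D B : ℕ) (fits : ∀ i j k → i ℕ.< s → j ℕ.< s → k ℕ.< r → i ℕ.+ (j ℕ.+ k ℕ.* d) ℕ.≤ D)
           (s≤B : s ℕ.≤ B) (r≤B : r ℕ.≤ B) (big : length sample ℕ.< s ℕ.* (s ℕ.* r)) where
    private
      -- A box of exponents inside the weighted simplex: its size is a plain product, at the price
      -- of a constant factor.
      monomials : List (ℕ × ℕ × ℕ)
      monomials = cartesianProduct (upTo s) (cartesianProduct (upTo s) (upTo r))

      value : ℕ × ℕ × ℕ → Point 𝔽 → F
      value (i , j , k) b = proj₁ b ^ i * (proj₂ b ^ j * f b ^ k)

      monomials-length : length monomials ≡ s ℕ.* (s ℕ.* r)
      monomials-length = trans (length-cartesianProduct (upTo s) _) (cong₂ ℕ._*_ (length-upTo s)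
        (trans (length-cartesianProduct (upTo s) (upTo r)) (cong₂ ℕ._*_ (length-upTo s) (length-upTo r))))

      monomials-unique : Unique monomials
      monomials-unique = Uniqueₚ.cartesianProduct⁺ (Uniqueₚ.upTo⁺ s)
        (Uniqueₚ.cartesianProduct⁺ (Uniqueₚ.upTo⁺ s) (Uniqueₚ.upTo⁺ r))

      ∈-monomials : ∀ {i j k} → (i , j , k) ∈ monomials → i ℕ.< s × j ℕ.< s × k ℕ.< r
      ∈-monomials m∈ = ∈-upTo⁻ (proj₁ split) , ∈-upTo⁻ (proj₁ split′) , ∈-upTo⁻ (proj₂ split′)
        where
        split = ∈-cartesianProduct⁻ (upTo s) (cartesianProduct (upTo s) (upTo r)) m∈
        split′ = ∈-cartesianProduct⁻ (upTo s) (upTo r) (proj₂ split)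

    Interpolant : Set
    Interpolant = ∃ λ (A : Coeff) → (∃ λ i → ∃ λ j → ∃ λ k → A i j k ≢ 0#) × Weighted d D A ×
                  (∀ {b} → b ∈ sample → eval³ B A (proj₁ b) (proj₂ b) (f b) ≡ 0#)

    interpolate : Interpolant
    interpolate = convert (solve-homogeneous sample monomials value monomials-unique
      (subst (length sample ℕ.<_) (sym monomials-length) big))
      where
      convert : Solution monomials sample value → Interpolant
      convert (c , ((i , j , k) , nz) , supp , sols) = A , (i , j , k , nz) , weighted , vanish
        where
        open ≡-Reasoning
        A : Coeff
        A i j k = c (i , j , k)
        outside : ∀ i j k → ¬ (i ℕ.< s × j ℕ.< s × k ℕ.< r) → A i j k ≡ 0#
        outside i j k out = supp (i , j , k) (out ∘ ∈-monomials)
        weighted : Weighted d D A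
        weighted i j k lt = outside i j k λ { (i<s , j<s , k<r) → ℕₚ.<⇒≱ lt (fits i j k i<s j<s k<r) }
        z* : ∀ {x} w → x ≡ 0# → x * w ≡ 0#
        z* w refl = zeroˡ w
        vanish : ∀ {b} → b ∈ sample → eval³ B A (proj₁ b) (proj₂ b) (f b) ≡ 0#
        vanish {b} b∈ = begin
          eval³ B A (proj₁ b) (proj₂ b) (f b)
            ≡⟨ Σ-extend _ s≤B (λ i s≤i → Σ-zero B λ j _ → Σ-zero B λ k _ →
                 z* _ (outside i j k λ { (i<s , _) → ℕₚ.<⇒≱ i<s s≤i })) ⟩
          Σ s (λ i → Σ B λ j → Σ B λ k → h i j k)
            ≡⟨ Σ-cong s (λ i → trans (Σ-extend _ s≤B λ j s≤j → Σ-zero B λ k _ →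
                 z* _ (outside i j k λ { (_ , j<s , _) → ℕₚ.<⇒≱ j<s s≤j }))
                 (Σ-cong s λ j → Σ-extend _ r≤B λ k r≤k → z* _ (outside i j k λ { (_ , _ , k<r) → ℕₚ.<⇒≱ k<r r≤k }))) ⟩
          Σ s (λ i → Σ s λ j → Σ r λ k → h i j k)
            ≡⟨ trans (ΣL-cong (upTo s) λ {i} _ → trans (ΣL-product (upTo s) (upTo r) (λ m → h i (proj₁ m) (proj₂ m)))
                 (trans (ΣL-cong (upTo s) λ {j} _ → ΣL-upTo r _) (ΣL-upTo s _))) (ΣL-upTo s _) ⟨
          ΣL (upTo s) (λ i → ΣL (cartesianProduct (upTo s) (upTo r)) (λ m → h i (proj₁ m) (proj₂ m)))
            ≡⟨ ΣL-product (upTo s) (cartesianProduct (upTo s) (upTo r)) (λ m → c m * value m b) ⟨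
          ΣL monomials (λ m → c m * value m b)
            ≡⟨ sols b∈ ⟩
          0# ∎
          where
          h : Coeff
          h i j k = c (i , j , k) * value (i , j , k) b

two-members : ∀ {A : Set} {xs : List A} → Unique xs → 1 ℕ.< length xs → ∃ λ x → ∃ λ y → x ∈ xs × y ∈ xs × x ≢ y
two-members {xs = x ∷ []}     _ (s≤s ())
two-members {xs = x ∷ y ∷ xs} ((x≢y ∷ _) ∷ _) _ = x , y , here refl , there (here refl) , x≢y

-- Enumeration of the field and of the plane.

module Enumeration (𝔽 : FiniteField) where
  open Field 𝔽

  ∈-elems : ∀ x → x ∈ elems 𝔽
  ∈-elems x = subst (_∈ elems 𝔽) (Inverse.strictlyInverseˡ enum x) (∈-map⁺ (Inverse.to enum) (∈-allFin _))

  elems-unique : Unique (elems 𝔽)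
  elems-unique = Uniqueₚ.map⁺ (λ eq → trans (sym (Inverse.strictlyInverseʳ enum _))
    (trans (cong (Inverse.from enum) eq) (Inverse.strictlyInverseʳ enum _))) (Uniqueₚ.allFin⁺ q)

  length-elems : length (elems 𝔽) ≡ q
  length-elems = trans (length-map (Inverse.to enum) (allFin q)) (length-tabulate (λ i → i))

  points≡product : points 𝔽 ≡ cartesianProduct (elems 𝔽) (elems 𝔽)
  points≡product = concatMap-pairs (elems 𝔽) (elems 𝔽)

  ∈-points : ∀ b → b ∈ points 𝔽
  ∈-points (x , y) = subst ((x , y) ∈_) (sym points≡product) (∈-cartesianProduct⁺ (∈-elems x) (∈-elems y))

  points-unique : Unique (points 𝔽)
  points-unique = subst Unique (sym points≡product) (Uniqueₚ.cartesianProduct⁺ elems-unique elems-unique)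

  length-points : length (points 𝔽) ≡ q ℕ.* q
  length-points = trans (cong length points≡product)
    (trans (length-cartesianProduct (elems 𝔽) (elems 𝔽)) (cong₂ ℕ._*_ length-elems length-elems))

-- The incidence graph of the test and the agreement count.

module LowDegreeTest (𝔽 : FiniteField) (d : ℕ) (0<d : 0 ℕ.< d)
                     (f : Point 𝔽 → FiniteField.Carrier 𝔽)
                     (P : Point 𝔽 → Point 𝔽 → Point 𝔽 → FiniteField.Carrier 𝔽)
                     (bestFit : BestFit 𝔽 d f P) where
  open Field 𝔽
  open Enumeration 𝔽
  open BestFit bestFit

  -- (m , c) stands for the line y = c + x m.
  Line : Set
  Line = F × F

  line : Line → F → Point 𝔽
  line (m , c) = linePt 𝔽 (0# , c) (1# , m)

  On : Point 𝔽 → Line → Set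
  On (x , y) (m , c) = y ≡ c + x * m

  -- Every non-vertical line enters through one normal form, base point (0 , c) and direction (1 ,
  -- m), and is thus counted once. `P-line` transfers the condition to any other base point and
  -- direction.
  E : Point 𝔽 → Line → Set
  E b ℓ@(m , c) = On b ℓ × f b ≡ P (0# , c) (1# , m) b

  E? : ∀ b ℓ → Dec (E b ℓ)
  E? b (m , c) = (proj₂ b ≟ (c + proj₁ b * m)) ×-dec (f b ≟ P (0# , c) (1# , m) b)

  private
    direction≢0 : ∀ {m} → (1# , m) ≢ origin 𝔽
    direction≢0 eq = 0≢1 (sym (cong proj₁ eq))

  line-at : ∀ {b} ℓ → On b ℓ → line ℓ (proj₁ b) ≡ b
  line-at {x , y} (m , c) on = cong₂ _,_ (solve 1 (λ x → :0 :+ x :* :1 := x) refl x) (sym on)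

  through : ∀ {a b} ℓ → On a ℓ → On b ℓ → linePt 𝔽 a (1# , proj₁ ℓ) (proj₁ b - proj₁ a) ≡ b
  through {x , y} {x′ , y′} (m , c) refl refl = cong₂ _,_
    (solve 2 (λ x x′ → x :+ (x′ :- x) :* :1 := x′) refl x x′)
    (solve 4 (λ c x x′ m → c :+ x :* m :+ (x′ :- x) :* m := c :+ x′ :* m) refl c x x′ m)

  P-line : ∀ {a b} ℓ r u → On a ℓ → On b ℓ → r ≢ 0# → u ≡ _·_ 𝔽 r (1# , proj₁ ℓ) →
           P (0# , proj₂ ℓ) (1# , proj₁ ℓ) b ≡ P a u b
  P-line {a} {b} ℓ@(m , c) r u onA onB r≢0 u-eq =
    subst (λ p → P (0# , c) (1# , m) p ≡ P a u p) (line-at ℓ onB)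
      (wellDefined (0# , c) (1# , m) a u direction≢0
        ((proj₁ a , sym (line-at ℓ onA)) , (r , r≢0 , u-eq)) (proj₁ b))

  P-base : ∀ {a b} ℓ → On a ℓ → On b ℓ → P (0# , proj₂ ℓ) (1# , proj₁ ℓ) b ≡ P a (1# , proj₁ ℓ) b
  P-base (m , c) onA onB = P-line (m , c) 1# (1# , m) onA onB (λ eq → 0≢1 (sym eq))
    (sym (cong₂ _,_ (*-identityˡ 1#) (*-identityˡ m)))

  On-injective : ∀ {a b ℓ ℓ′} → On a ℓ → On b ℓ → On a ℓ′ → On b ℓ′ → b ≢ a → ℓ ≡ ℓ′
  On-injective {x , y} {x′ , y′} {m , c} {m′ , c′} aℓ bℓ aℓ′ bℓ′ b≢a = cong₂ _,_ m≡m′ c≡c′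
    where
    open ≡-Reasoning
    x≢x′ : x - x′ ≢ 0#
    -- On a non-vertical line the abscissa determines the point.
    x≢x′ eq with refl ← x-y≡0⇒x≡y eq = b≢a (cong (x ,_) (trans bℓ (sym aℓ)))
    m≡m′ : m ≡ m′
    m≡m′ = x-y≡0⇒x≡y (*≢0 x≢x′ (begin
      (x - x′) * (m - m′)
        ≡⟨ solve 6 (λ x x′ m m′ c c′ → (x :- x′) :* (m :- m′)
             := (c :+ x :* m :- (c :+ x′ :* m)) :- (c′ :+ x :* m′ :- (c′ :+ x′ :* m′))) refl x x′ m m′ c c′ ⟩
      (c + x * m - (c + x′ * m)) - (c′ + x * m′ - (c′ + x′ * m′))
        ≡⟨ cong₂ _-_ (cong₂ _-_ (sym aℓ) (sym bℓ)) (cong₂ _-_ (sym aℓ′) (sym bℓ′)) ⟩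
      (y - y′) - (y - y′)
        ≡⟨ -‿inverseʳ _ ⟩
      0# ∎))
    c≡c′ : c ≡ c′
    c≡c′ = begin
      c                         ≡⟨ solve 3 (λ c x m → c := c :+ x :* m :- x :* m) refl c x m ⟩
      c + x * m - x * m         ≡⟨ cong₂ _-_ (trans (sym aℓ) aℓ′) (cong (x *_) m≡m′) ⟩
      c′ + x * m′ - x * m′      ≡⟨ solve 3 (λ c x m → c :+ x :* m :- x :* m := c) refl c′ x m′ ⟩
      c′                        ∎

  same-slope : ∀ {a m c c′} → On a (m , c) → On a (m , c′) → c ≡ c′
  same-slope {x , y} {m} {c} {c′} on on′ = begin
    c                         ≡⟨ solve 3 (λ c x m → c := c :+ x :* m :- x :* m) refl c x m ⟩
    c + x * m - x * m         ≡⟨ cong (_- x * m) (trans (sym on) on′) ⟩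
    c′ + x * m - x * m        ≡⟨ solve 3 (λ c x m → c :+ x :* m :- x :* m := c) refl c′ x m ⟩
    c′                        ∎
    where open ≡-Reasoning

  Accepts : Point 𝔽 × Point 𝔽 → Set
  Accepts (a , u) = u ≢ origin 𝔽 × P a u a ≡ f a

  accepts? : ∀ au → Dec (Accepts au)
  accepts? au = ¬? (_≟P_ 𝔽 (proj₂ au) (origin 𝔽)) ×-dec (P (proj₁ au) (proj₂ au) (proj₁ au) ≟ f (proj₁ au))

  module _ (T : ℕ) where
    open Bipartite {Point 𝔽} {Line} {E} E? T

    private
      module Directions (a : Point 𝔽) where
        x = proj₁ a
        y = proj₂ a

        -- A non-vertical direction is recorded as its first coordinate and the line it spans at
        -- `a`, so a good line accounts for at most q accepted directions. Vertical directions are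
        -- recorded whether or not the test accepts them. The decision is an argument so that proofs
        -- can split on it directly.
        encode′ : ∀ u₁ → F → Dec (u₁ ≡ 0#) → F ⊎ (F × Line)
        encode′ u₁ u₂ (yes _)   = inj₁ u₂
        encode′ u₁ u₂ (no u₁≢0) = inj₂ (u₁ , u₂ * i , y - x * (u₂ * i))
          where i = proj₁ (inverse u₁ u₁≢0)

        encode : Point 𝔽 → F ⊎ (F × Line)
        encode (u₁ , u₂) = encode′ u₁ u₂ (u₁ ≟ 0#)

        recover : ∀ u₁ (u₁≢0 : u₁ ≢ 0#) u₂ → u₁ * (u₂ * proj₁ (inverse u₁ u₁≢0)) ≡ u₂
        recover u₁ u₁≢0 u₂ = trans
          (solve 3 (λ u i v → u :* (v :* i) := v :* (u :* i)) refl u₁ (proj₁ (inverse u₁ u₁≢0)) u₂)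
          (trans (cong (u₂ *_) (proj₂ (inverse u₁ u₁≢0))) (*-identityʳ u₂))

        encode′-injective : ∀ u₁ u₂ v₁ v₂ (du : Dec (u₁ ≡ 0#)) (dv : Dec (v₁ ≡ 0#)) →
                            encode′ u₁ u₂ du ≡ encode′ v₁ v₂ dv → (u₁ , u₂) ≡ (v₁ , v₂)
        encode′-injective u₁ u₂ v₁ v₂ (yes u0) (yes v0) eq = cong₂ _,_ (trans u0 (sym v0)) (inj₁-injective eq)
        encode′-injective u₁ u₂ v₁ v₂ (no u≢0) (no v≢0) eq = cong₂ _,_ first
          (trans (sym (recover u₁ u≢0 u₂)) (trans (cong₂ _*_ first (cong (proj₁ ∘ proj₂) eq′)) (recover v₁ v≢0 v₂)))
          where
          eq′ = inj₂-injective eq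
          first = cong proj₁ eq′

        target : List (F ⊎ (F × Line))
        target = map inj₁ (elems 𝔽) ++ map inj₂ (cartesianProduct (elems 𝔽) (filter (E? a) (points 𝔽)))

        accepted : List (Point 𝔽)
        accepted = filter (λ u → accepts? (a , u)) (points 𝔽)

        encode′-target : ∀ u₁ u₂ (du : Dec (u₁ ≡ 0#)) → P a (u₁ , u₂) a ≡ f a → encode′ u₁ u₂ du ∈ target
        encode′-target u₁ u₂ (yes _)   acc = ∈-++⁺ˡ (∈-map⁺ inj₁ (∈-elems u₂))
        encode′-target u₁ u₂ (no u₁≢0) acc = ∈-++⁺ʳ (map inj₁ (elems 𝔽)) (∈-map⁺ inj₂
          (∈-cartesianProduct⁺ (∈-elems u₁) (∈-filter⁺ (E? a) (∈-points ℓ) (on ,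
            trans (sym acc) (sym (P-line ℓ u₁ (u₁ , u₂) on on u₁≢0
              (cong₂ _,_ (sym (*-identityʳ u₁)) (sym (recover u₁ u₁≢0 u₂)))))))))
          where
          m = u₂ * proj₁ (inverse u₁ u₁≢0)
          ℓ : Line
          ℓ = m , y - x * m
          on : On a ℓ
          on = solve 3 (λ x y m → y := y :- x :* m :+ x :* m) refl x y m

        bound : length accepted ℕ.≤ q ℕ.+ q ℕ.* deg a (points 𝔽)
        bound = subst₂ ℕ._≤_ (length-map encode accepted) target-length
          (unique-⊆-length
            (unique-map encode {accepted} (λ _ _ eq → encode′-injective _ _ _ _ (_ ≟ 0#) (_ ≟ 0#) eq)
              (Uniqueₚ.filter⁺ (λ u → accepts? (a , u)) points-unique))
            inside)
          where
          target-length : length target ≡ q ℕ.+ q ℕ.* deg a (points 𝔽)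
          target-length = trans (length-++ (map inj₁ (elems 𝔽))) (cong₂ ℕ._+_
            (trans (length-map inj₁ (elems 𝔽)) length-elems)
            (trans (length-map inj₂ (cartesianProduct (elems 𝔽) (filter (E? a) (points 𝔽))))
              (trans (length-cartesianProduct (elems 𝔽) _) (cong (ℕ._* deg a (points 𝔽)) length-elems))))
          inside : ∀ {e} → e ∈ map encode accepted → e ∈ target
          inside e∈ with ∈-map⁻ encode e∈
          ... | (u₁ , u₂) , u∈ , refl = encode′-target u₁ u₂ (u₁ ≟ 0#)
                (proj₂ (proj₂ (∈-filter⁻ (λ u → accepts? (a , u)) {xs = points 𝔽} u∈)))

    -- The cubic term pays for the vertical directions, q at each of the q² points.
    ldt-bound : ldtAccepting 𝔽 f P ℕ.≤ q ℕ.* q ℕ.* q ℕ.+ q ℕ.* edges (points 𝔽) (points 𝔽)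
    ldt-bound = ℕₚ.≤-trans
      (length-filter-pairs accepts? (points 𝔽) (points 𝔽) (λ a → q ℕ.+ q ℕ.* deg a (points 𝔽)) Directions.bound)
      (ℕₚ.≤-reflexive (trans (sum-affine (points 𝔽) (λ a → deg a (points 𝔽)) q)
        (cong (λ n → n ℕ.* q ℕ.+ q ℕ.* edges (points 𝔽) (points 𝔽)) length-points)))

    module Agreement (1≤T : 1 ℕ.≤ T) (B : ℕ) (T<B : T ℕ.< B) (C : Core) where
      open Core C renaming (vs to S; ws to L)
      open Series 𝔽
      open Univariate 𝔽
      open Bivariate 𝔽
      open Descent 𝔽 d T B 0<d T<B f S

      onLine : Line → List (Point 𝔽)
      onLine ℓ = filter (λ b → E? b ℓ) S

      ∈-onLine : ∀ {b} ℓ → b ∈ onLine ℓ → b ∈ S × E b ℓ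
      ∈-onLine ℓ = ∈-filter⁻ (λ b → E? b ℓ) {xs = S}

      rep-start : ∀ {n U g} → Rep n U g → U 0 ≡ g 0#
      rep-start (rep []      _ c v) = trans (sym (c 0)) (v 0#)
      rep-start (rep (a ∷ p) _ c v) = trans (sym (c 0)) (trans
        (solve 2 (λ a e → a := a :+ :0 :* e) refl a (eval p 0#)) (v 0#))

      -- The line is reparametrised from `a`: the parameter of a point is the difference of
      -- abscissas, so `a` itself sits at 0, where the constant coefficient is read off.
      ray : ∀ {a} ℓ → ℓ ∈ L → E a ℓ → Ray a (proj₁ ℓ)
      ray {a} ℓ@(m , c) ℓ∈L (onA , fA) = record
        { coefficients = coeff (tabulate (proj₁ (isPoly a (1# , m) direction≢0)))
        ; value        = val
        ; polynomial   = poly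
        ; start        = trans (rep-start poly) val-0
        ; ts           = map param (onLine ℓ)
        ; unique       = unique-map param {onLine ℓ} (λ b∈ b′∈ eq → param-injective (proj₁ (proj₂ (∈-onLine ℓ b∈)))
                           (proj₁ (proj₂ (∈-onLine ℓ b′∈))) eq) (Uniqueₚ.filter⁺ (λ b → E? b ℓ) vs-unique)
        ; many         = subst (T ℕ.<_) (sym (length-map param (onLine ℓ))) (codeg> ℓ∈L)
        ; agree        = Allₚ.map⁺ (All.tabulate (λ b∈ → agrees (∈-onLine ℓ b∈)))
        }
        where
        val : F → F
        val t = P a (1# , m) (linePt 𝔽 a (1# , m) t)
        param : Point 𝔽 → F
        param b = proj₁ b - proj₁ a
        poly : Rep d (coeff (tabulate (proj₁ (isPoly a (1# , m) direction≢0)))) val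
        poly = rep-resp (λ _ → refl) (λ t → sym (proj₂ (isPoly a (1# , m) direction≢0) t)) (rep-evalUni d _)
        val-0 : val 0# ≡ f a
        val-0 = trans (cong (P a (1# , m)) (cong₂ _,_
            (solve 1 (λ x → x :+ :0 :* :1 := x) refl (proj₁ a))
            (solve 2 (λ y m → y :+ :0 :* m := y) refl (proj₂ a) m)))
          (trans (sym (P-base ℓ onA onA)) (sym fA))
        param-injective : ∀ {b b′} → On b ℓ → On b′ ℓ → param b ≡ param b′ → b ≡ b′
        param-injective onB onB′ eq = trans (sym (through ℓ onA onB))
          (trans (cong (linePt 𝔽 a (1# , m)) eq) (through ℓ onA onB′))
        agrees : ∀ {b} → b ∈ S × E b ℓ →
                 linePt 𝔽 a (1# , m) (param b) ∈ S × f (linePt 𝔽 a (1# , m) (param b)) ≡ val (param b)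
        agrees {b} (b∈S , onB , fB) = subst (λ p → p ∈ S × f p ≡ P a (1# , m) p) (sym (through ℓ onA onB))
          (b∈S , trans fB (P-base ℓ onA onB))

      linesAt : Point 𝔽 → List Line
      linesAt a = filter (E? a) L

      ∈-linesAt : ∀ {a ℓ} → ℓ ∈ linesAt a → ℓ ∈ L × E a ℓ
      ∈-linesAt {a} = ∈-filter⁻ (E? a) {xs = L}

      linesAt-unique : ∀ a → Unique (linesAt a)
      linesAt-unique a = Uniqueₚ.filter⁺ (E? a) ws-unique

      -- A degree above T ≥ 1 gives two lines, and distinct non-vertical lines through one point
      -- have distinct slopes.
      twoRays : ∀ {a} → a ∈ S → TwoRays a
      twoRays {a} a∈S = convert (two-members (linesAt-unique a) (ℕₚ.≤-<-trans 1≤T (deg> a∈S)))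
        where
        convert : (∃ λ ℓ → ∃ λ ℓ′ → ℓ ∈ linesAt a × ℓ′ ∈ linesAt a × ℓ ≢ ℓ′) → TwoRays a
        convert ((m , c) , (m′ , c′) , ℓ∈ , ℓ′∈ , ℓ≢ℓ′) = m , m′ , m≢m′ , atLine ℓ∈ , atLine ℓ′∈
          where
          atLine : ∀ {ℓ} → ℓ ∈ linesAt a → Ray a (proj₁ ℓ)
          atLine {ℓ} ℓ∈ = ray ℓ (proj₁ (∈-linesAt ℓ∈)) (proj₂ (∈-linesAt ℓ∈))
          m≢m′ : m ≢ m′
          m≢m′ refl = ℓ≢ℓ′ (cong (m ,_) (same-slope {a} (proj₁ (proj₂ (∈-linesAt ℓ∈))) (proj₁ (proj₂ (∈-linesAt ℓ′∈)))))

      agreement : Separable → ∃ λ Q → T ℕ.* T ℕ.≤ agreeCount 𝔽 d f Q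
      agreement sep = count-agreements (Newton.global 𝔽 d T B 0<d T<B f S sep)
        where
        open Separable sep using (centre; centre∈S)
        count-agreements : (∃ λ Q → ∀ {m} (r : Ray centre m) t →
                             evalBi 𝔽 d Q (linePt 𝔽 centre (1# , m) t) ≡ Ray.value r t) →
                           ∃ λ Q → T ℕ.* T ℕ.≤ agreeCount 𝔽 d f Q
        count-agreements (Q , Q-eq) = Q , ℕₚ.≤-trans (ℕₚ.*-monoˡ-≤ T (ℕₚ.<⇒≤ (deg> centre∈S)))
          (disjoint-lists-length others T (linesAt centre) (linesAt-unique centre) each disjoint)
          where
          others : Line → List (Point 𝔽)
          others ℓ = filter (λ b → ¬? (_≟P_ 𝔽 b centre)) (onLine ℓ)
          ∈-others : ∀ {b} ℓ → b ∈ others ℓ → (b ∈ S × E b ℓ) × b ≢ centre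
          ∈-others ℓ b∈ = ∈-onLine ℓ (proj₁ split) , proj₂ split
            where split = ∈-filter⁻ (λ b → ¬? (_≟P_ 𝔽 b centre)) {xs = onLine ℓ} b∈
          onLine-unique : ∀ ℓ → Unique (onLine ℓ)
          onLine-unique ℓ = Uniqueₚ.filter⁺ (λ b → E? b ℓ) vs-unique
          agrees : ∀ {ℓ b} → ℓ ∈ L → E centre ℓ → E b ℓ → f b ≡ evalBi 𝔽 d Q b
          agrees {ℓ} {b} ℓ∈L cℓ@(onC , _) (onB , fB) = trans fB (trans (P-base ℓ onC onB)
            (subst (λ p → P centre (1# , proj₁ ℓ) p ≡ evalBi 𝔽 d Q p) (through ℓ onC onB)
              (sym (Q-eq (ray ℓ ℓ∈L cℓ) (proj₁ b - proj₁ centre)))))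
          each : ∀ {ℓ} → ℓ ∈ linesAt centre → Unique (others ℓ) × T ℕ.≤ length (others ℓ) ×
                 (∀ {b} → b ∈ others ℓ → b ∈ filter (λ a → f a ≟ evalBi 𝔽 d Q a) (points 𝔽))
          each {ℓ} ℓ∈ = Uniqueₚ.filter⁺ (λ b → ¬? (_≟P_ 𝔽 b centre)) (onLine-unique ℓ) ,
            -- More than `T` points on the line leave at least `T` after removal of the centre.
            ℕ.s≤s⁻¹ (ℕₚ.≤-trans (codeg> (proj₁ (∈-linesAt ℓ∈))) (length-remove (_≟P_ 𝔽) centre (onLine-unique ℓ))) ,
            λ {b} b∈ → ∈-filter⁺ (λ a → f a ≟ evalBi 𝔽 d Q a) (∈-points b)
              (agrees (proj₁ (∈-linesAt ℓ∈)) (proj₂ (∈-linesAt ℓ∈)) (proj₂ (proj₁ (∈-others ℓ b∈))))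
          disjoint : ∀ {b ℓ ℓ′} → ℓ ∈ linesAt centre → ℓ′ ∈ linesAt centre → b ∈ others ℓ → b ∈ others ℓ′ → ℓ ≡ ℓ′
          disjoint {b} {ℓ} {ℓ′} ℓ∈ ℓ′∈ b∈ b∈′ = On-injective
            (proj₁ (proj₂ (∈-linesAt ℓ∈))) (proj₁ (proj₂ (proj₁ (∈-others ℓ b∈))))
            (proj₁ (proj₂ (∈-linesAt ℓ′∈))) (proj₁ (proj₂ (proj₁ (∈-others ℓ′ b∈′))))
            (proj₂ (∈-others ℓ b∈))

    many-agreements : 1 ℕ.≤ T → ∀ s r → (∀ i j k → i ℕ.< s → j ℕ.< s → k ℕ.< r → i ℕ.+ (j ℕ.+ k ℕ.* d) ℕ.≤ T) →
                      q ℕ.* q ℕ.< s ℕ.* (s ℕ.* r) →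
                      T ℕ.* (q ℕ.* q ℕ.+ q ℕ.* q) ℕ.< edges (points 𝔽) (points 𝔽) →
                      ∃ λ Q → T ℕ.* T ℕ.≤ agreeCount 𝔽 d f Q
    many-agreements 1≤T s r fits big dense = finish
      (Interpolation.interpolate 𝔽 f (points 𝔽) s r d T B fits s≤B r≤B
        (subst (ℕ._< s ℕ.* (s ℕ.* r)) (sym length-points) big))
      where
      open Series 𝔽
      open Univariate 𝔽
      -- A common bound for the weighted degree and for both ranges of exponents.
      B = suc T ℕ.+ (s ℕ.+ r)
      T<B : T ℕ.< B
      T<B = ℕₚ.m≤m+n (suc T) (s ℕ.+ r)
      s≤B : s ℕ.≤ B
      s≤B = ℕₚ.≤-trans (ℕₚ.m≤m+n s r) (ℕₚ.m≤n+m (s ℕ.+ r) (suc T))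
      r≤B : r ℕ.≤ B
      r≤B = ℕₚ.≤-trans (ℕₚ.m≤n+m r s) (ℕₚ.m≤n+m (s ℕ.+ r) (suc T))
      C : Core
      C = core (q ℕ.* q ℕ.+ q ℕ.* q) (points 𝔽) (points 𝔽) (cong₂ ℕ._+_ length-points length-points)
        points-unique points-unique dense
      open Agreement 1≤T B T<B C
      open Descent 𝔽 d T B 0<d T<B f (Core.vs C)
      -- As d ≥ 1, the weight dominates the total degree, so `T` also bounds the number of descent
      -- steps.
      weighted⇒total : ∀ {A} → Weighted d T A → Total T A
      weighted⇒total wt i j k lt = wt i j k (ℕₚ.≤-trans lt (ℕₚ.+-monoʳ-≤ i (ℕₚ.+-monoʳ-≤ j (ℕₚ.m≤m*n k d))))
        where instance _ = ℕ.>-nonZero 0<d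
      finish : (∃ λ (A : Coeff) → Nonzero A × Weighted d T A ×
                (∀ {b} → b ∈ points 𝔽 → eval³ B A (proj₁ b) (proj₂ b) (f b) ≡ 0#)) →
               ∃ λ Q → T ℕ.* T ℕ.≤ agreeCount 𝔽 d f Q
      finish (A , nz , wt , vanish) = agreement (separable (proj₂ (Core.member C)) twoRays T A
        (weighted⇒total wt) wt nz (λ {b} _ → vanish (∈-points b)))

-- Choice of the numerical parameters, with ε = n/m.

module Arithmetic where
  open import Data.Nat using (_≤_; _<_; _+_; _*_; _^_)
  open +-*-Solver using (solve; _:+_; _:*_; _:=_; con; Polynomial)

  infixr 9 _:↑_
  _:↑_ : ∀ {n} → Polynomial n → ℕ → Polynomial n
  x :↑ zero  = con 1
  x :↑ suc k = x :* (x :↑ k)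

  n<[1+n/k]*k : ∀ n k .{{_ : NonZero k}} → n < suc (n / k) * k
  n<[1+n/k]*k n k = subst (_< suc (n / k) * k) (sym (m≡m%n+[m/n]*n n k)) (ℕₚ.+-monoˡ-< (n / k * k) (m%n<n n k))

  module Parameters (n m q d : ℕ) (0<n : 0 < n) (0<m : 0 < m) (1<q : 1 < q) (0<d : 0 < d)
                    -- `K` is a variable known through an equation, so that the solver treats it as
                    -- an atom.
                    (K : ℕ) (K-eq : K ≡ 4096 * 32)
                    (large : 16 * K * d * m ^ 7 < q * n ^ 7) (ldt N : ℕ)
                    (passes : n * (q * q * (q * q ∸ 1)) ≤ m * ldt)
                    (ldt≤ : ldt ≤ q * q * q + q * N) (ldt≤q⁴ : ldt ≤ q * q * (q * q)) where
    open ℕₚ.≤-Reasoning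

    private
      instance
        _ = ℕ.>-nonZero 0<n
        _ = ℕ.>-nonZero 0<m
        _ = ℕ.>-nonZero 0<d
        q≢0 : NonZero q
        q≢0 = ℕ.>-nonZero (ℕₚ.<-trans (s≤s z≤n) 1<q)
        8m≢0 : NonZero (8 * m)
        8m≢0 = ℕₚ.m*n≢0 8 m
        2d≢0 : NonZero (2 * d)
        2d≢0 = ℕₚ.m*n≢0 2 d

      Q = q * q
      w = Q ∸ 1

      instance
        Q≢0 : NonZero Q
        Q≢0 = ℕₚ.m*n≢0 q q

      4≤Q : 4 ≤ Q
      4≤Q = ℕₚ.*-mono-≤ 1<q 1<q

      Q≡1+w : Q ≡ suc w
      Q≡1+w = sym (ℕₚ.m+[n∸m]≡n (ℕₚ.≤-trans (s≤s z≤n) 4≤Q))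

      1≤w : 1 ≤ w
      1≤w = ℕ.s≤s⁻¹ (subst (2 ≤_) Q≡1+w (ℕₚ.≤-trans (s≤s (s≤s z≤n)) 4≤Q))

      instance
        w≢0 : NonZero w
        w≢0 = ℕ.>-nonZero 1≤w

      Q≤2w : Q ≤ 2 * w
      Q≤2w = begin
        Q          ≡⟨ Q≡1+w ⟩
        1 + w      ≤⟨ ℕₚ.+-monoˡ-≤ w 1≤w ⟩
        w + w      ≡⟨ cong (w +_) (ℕₚ.+-identityʳ w) ⟨
        2 * w      ∎

    -- That is, ε ≤ 2: at most q⁴ pairs are accepted, and the normalising q²(q² - 1) is at least
    -- q⁴/2. This bound is what trades one power of ε for another below.
    n≤2m : n ≤ 2 * m
    n≤2m = ℕₚ.*-cancelʳ-≤ n (2 * m) w (ℕₚ.*-cancelʳ-≤ (n * w) (2 * m * w) Q (begin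
      n * w * Q          ≡⟨ solve 3 (λ n w Q → n :* w :* Q := n :* (Q :* w)) refl n w Q ⟩
      n * (Q * w)        ≤⟨ passes ⟩
      m * ldt            ≤⟨ ℕₚ.*-monoʳ-≤ m ldt≤q⁴ ⟩
      m * (Q * Q)        ≤⟨ ℕₚ.*-monoʳ-≤ m (ℕₚ.*-monoʳ-≤ Q Q≤2w) ⟩
      m * (Q * (2 * w))  ≡⟨ solve 3 (λ m w Q → m :* (Q :* (con 2 :* w)) := con 2 :* m :* w :* Q) refl m w Q ⟩
      2 * m * w * Q      ∎))

    private
      n²≤4m² : n * n ≤ 4 * (m * m)
      n²≤4m² = begin
        n * n                ≤⟨ ℕₚ.*-mono-≤ n≤2m n≤2m ⟩
        2 * m * (2 * m)      ≡⟨ solve 1 (λ m → con 2 :* m :* (con 2 :* m) := con 4 :* (m :* m)) refl m ⟩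
        4 * (m * m)          ∎

    -- Cancels ε⁴ ≤ 16 from the hypothesis on q; hence the factor 16 there.
    Kdm³<qn³ : K * d * m ^ 3 < q * n ^ 3
    Kdm³<qn³ = ℕₚ.*-cancelˡ-< (16 * m ^ 4) (K * d * m ^ 3) (q * n ^ 3) (begin-strict
      16 * m ^ 4 * (K * d * m ^ 3)
        ≡⟨ solve 3 (λ K d m → con 16 :* m :↑ 4 :* (K :* d :* m :↑ 3) := con 16 :* K :* d :* m :↑ 7) refl K d m ⟩
      16 * K * d * m ^ 7
        <⟨ large ⟩
      q * n ^ 7
        ≡⟨ solve 2 (λ q n → q :* n :↑ 7 := (n :* n) :* (n :* n) :* (q :* n :↑ 3)) refl q n ⟩
      (n * n) * (n * n) * (q * n ^ 3)
        ≤⟨ ℕₚ.*-monoˡ-≤ (q * n ^ 3) (ℕₚ.*-mono-≤ n²≤4m² n²≤4m²) ⟩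
      (4 * (m * m)) * (4 * (m * m)) * (q * n ^ 3)
        ≡⟨ cong (_* (q * n ^ 3)) (solve 1 (λ m → (con 4 :* (m :* m)) :* (con 4 :* (m :* m)) := con 16 :* m :↑ 4) refl m) ⟩
      16 * m ^ 4 * (q * n ^ 3) ∎)

    private
      instance
        m²≢0 : NonZero (4 * (m * m))
        m²≢0 = ℕₚ.m*n≢0 4 (m * m) {{_}} {{ℕₚ.m*n≢0 m m}}

      32m≤Kdm : 8 * m * 4 ≤ K * d * m
      32m≤Kdm = begin
        8 * m * 4       ≡⟨ solve 1 (λ m → con 8 :* m :* con 4 := con 32 :* m) refl m ⟩
        32 * m          ≤⟨ ℕₚ.*-monoˡ-≤ m 32≤Kd ⟩
        K * d * m       ∎
        where
        32≤Kd : 32 ≤ K * d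
        32≤Kd = ℕₚ.≤-trans (subst (32 ≤_) (sym K-eq) (ℕₚ.m≤n*m 32 4096)) (ℕₚ.m≤m*n K d)

    -- That is, εq ≥ 8, from qε³ > K d ≥ 32 and ε² ≤ 4. It keeps the rounded threshold `T` positive.
    8m≤nq : 8 * m ≤ n * q
    8m≤nq = ℕₚ.<⇒≤ (ℕₚ.*-cancelˡ-< (4 * (m * m)) (8 * m) (n * q) (begin-strict
      4 * (m * m) * (8 * m)      ≡⟨ solve 1 (λ m → con 4 :* (m :* m) :* (con 8 :* m) := con 8 :* m :* con 4 :* (m :* m)) refl m ⟩
      8 * m * 4 * (m * m)        ≤⟨ ℕₚ.*-monoˡ-≤ (m * m) 32m≤Kdm ⟩
      K * d * m * (m * m)        ≡⟨ solve 3 (λ K d m → K :* d :* m :* (m :* m) := K :* d :* m :↑ 3) refl K d m ⟩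
      K * d * m ^ 3              <⟨ Kdm³<qn³ ⟩
      q * n ^ 3                  ≡⟨ solve 2 (λ q n → q :* n :↑ 3 := n :* n :* (n :* q)) refl q n ⟩
      n * n * (n * q)            ≤⟨ ℕₚ.*-monoˡ-≤ (n * q) n²≤4m² ⟩
      4 * (m * m) * (n * q)      ∎))

    -- The 8 collects three factors of 2: the graph has 2q² vertices, q² - 1 is estimated by q²/2,
    -- and half of what remains is reserved for the vertical directions.
    T : ℕ
    T = n * q / (8 * m)

    private
      T8m≤nq : T * (8 * m) ≤ n * q
      T8m≤nq = m/n*n≤m (n * q) (8 * m)

      nq<[1+T]8m : n * q < suc T * (8 * m)
      nq<[1+T]8m = n<[1+n/k]*k (n * q) (8 * m)

    1≤T : 1 ≤ T
    1≤T = ℕ.s≤s⁻¹ (ℕₚ.*-cancelʳ-< (8 * m) 1 (suc T) (begin-strict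
      1 * (8 * m)      ≡⟨ ℕₚ.*-identityˡ _ ⟩
      8 * m            ≤⟨ 8m≤nq ⟩
      n * q            <⟨ nq<[1+T]8m ⟩
      suc T * (8 * m)  ∎))

    -- Rounding down a number that is at least 1 loses at most a factor 2.
    nq≤16mT : n * q ≤ 16 * m * T
    nq≤16mT = begin
      n * q                ≤⟨ ℕₚ.<⇒≤ nq<[1+T]8m ⟩
      (1 + T) * (8 * m)    ≤⟨ ℕₚ.*-monoˡ-≤ (8 * m) (ℕₚ.+-monoˡ-≤ T 1≤T) ⟩
      (T + T) * (8 * m)    ≡⟨ solve 2 (λ T m → (T :+ T) :* (con 8 :* m) := con 16 :* m :* T) refl T m ⟩
      16 * m * T           ∎

    -- Here 4096 is 16³, from cubing `nq≤16mT`; the remaining 32 d is the reciprocal density of the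
    -- monomial box.
    32dQ<T³ : 32 * d * (q * q) < T * (T * T)
    32dQ<T³ = ℕₚ.*-cancelˡ-< (4096 * m ^ 3) (32 * d * Q) (T * (T * T)) (begin-strict
      4096 * m ^ 3 * (32 * d * Q)
        ≡⟨ solve 5 (λ k l d m Q → k :* m :↑ 3 :* (l :* d :* Q) := k :* l :* d :* m :↑ 3 :* Q) refl 4096 32 d m Q ⟩
      4096 * 32 * d * m ^ 3 * Q
        ≡⟨ cong (λ K → K * d * m ^ 3 * Q) K-eq ⟨
      K * d * m ^ 3 * Q
        <⟨ ℕₚ.*-monoˡ-< Q Kdm³<qn³ ⟩
      q * n ^ 3 * Q
        ≡⟨ solve 2 (λ q n → q :* n :↑ 3 :* (q :* q) := n :* q :* (n :* q :* (n :* q))) refl q n ⟩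
      n * q * (n * q * (n * q))
        ≤⟨ ℕₚ.*-mono-≤ nq≤16mT (ℕₚ.*-mono-≤ nq≤16mT nq≤16mT) ⟩
      16 * m * T * (16 * m * T * (16 * m * T))
        ≡⟨ solve 2 (λ m T → con 16 :* m :* T :* (con 16 :* m :* T :* (con 16 :* m :* T))
             := con 4096 :* m :↑ 3 :* (T :* (T :* T))) refl m T ⟩
      4096 * m ^ 3 * (T * (T * T)) ∎)

    -- The budget `T` is split into T/4 for x, T/4 for y and T/2 for z, whose powers weigh `d` each.
    -- Counting the exponent 0 rounds upwards, so s²r is at least (T/4)² · T/(2d) = T³/(32 d).
    s r : ℕ
    s = suc (T / 4)
    r = suc (T / (2 * d))

    fits : ∀ i j k → i < s → j < s → k < r → i + (j + k * d) ≤ T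
    fits i j k (s≤s i≤) (s≤s j≤) (s≤s k≤) = ℕₚ.*-cancelˡ-≤ 4 (begin
      4 * (i + (j + k * d))
        ≡⟨ solve 4 (λ i j k d → con 4 :* (i :+ (j :+ k :* d))
             := i :* con 4 :+ (j :* con 4 :+ con 2 :* (k :* (con 2 :* d)))) refl i j k d ⟩
      i * 4 + (j * 4 + 2 * (k * (2 * d)))
        ≤⟨ ℕₚ.+-mono-≤ (4*≤T i≤) (ℕₚ.+-mono-≤ (4*≤T j≤) (ℕₚ.*-monoʳ-≤ 2
             (ℕₚ.≤-trans (ℕₚ.*-monoˡ-≤ (2 * d) k≤) (m/n*n≤m T (2 * d))))) ⟩
      T + (T + 2 * T)
        ≡⟨ solve 1 (λ T → T :+ (T :+ con 2 :* T) := con 4 :* T) refl T ⟩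
      4 * T ∎)
      where
      4*≤T : ∀ {i} → i ≤ T / 4 → i * 4 ≤ T
      4*≤T i≤ = ℕₚ.≤-trans (ℕₚ.*-monoˡ-≤ 4 i≤) (m/n*n≤m T 4)

    big : q * q < s * (s * r)
    big = ℕₚ.*-cancelˡ-< (32 * d) Q (s * (s * r)) (begin-strict
      32 * d * Q
        <⟨ 32dQ<T³ ⟩
      T * (T * T)
        ≤⟨ ℕₚ.*-mono-≤ T≤4s (ℕₚ.*-mono-≤ T≤4s (ℕₚ.<⇒≤ (n<[1+n/k]*k T (2 * d)))) ⟩
      s * 4 * (s * 4 * (r * (2 * d)))
        ≡⟨ solve 3 (λ s r d → s :* con 4 :* (s :* con 4 :* (r :* (con 2 :* d))) := con 32 :* d :* (s :* (s :* r))) refl s r d ⟩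
      32 * d * (s * (s * r)) ∎)
      where
      T≤4s : T ≤ s * 4
      T≤4s = ℕₚ.<⇒≤ (n<[1+n/k]*k T 4)

    dense : T * (q * q + q * q) < N
    dense = ℕₚ.*-cancelˡ-< (4 * m * q) (T * (Q + Q)) N (ℕₚ.+-cancelˡ-< (4 * m * (q * Q)) _ _ (begin-strict
      4 * m * (q * Q) + 4 * m * q * (T * (Q + Q))
        ≡⟨ solve 4 (λ m q T Q → con 4 :* m :* (q :* Q) :+ con 4 :* m :* q :* (T :* (Q :+ Q))
             := (T :* (con 8 :* m) :* q :+ con 4 :* m :* q) :* Q) refl m q T Q ⟩
      (T * (8 * m) * q + 4 * m * q) * Q
        -- One half of the accepted pairs covers the threshold `T` at all 2q² vertices, the other
        -- half the vertical directions.
        <⟨ ℕₚ.*-monoˡ-< Q (ℕₚ.+-mono-≤-< first second) ⟩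
      (2 * (n * w) + 2 * (n * w)) * Q
        ≡⟨ solve 3 (λ n w Q → (con 2 :* (n :* w) :+ con 2 :* (n :* w)) :* Q := con 4 :* (n :* (Q :* w))) refl n w Q ⟩
      4 * (n * (Q * w))
        ≤⟨ ℕₚ.*-monoʳ-≤ 4 (ℕₚ.≤-trans passes (ℕₚ.*-monoʳ-≤ m ldt≤)) ⟩
      4 * (m * (Q * q + q * N))
        ≡⟨ solve 4 (λ m q Q N → con 4 :* (m :* (Q :* q :+ q :* N)) := con 4 :* m :* (q :* Q) :+ con 4 :* m :* q :* N) refl m q Q N ⟩
      4 * m * (q * Q) + 4 * m * q * N ∎))
      where
      nqq≤2nw : n * q * q ≤ 2 * (n * w)
      nqq≤2nw = begin
        n * q * q      ≡⟨ ℕₚ.*-assoc n q q ⟩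
        n * Q          ≤⟨ ℕₚ.*-monoʳ-≤ n Q≤2w ⟩
        n * (2 * w)    ≡⟨ solve 2 (λ n w → n :* (con 2 :* w) := con 2 :* (n :* w)) refl n w ⟩
        2 * (n * w)    ∎
      first : T * (8 * m) * q ≤ 2 * (n * w)
      first = ℕₚ.≤-trans (ℕₚ.*-monoˡ-≤ q T8m≤nq) nqq≤2nw
      4m<nq : 4 * m < n * q
      4m<nq = ℕₚ.<-≤-trans (ℕₚ.*-monoˡ-< m {4} {8} (ℕₚ.m≤m+n 5 3)) 8m≤nq
      second : 4 * m * q < 2 * (n * w)
      second = ℕₚ.<-≤-trans (ℕₚ.*-monoˡ-< q 4m<nq) nqq≤2nw

    -- From ε²q² ≤ 256 T² and ε² ≤ 4; this is the origin of c = 1/1024.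
    n⁴Q≤1024m⁴T² : n ^ 4 * (q * q) ≤ 1024 * m ^ 4 * (T * T)
    n⁴Q≤1024m⁴T² = begin
      n ^ 4 * (q * q)
        ≡⟨ solve 2 (λ n q → n :↑ 4 :* (q :* q) := n :* n :* (n :* q :* (n :* q))) refl n q ⟩
      n * n * (n * q * (n * q))
        ≤⟨ ℕₚ.*-mono-≤ n²≤4m² (ℕₚ.*-mono-≤ nq≤16mT nq≤16mT) ⟩
      4 * (m * m) * (16 * m * T * (16 * m * T))
        ≡⟨ solve 2 (λ m T → con 4 :* (m :* m) :* (con 16 :* m :* T :* (con 16 :* m :* T)) := con 1024 :* m :↑ 4 :* (T :* T)) refl m T ⟩
      1024 * m ^ 4 * (T * T) ∎

-- Clearing denominators and conclusion.

open import Data.Rational as ℚ using (ℚ; _<_; _≤_; _*_; 0ℚ)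
import Data.Rational.Properties as ℚₚ
import Data.Rational.Unnormalised as ℚᵘ
import Data.Rational.Unnormalised.Properties as ℚᵘₚ

open CommutativeSemigroupProperties (CommutativeMonoid.commutativeSemigroup ℚₚ.*-1-commutativeMonoid)
  using () renaming (interchange to *-interchange)

private
  fraction : ℕ → ℚᵘ.ℚᵘ
  fraction n = ℚᵘ.mkℚᵘ (ℤ.+ n) 0

  toℚᵘ-ℕ : ∀ n → ℚ.toℚᵘ (ℕtoℚ n) ℚᵘ.≃ fraction n
  toℚᵘ-ℕ n = ℚₚ.toℚᵘ-fromℚᵘ (fraction n)

ℕtoℚ-* : ∀ a b → ℕtoℚ (a *ₙ b) ≡ ℕtoℚ a * ℕtoℚ b
ℕtoℚ-* a b = ℚₚ.toℚᵘ-injective (begin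
  ℚ.toℚᵘ (ℕtoℚ (a *ₙ b))                       ≈⟨ toℚᵘ-ℕ (a *ₙ b) ⟩
  fraction (a *ₙ b)                            ≡⟨ cong (λ i → ℚᵘ.mkℚᵘ i 0) (ℤₚ.pos-* a b) ⟩
  fraction a ℚᵘ.* fraction b                   ≈⟨ ℚᵘₚ.*-cong (toℚᵘ-ℕ a) (toℚᵘ-ℕ b) ⟨
  ℚ.toℚᵘ (ℕtoℚ a) ℚᵘ.* ℚ.toℚᵘ (ℕtoℚ b)         ≈⟨ ℚₚ.toℚᵘ-homo-* (ℕtoℚ a) (ℕtoℚ b) ⟨
  ℚ.toℚᵘ (ℕtoℚ a * ℕtoℚ b)                     ∎)
  where open ℚᵘₚ.≃-Reasoning

ℕtoℚ-mono-≤ : ∀ {a b} → a ℕ.≤ b → ℕtoℚ a ≤ ℕtoℚ b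
ℕtoℚ-mono-≤ {a} {b} a≤b = ℚₚ.toℚᵘ-cancel-≤ (ℚᵘₚ.≤-respˡ-≃ (ℚᵘₚ.≃-sym (toℚᵘ-ℕ a))
  (ℚᵘₚ.≤-respʳ-≃ (ℚᵘₚ.≃-sym (toℚᵘ-ℕ b)) (ℚᵘ.*≤* (ℤₚ.*-monoʳ-≤-nonNeg (ℤ.+ 1) (ℤ.+≤+ a≤b)))))

ℕtoℚ-mono-< : ∀ {a b} → a ℕ.< b → ℕtoℚ a < ℕtoℚ b
ℕtoℚ-mono-< {a} {b} a<b = ℚₚ.toℚᵘ-cancel-< (ℚᵘₚ.<-respˡ-≃ (ℚᵘₚ.≃-sym (toℚᵘ-ℕ a))
  (ℚᵘₚ.<-respʳ-≃ (ℚᵘₚ.≃-sym (toℚᵘ-ℕ b)) (ℚᵘ.*<* (ℤₚ.*-monoʳ-<-pos (ℤ.+ 1) (ℤ.+<+ a<b)))))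

ℕtoℚ-cancel-≤ : ∀ {a b} → ℕtoℚ a ≤ ℕtoℚ b → a ℕ.≤ b
ℕtoℚ-cancel-≤ {a} {b} a≤b = ℕₚ.≮⇒≥ (λ b<a → ℚₚ.<-irrefl refl (ℚₚ.<-≤-trans (ℕtoℚ-mono-< b<a) a≤b))

ℕtoℚ-cancel-< : ∀ {a b} → ℕtoℚ a < ℕtoℚ b → a ℕ.< b
ℕtoℚ-cancel-< {a} {b} a<b = ℕₚ.≰⇒> (λ b≤a → ℚₚ.<-irrefl refl (ℚₚ.<-≤-trans a<b (ℕtoℚ-mono-≤ b≤a)))

fraction-of : ∀ ε → 0ℚ < ε → ∃ λ n → ∃ λ m → 0 ℕ.< n × 0 ℕ.< m × ε * ℕtoℚ m ≡ ℕtoℚ n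
fraction-of (ℚ.mkℚ (ℤ.+ zero) m-1 c) (ℚ.*<* (ℤ.+<+ ()))
fraction-of ε@(ℚ.mkℚ (ℤ.+ suc n-1) m-1 c) _ = n , m , s≤s z≤n , s≤s z≤n , ℚₚ.toℚᵘ-injective (begin
  ℚ.toℚᵘ (ε * ℕtoℚ m)                ≈⟨ ℚₚ.toℚᵘ-homo-* ε (ℕtoℚ m) ⟩
  ℚ.toℚᵘ ε ℚᵘ.* ℚ.toℚᵘ (ℕtoℚ m)      ≈⟨ ℚᵘₚ.*-cong (ℚᵘₚ.≃-refl {ℚ.toℚᵘ ε}) (toℚᵘ-ℕ m) ⟩
  ℚ.toℚᵘ ε ℚᵘ.* fraction m           ≈⟨ ℚᵘ.*≡* (trans (ℤₚ.*-identityʳ _)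
                                          (cong (λ k → ℤ.+ n ℤ.* ℤ.+ k) (sym (ℕₚ.*-identityʳ m)))) ⟩
  fraction n                         ≈⟨ toℚᵘ-ℕ n ⟨
  ℚ.toℚᵘ (ℕtoℚ n)                    ∎)
  where
  open ℚᵘₚ.≃-Reasoning
  n = suc n-1
  m = suc m-1

powℚ-clear : ∀ ε n m → ε * ℕtoℚ m ≡ ℕtoℚ n → ∀ k → powℚ ε k * ℕtoℚ (m ℕ.^ k) ≡ ℕtoℚ (n ℕ.^ k)
powℚ-clear ε n m eq zero    = refl
powℚ-clear ε n m eq (suc k) = begin
  ε * powℚ ε k * ℕtoℚ (m *ₙ m ℕ.^ k)                  ≡⟨ cong (ε * powℚ ε k *_) (ℕtoℚ-* m (m ℕ.^ k)) ⟩
  ε * powℚ ε k * (ℕtoℚ m * ℕtoℚ (m ℕ.^ k))            ≡⟨ *-interchange ε (powℚ ε k) (ℕtoℚ m) _ ⟩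
  ε * ℕtoℚ m * (powℚ ε k * ℕtoℚ (m ℕ.^ k))            ≡⟨ cong₂ _*_ eq (powℚ-clear ε n m eq k) ⟩
  ℕtoℚ n * ℕtoℚ (n ℕ.^ k)                             ≡⟨ ℕtoℚ-* n (n ℕ.^ k) ⟨
  ℕtoℚ (n *ₙ n ℕ.^ k)                                 ∎
  where
  open ≡-Reasoning

1<q : ∀ 𝔽 → 1 ℕ.< FiniteField.q 𝔽
1<q 𝔽 = subst (1 ℕ.<_) length-elems (unique-⊆-length ((0≢1 ∷ []) ∷ [] ∷ []) (λ {x} _ → ∈-elems x))
  where
  open Field 𝔽
  open Enumeration 𝔽

private
  -- 131072 = 4096 · 32, which makes T³ > 32 d q² in Arithmetic.Parameters.
  K : ℕ
  K = 131072

  positive-ℕ : ∀ n .{{_ : NonZero n}} → ℚ.Positive (ℕtoℚ n)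
  positive-ℕ n = ℚ.positive (ℕtoℚ-mono-< {0} {n} (ℕ.>-nonZero⁻¹ n))

module _ (ε : ℚ) (n m : ℕ) (0<n : 0 ℕ.< n) (0<m : 0 ℕ.< m) (ε-eq : ε * ℕtoℚ m ≡ ℕtoℚ n)
         (d : ℕ) (0<d : 0 ℕ.< d) (𝔽 : FiniteField) where
  private
    q = FiniteField.q 𝔽
    instance
      m≢0 : NonZero m
      m≢0 = ℕ.>-nonZero 0<m

  clear-large : ℕtoℚ (16 *ₙ K) * ℕtoℚ d < ℕtoℚ q * powℚ ε 7 → 16 *ₙ K *ₙ d *ₙ m ℕ.^ 7 ℕ.< q *ₙ n ℕ.^ 7
  clear-large large = ℕtoℚ-cancel-< (subst₂ _<_ lhs rhs (ℚₚ.*-monoˡ-<-pos (ℕtoℚ (m ℕ.^ 7)) {{positive-ℕ (m ℕ.^ 7)}} large))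
    where
    instance
      m⁷≢0 : NonZero (m ℕ.^ 7)
      m⁷≢0 = ℕₚ.m^n≢0 m 7
    lhs : ℕtoℚ (16 *ₙ K) * ℕtoℚ d * ℕtoℚ (m ℕ.^ 7) ≡ ℕtoℚ (16 *ₙ K *ₙ d *ₙ m ℕ.^ 7)
    lhs = trans (cong (_* ℕtoℚ (m ℕ.^ 7)) (sym (ℕtoℚ-* (16 *ₙ K) d))) (sym (ℕtoℚ-* (16 *ₙ K *ₙ d) (m ℕ.^ 7)))
    rhs : ℕtoℚ q * powℚ ε 7 * ℕtoℚ (m ℕ.^ 7) ≡ ℕtoℚ (q *ₙ n ℕ.^ 7)
    rhs = trans (ℚₚ.*-assoc (ℕtoℚ q) (powℚ ε 7) _)
      (trans (cong (ℕtoℚ q *_) (powℚ-clear ε n m ε-eq 7)) (sym (ℕtoℚ-* q (n ℕ.^ 7))))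

  clear-passes : ∀ X Y → ε * ℕtoℚ X ≤ ℕtoℚ Y → n *ₙ X ℕ.≤ m *ₙ Y
  clear-passes X Y passes = ℕtoℚ-cancel-≤ (subst₂ _≤_ lhs (sym (ℕtoℚ-* m Y))
    (ℚₚ.*-monoˡ-≤-nonNeg (ℕtoℚ m) {{ℚₚ.pos⇒nonNeg (ℕtoℚ m) {{positive-ℕ m}}}} passes))
    where
    lhs : ℕtoℚ m * (ε * ℕtoℚ X) ≡ ℕtoℚ (n *ₙ X)
    lhs = trans (sym (ℚₚ.*-assoc (ℕtoℚ m) ε _)) (trans (cong (_* ℕtoℚ X) (trans (ℚₚ.*-comm (ℕtoℚ m) ε) ε-eq))
      (sym (ℕtoℚ-* n X)))

  clear-conclusion : ∀ X Y → n ℕ.^ 4 *ₙ X ℕ.≤ 1024 *ₙ m ℕ.^ 4 *ₙ Y →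
                     (ℤ.+ 1 ℚ./ 1024) * powℚ ε 4 * ℕtoℚ X ≤ ℕtoℚ Y
  clear-conclusion X Y bound = ℚₚ.*-cancelˡ-≤-pos (ℕtoℚ (1024 *ₙ m ℕ.^ 4)) {{positive-ℕ (1024 *ₙ m ℕ.^ 4)}}
    (subst₂ _≤_ (sym lhs) (ℕtoℚ-* (1024 *ₙ m ℕ.^ 4) Y) (ℕtoℚ-mono-≤ bound))
    where
    open ≡-Reasoning
    c = ℤ.+ 1 ℚ./ 1024
    instance
      m⁴≢0 : NonZero (1024 *ₙ m ℕ.^ 4)
      m⁴≢0 = ℕₚ.m*n≢0 1024 (m ℕ.^ 4) {{_}} {{ℕₚ.m^n≢0 m 4}}
    lhs : ℕtoℚ (1024 *ₙ m ℕ.^ 4) * (c * powℚ ε 4 * ℕtoℚ X) ≡ ℕtoℚ (n ℕ.^ 4 *ₙ X)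
    lhs = begin
      ℕtoℚ (1024 *ₙ m ℕ.^ 4) * (c * powℚ ε 4 * ℕtoℚ X)          ≡⟨ ℚₚ.*-assoc (ℕtoℚ (1024 *ₙ m ℕ.^ 4)) _ _ ⟨
      ℕtoℚ (1024 *ₙ m ℕ.^ 4) * (c * powℚ ε 4) * ℕtoℚ X          ≡⟨ cong (λ u → u * (c * powℚ ε 4) * ℕtoℚ X) (ℕtoℚ-* 1024 (m ℕ.^ 4)) ⟩
      ℕtoℚ 1024 * ℕtoℚ (m ℕ.^ 4) * (c * powℚ ε 4) * ℕtoℚ X      ≡⟨ cong (_* ℕtoℚ X) (*-interchange (ℕtoℚ 1024) (ℕtoℚ (m ℕ.^ 4)) c (powℚ ε 4)) ⟩
      ℕtoℚ 1024 * c * (ℕtoℚ (m ℕ.^ 4) * powℚ ε 4) * ℕtoℚ X      ≡⟨ cong (λ u → u * ℕtoℚ X) (trans (ℚₚ.*-identityˡ _) (ℚₚ.*-comm _ (powℚ ε 4))) ⟩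
      powℚ ε 4 * ℕtoℚ (m ℕ.^ 4) * ℕtoℚ X                        ≡⟨ cong (_* ℕtoℚ X) (powℚ-clear ε n m ε-eq 4) ⟩
      ℕtoℚ (n ℕ.^ 4) * ℕtoℚ X                                   ≡⟨ ℕtoℚ-* (n ℕ.^ 4) X ⟨
      ℕtoℚ (n ℕ.^ 4 *ₙ X)                                       ∎

  module _ (f : Point 𝔽 → FiniteField.Carrier 𝔽) (P : Point 𝔽 → Point 𝔽 → Point 𝔽 → FiniteField.Carrier 𝔽)
           (bestFit : BestFit 𝔽 d f P)
           (large : ℕtoℚ (16 *ₙ K) * ℕtoℚ d < ℕtoℚ q * powℚ ε 7)
           (passes : ε * ℕtoℚ (q *ₙ q *ₙ (q *ₙ q ∸ 1)) ≤ ℕtoℚ (ldtAccepting 𝔽 f P)) where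
    open Enumeration 𝔽
    open LowDegreeTest 𝔽 d 0<d f P bestFit

    ldt≤q⁴ : ldtAccepting 𝔽 f P ℕ.≤ q *ₙ q *ₙ (q *ₙ q)
    ldt≤q⁴ = ℕₚ.≤-trans (length-filter accepts? (concatMap (λ a → map (λ u → (a , u)) (points 𝔽)) (points 𝔽))) (ℕₚ.≤-reflexive
      (trans (cong length (concatMap-pairs (points 𝔽) (points 𝔽)))
        (trans (length-cartesianProduct (points 𝔽) (points 𝔽)) (cong₂ _*ₙ_ length-points length-points))))

    -- The number of edges does not depend on the threshold of `Bipartite`, so 0 serves as a
    -- placeholder: `T` becomes available only from `Parameters`, which take this count as input.
    edgeCount : ℕ
    edgeCount = Bipartite.edges E? 0 (points 𝔽) (points 𝔽)

    open Arithmetic.Parameters n m q d 0<n 0<m (1<q 𝔽) 0<d K refl (clear-large large) (ldtAccepting 𝔽 f P) edgeCount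
      (clear-passes _ _ passes) (ldt-bound 0) ldt≤q⁴

    close-polynomial : ∃ λ Q → (ℤ.+ 1 ℚ./ 1024) * powℚ ε 4 * ℕtoℚ (q *ₙ q) ≤ ℕtoℚ (agreeCount 𝔽 d f Q)
    close-polynomial = conclude (many-agreements T 1≤T s r fits big dense)
      where
      conclude : (∃ λ Q → T *ₙ T ℕ.≤ agreeCount 𝔽 d f Q) →
                 ∃ λ Q → (ℤ.+ 1 ℚ./ 1024) * powℚ ε 4 * ℕtoℚ (q *ₙ q) ≤ ℕtoℚ (agreeCount 𝔽 d f Q)
      conclude (Q , agree) = Q , clear-conclusion (q *ₙ q) (agreeCount 𝔽 d f Q)
        (ℕₚ.≤-trans n⁴Q≤1024m⁴T² (ℕₚ.*-monoʳ-≤ (1024 *ₙ m ℕ.^ 4) agree))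

theorem4p2 : ∃ λ (C : ℚ) → ∃ λ (c : ℚ) → 0ℚ < C × 0ℚ < c ×
    (∀ (ε : ℚ) → 0ℚ < ε → ∀ (d : ℕ) → .{{_ : NonZero d}} → ∀ (𝔽 : FiniteField) →
    C * ℕtoℚ d < ℕtoℚ (FiniteField.q 𝔽) * powℚ ε 7 →
    ∀ (f : Point 𝔽 → FiniteField.Carrier 𝔽) →
    ∀ (P : Point 𝔽 → Point 𝔽 → Point 𝔽 → FiniteField.Carrier 𝔽) →
    BestFit 𝔽 d f P →
    ε * ℕtoℚ (FiniteField.q 𝔽 *ₙ FiniteField.q 𝔽 *ₙ (FiniteField.q 𝔽 *ₙ FiniteField.q 𝔽 ∸ 1))
    ≤ ℕtoℚ (ldtAccepting 𝔽 f P) →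
    ∃ λ (Q : ℕ → ℕ → FiniteField.Carrier 𝔽) →
    c * powℚ ε 4 * ℕtoℚ (FiniteField.q 𝔽 *ₙ FiniteField.q 𝔽)
    ≤ ℕtoℚ (agreeCount 𝔽 d f Q))
theorem4p2 = ℕtoℚ (16 *ₙ K) , ℤ.+ 1 ℚ./ 1024 , ℕtoℚ-mono-< {0} {16 *ₙ K} (s≤s z≤n) , ℚₚ.positive⁻¹ (ℤ.+ 1 ℚ./ 1024) ,
  λ ε 0<ε d 𝔽 large f P bestFit passes → conclude ε d 𝔽 f P bestFit large passes (fraction-of ε 0<ε)
  where
  conclude : ∀ ε d .{{_ : NonZero d}} 𝔽 f P → BestFit 𝔽 d f P →
             ℕtoℚ (16 *ₙ K) * ℕtoℚ d < ℕtoℚ (FiniteField.q 𝔽) * powℚ ε 7 →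
             ε * ℕtoℚ (FiniteField.q 𝔽 *ₙ FiniteField.q 𝔽 *ₙ (FiniteField.q 𝔽 *ₙ FiniteField.q 𝔽 ∸ 1))
               ≤ ℕtoℚ (ldtAccepting 𝔽 f P) →
             (∃ λ n → ∃ λ m → 0 ℕ.< n × 0 ℕ.< m × ε * ℕtoℚ m ≡ ℕtoℚ n) →
             ∃ λ Q → (ℤ.+ 1 ℚ./ 1024) * powℚ ε 4 * ℕtoℚ (FiniteField.q 𝔽 *ₙ FiniteField.q 𝔽)
                       ≤ ℕtoℚ (agreeCount 𝔽 d f Q)
  conclude ε d 𝔽 f P bestFit large passes (n , m , 0<n , 0<m , ε-eq) =
    close-polynomial ε n m 0<n 0<m ε-eq d (ℕ.>-nonZero⁻¹ d) 𝔽 f P bestFit large passes
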